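{- Let $p$ be an odd prime and $G\in\mathcal{F}_n^p$, with walk matrix $W$. Then $G$ is not DGS if and only if every nontrivial integral solution $z$ (i.e., $z\not\equiv0\pmod p$) of $W^{\mathrm T}z\equiv 0\pmod p$ can generate some primitive matrix.
   Context: Graphs are finite, simple, undirected. For a graph $G$ on $n$ vertices with adjacency matrix $A$, $W=W(G)=[e,Ae,\ldots,A^{n-1}e]$ with $e$ the all-one vector. Two graphs are generalized cospectral if their adjacency matrices have the same spectrum and the adjacency matrices of their complements have the same spectrum; $G$ is DGS if every graph generalized cospectral with $G$ is isomorphic to $G$. $\mathcal{F}_n$ is the family of graphs on $n$ vertices whose walk matrix has Smith normal form $\mathrm{diag}[1,\ldots,1,2,\ldots,2,2p^2b]$ ($\lceil n/2\rceil$ ones followed by $\lfloor n/2\rfloor$ entries $2,\ldots,2,2p^2b$), where $b$ is odd and square-free, $p$ is an odd prime and $p\nmid b$; $\mathcal{F}_n^p=\{G\in\mathcal{F}_n:p^2\mid\det W\}$. An orthogonal matrix $Q$ is regular if $Qe=e$; the level of a rational matrix $Q$ is the least positive integer $k$ with $kQ$ integral. A primitive matrix is a regular rational orthogonal matrix $Q$ of level $p$ with $\mathrm{rank}(pQ)=1$ over $\mathbb{F}_p$. An integral vector $v$ generates a primitive matrix $Q$ (of order equal to the dimension of $v$) if each column of $pQ$ is a multiple of $v$ over $\mathbb{F}_p$. -}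

module Defs where

open import Data.Nat as ℕ using (ℕ; zero; suc; ⌈_/2⌉)
open import Data.Nat.Primality using (Prime)
open import Data.Integer as ℤ using (ℤ; +_)
open import Data.Integer.Divisibility as ℤD using ()
open import Data.Rational as ℚ using (ℚ; 0ℚ; 1ℚ; ↥_; ↧ₙ_)
open import Data.Fin using (Fin; zero; suc; toℕ; punchIn; _≟_)
open import Data.Fin.Permutation using (Permutation′; _⟨$⟩ʳ_)
open import Data.Bool using (Bool; true; false; if_then_else_)
open import Data.Product using (_×_; ∃; ∃-syntax; _,_)
open import Data.Product.Base using (Σ-syntax)
open import Data.Sum using (_⊎_)
open import Relation.Nullary using (¬_; yes; no)
open import Relation.Binary.PropositionalEquality using (_≡_)

Matrix : Set → ℕ → Set
Matrix A n = Fin n → Fin n → A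

record RingOps (A : Set) : Set where
  field
    0# 1# : A
    _+_ _*_ : A → A → A
    -_ : A → A

module Lin {A : Set} (R : RingOps A) where
  open RingOps R

  sumF : ∀ {n} → (Fin n → A) → A
  sumF {zero}  f = 0#
  sumF {suc n} f = f zero + sumF (λ i → f (suc i))

  _·_ : ∀ {n} → Matrix A n → Matrix A n → Matrix A n
  (M · N) i j = sumF (λ k → M i k * N k j)

  δ : ∀ {n} → Fin n → Fin n → A
  δ i j with i ≟ j
  ... | yes _ = 1#
  ... | no  _ = 0#

  alt : ℕ → A → A
  alt zero x = x
  alt (suc k) x = - (alt k x)

  det : ∀ n → Matrix A n → A
  det zero    M = 1#
  det (suc n) M =
    sumF (λ j → alt (toℕ j) (M zero j * det n (λ i k → M (suc i) (punchIn j k))))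

ℤops : RingOps ℤ
ℤops = record { 0# = + 0 ; 1# = + 1 ; _+_ = ℤ._+_ ; _*_ = ℤ._*_ ; -_ = ℤ.-_ }

module LZ = Lin ℤops

detℤ : ∀ {n} → Matrix ℤ n → ℤ
detℤ {n} = LZ.det n

_≡_[mod_] : ℤ → ℤ → ℕ → Set
a ≡ b [mod p ] = (+ p) ℤD.∣ (a ℤ.- b)

-- Formal power series over ℤ (coefficient functions); ℤ[x] embeds in it,
-- so characteristic polynomials are compared coefficientwise.

PS : Set
PS = ℕ → ℤ

convUpTo : (ℕ → ℤ) → (ℕ → ℤ) → ℕ → ℕ → ℤ
convUpTo f g k zero    = f 0 ℤ.* g k
convUpTo f g k (suc i) = f (suc i) ℤ.* g (k ℕ.∸ suc i) ℤ.+ convUpTo f g k i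

PSops : RingOps PS
PSops = record
  { 0# = λ _ → + 0
  ; 1# = λ { zero → + 1 ; (suc _) → + 0 }
  ; _+_ = λ f g k → f k ℤ.+ g k
  ; _*_ = λ f g k → convUpTo f g k k
  ; -_ = λ f k → ℤ.- (f k)
  }

constPS : ℤ → PS
constPS c zero    = c
constPS c (suc _) = + 0

X : PS
X (suc zero) = + 1
X _          = + 0

charPoly : ∀ {n} → Matrix ℤ n → PS
charPoly {n} M = Lin.det PSops n (λ i j →
  Lin.δ PSops i j ⊕ constPS (ℤ.- (M i j)))
  where
  _⊕_ : PS → PS → PS
  d ⊕ c = λ k → (RingOps._*_ PSops d X) k ℤ.+ c k

-- same spectrum (for real symmetric matrices: same characteristic polynomial)
SameSpectrum : ∀ {n} → Matrix ℤ n → Matrix ℤ n → Set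
SameSpectrum M N = ∀ k → charPoly M k ≡ charPoly N k

record Graph (n : ℕ) : Set where
  field
    adj    : Fin n → Fin n → Bool
    sym    : ∀ i j → adj i j ≡ adj j i
    irrefl : ∀ i → adj i i ≡ false
open Graph public

adjMat : ∀ {n} → Graph n → Matrix ℤ n
adjMat G i j = if adj G i j then + 1 else + 0

compAdjMat : ∀ {n} → Graph n → Matrix ℤ n
compAdjMat G i j with i ≟ j
... | yes _ = + 0
... | no  _ = if adj G i j then + 0 else + 1

GenCospectral : ∀ {n} → Graph n → Graph n → Set
GenCospectral G H =
  SameSpectrum (adjMat G) (adjMat H) × SameSpectrum (compAdjMat G) (compAdjMat H)

Isomorphic : ∀ {n} → Graph n → Graph n → Set
Isomorphic {n} G H =
  Σ[ σ ∈ Permutation′ n ] (∀ i j → adj H (σ ⟨$⟩ʳ i) (σ ⟨$⟩ʳ j) ≡ adj G i j)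

DGS : ∀ {n} → Graph n → Set
DGS {n} G = (H : Graph n) → GenCospectral G H → Isomorphic G H

walkVec : ∀ {n} → Graph n → ℕ → Fin n → ℤ
walkVec G zero    i = + 1
walkVec G (suc k) i = LZ.sumF (λ j → adjMat G i j ℤ.* walkVec G k j)

W : ∀ {n} → Graph n → Matrix ℤ n
W G i k = walkVec G (toℕ k) i

Unimodular : ∀ {n} → Matrix ℤ n → Set
Unimodular U = detℤ U ≡ + 1 ⊎ detℤ U ≡ ℤ.- (+ 1)

HasSNF : ∀ {n} → Matrix ℤ n → (Fin n → ℤ) → Set
HasSNF M d = ∃[ U ] ∃[ V ] (Unimodular U × Unimodular V ×
  (∀ i j → LZ._·_ (LZ._·_ U M) V i j ≡ ℤ._*_ (LZ.δ i j) (d i)))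

snfF : (n p b : ℕ) → Fin n → ℤ
snfF n p b i with toℕ i ℕ.<? ⌈ n /2⌉
... | yes _ = + 1
... | no _ with suc (toℕ i) ℕ.≟ n
...   | yes _ = + (2 ℕ.* (p ℕ.* p) ℕ.* b)
...   | no _  = + 2

OddPrime : ℕ → Set
OddPrime p = Prime p × ¬ (2 Data.Nat.Divisibility.∣ p)
  where import Data.Nat.Divisibility

Odd : ℕ → Set
Odd b = ¬ (2 Data.Nat.Divisibility.∣ b)
  where import Data.Nat.Divisibility

SquareFree : ℕ → Set
SquareFree b = ∀ q → (q ℕ.* q) Data.Nat.Divisibility.∣ b → q ≡ 1
  where import Data.Nat.Divisibility

inF : ∀ {n} → Graph n → Set
inF {n} G = ∃[ b ] ∃[ q ] (Odd b × SquareFree b × OddPrime q ×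
  ¬ (q Data.Nat.Divisibility.∣ b) × HasSNF (W G) (snfF n q b))
  where import Data.Nat.Divisibility

inFp : ∀ {n} → ℕ → Graph n → Set
inFp p G = inF G × (+ (p ℕ.* p)) ℤD.∣ detℤ (W G)

Lℚops : RingOps ℚ
Lℚops = record { 0# = 0ℚ ; 1# = 1ℚ ; _+_ = ℚ._+_ ; _*_ = ℚ._*_ ; -_ = ℚ.-_ }

module LQ = Lin Lℚops

Orthogonal : ∀ {n} → Matrix ℚ n → Set
Orthogonal Q = ∀ i j → LQ.sumF (λ k → Q k i ℚ.* Q k j) ≡ LQ.δ i j

Regular : ∀ {n} → Matrix ℚ n → Set
Regular Q = ∀ i → LQ.sumF (λ j → Q i j) ≡ 1ℚ

IntegralQ : ℚ → Set
IntegralQ q = ↧ₙ q ≡ 1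

scaleQ : ℕ → ℚ → ℚ
scaleQ k q = (+ k ℚ./ 1) ℚ.* q

IntegralMat : ∀ {n} → Matrix ℚ n → Set
IntegralMat Q = ∀ i j → IntegralQ (Q i j)

HasLevel : ∀ {n} → Matrix ℚ n → ℕ → Set
HasLevel Q k = 0 ℕ.< k × IntegralMat (λ i j → scaleQ k (Q i j)) ×
  (∀ m → 0 ℕ.< m → m ℕ.< k → ¬ IntegralMat (λ i j → scaleQ m (Q i j)))

-- the integer matrix pQ (meaningful when pQ is integral)
pQint : ∀ {n} → ℕ → Matrix ℚ n → Matrix ℤ n
pQint p Q i j = ↥ (scaleQ p (Q i j))

ColumnsMultipleOf : ∀ {n} → ℕ → Matrix ℤ n → (Fin n → ℤ) → Set
ColumnsMultipleOf p M v = ∀ j → ∃[ c ] (∀ i → M i j ≡ c ℤ.* v i [mod p ])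

RankOneModP : ∀ {n} → ℕ → Matrix ℤ n → Set
RankOneModP p M = (∃[ i ] ∃[ j ] ¬ (M i j ≡ + 0 [mod p ])) ×
  ∃[ u ] ColumnsMultipleOf p M u

Primitive : ∀ {n} → ℕ → Matrix ℚ n → Set
Primitive p Q = Regular Q × Orthogonal Q × HasLevel Q p × RankOneModP p (pQint p Q)

Generates : ∀ {n} → ℕ → (Fin n → ℤ) → Matrix ℚ n → Set
Generates p v Q = Primitive p Q × ColumnsMultipleOf p (pQint p Q) v

{-# OPTIONS --safe #-}

-- Write A for the adjacency matrix of G, e for the all-one vector and w_k = A^k e.  If H is
-- generalized cospectral with G, the numbers e^T A^k e agree for both graphs, so W(G)^T W(G) =
-- W(H)^T W(H) and Q = W(G) W(H)^{-1} is a regular rational orthogonal matrix with Q^T A Q = B.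
-- Clearing denominators gives an integral matrix M = l Q whose columns satisfy W^T x = 0 mod l.
--
-- The level l is 1 or p.  Let r^a be the exact power of an odd prime r dividing the last
-- invariant factor d, and let u be the last row of U in U W V = diag; modulo N = r^a the kernel
-- of W^T is spanned by u, and A u = c u.  If N divides l and x is a column of M that is nonzero
-- modulo r, then x is isotropic, so x = W g mod N, and x^T (A - c) x = (unit) * d mod N^2; but
-- x^T (A - c) x = 0 mod l^2, so N^2 divides d, a contradiction.  For r = 2, x and the first n/2
-- (for odd n, nonconstant) walk vectors all lie in the kernel modulo 2, of dimension n/2;
-- evaluating the resulting linear relation in the forms y^T A^k y modulo 4 shows that it is
-- trivial, because W^T W with its even rows halved has odd determinant.
--
-- If l = 1 then Q is a permutation matrix and H is isomorphic to G.  If l = p then Q is primitive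
-- and generated by every nontrivial kernel vector.  Conversely, for a primitive Q generated by u
-- the formula for x^T (A - c) y modulo p^2, with p^2 dividing d, makes Q^T A Q integral, hence
-- the adjacency matrix of a graph H; as W is invertible, an isomorphism from G to H would make Q
-- a permutation matrix.

module Submission where

open import Defs hiding (sym; irrefl; adj; X)
import Defs
open import Algebra.Bundles using (CommutativeMonoid)
open import Data.Bool using (Bool; true; false; if_then_else_)
open import Data.Fin using (Fin; zero; suc; toℕ; fromℕ; fromℕ<; inject₁; punchIn; punchOut; _≟_)
open import Data.Fin.Induction using (>-weakInduction)
open import Data.Fin.Permutation using (Permutation′; permutation; _⟨$⟩ʳ_; _⟨$⟩ˡ_; inverseʳ; inverseˡ)
import Data.Fin.Properties as Finₚ
import Data.Integer
open import Data.Integer as ℤ using (ℤ; +_; _+_; _*_; -_; _-_; ∣_∣)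
open import Data.Integer.DivMod using (a≡a%n+[a/n]*n; n%d<d) renaming (_/_ to _/ℤ_; _%_ to _%ℤ_)
import Data.Integer.Divisibility as ℤDiv
open import Data.Integer.Divisibility.Signed using (_∣_; divides; quotient)
import Data.Integer.Divisibility.Signed as ℤ∣
import Data.Integer.Properties as ℤₚ
open import Data.Integer.Tactic.RingSolver using (solve-∀)
open import Data.List using ([]; _∷_)
open import Data.List.Relation.Unary.All using (_∷_)
open import Data.Nat as ℕ using (ℕ; zero; suc; _^_; ⌈_/2⌉; ⌊_/2⌋)
open import Data.Nat.Coprimality using (Coprime; coprime-Bézout)
import Data.Nat.Coprimality as Coprimality
import Data.Nat.Divisibility as ℕ∣
open import Data.Nat.GCD using (module Bézout)
open import Data.Nat.Primality using (Prime; prime⇒irreducible; ¬prime[1]; prime⇒nonZero; prime[2])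
open import Data.Nat.Primality.Factorisation using (factorise; PrimeFactorisation)
import Data.Nat.Properties as ℕₚ
open import Data.Product using (_×_; _,_; ∃; ∃-syntax; proj₁; proj₂)
open import Data.Rational as ℚ using (ℚ; mkℚ; 1ℚ; ↥_; ↧ₙ_)
import Data.Rational.Properties as ℚₚ
open import Data.Sum using (_⊎_; inj₁; inj₂; [_,_]′)
open import Data.Vec.Functional using (insertAt)
open import Data.Vec.Functional.Properties using (insertAt-lookup; insertAt-punchIn)
open import Function.Base using (_∘_)
open import Function.Bundles using (_⇔_; mk⇔)
open import Relation.Binary.PropositionalEquality
open import Relation.Nullary using (¬_; Dec; yes; no; does; contradiction)
open import Relation.Nullary.Decidable using (map′; _×-dec_; ¬?)
open import Algebra.Properties.AbelianGroup ℤₚ.+-0-abelianGroup using (∙-cancelˡ)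
open import Algebra.Properties.CommutativeSemigroup (CommutativeMonoid.commutativeSemigroup ℚₚ.*-1-commutativeMonoid) using (interchange)
open ≡-Reasoning

open LZ using (δ; alt) renaming (sumF to ∑)

-- All arguments stay in the integers: rational identities are multiplied by a denominator, an
-- inverse of W becomes a matrix V with W V = L, and power series in t are cut off and read modulo a
-- power of t. The numbers e^T A^k e are recovered as follows. An odd prime divides at most the last
-- invariant factor, so the kernel modulo it has a single generator, on which A acts by a scalar.
-- Modulo 2 the kernel has dimension n/2 and no such scalar is available, whence the separate
-- argument. The prime p survives in the level because the odd argument asks that N^2 not divide d:
-- this fails for N = p and holds for N = p^2. A proof of `¬ DGS G` hands over no graph H. The
-- primitive matrix is therefore found by deciding whether one exists among the finitely many
-- integral matrices with entries between -p and p.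

private variable
  m n : ℕ

-- Finite sums of integers and the Kronecker delta.

∑-cong : {f g : Fin n → ℤ} → (∀ i → f i ≡ g i) → ∑ f ≡ ∑ g
∑-cong {zero}  h = refl
∑-cong {suc n} h = cong₂ _+_ (h zero) (∑-cong (h ∘ suc))

∑-zero : {f : Fin n → ℤ} → (∀ i → f i ≡ + 0) → ∑ f ≡ + 0
∑-zero {zero}  h = refl
∑-zero {suc n} h = cong₂ _+_ (h zero) (∑-zero (h ∘ suc))

+-interchange : ∀ a b c d → (a + b) + (c + d) ≡ (a + c) + (b + d)
+-interchange = solve-∀

∑-+ : (f g : Fin n → ℤ) → ∑ (λ i → f i + g i) ≡ ∑ f + ∑ g
∑-+ {zero}  f g = refl
∑-+ {suc n} f g = trans (cong (_+_ (f zero + g zero)) (∑-+ (f ∘ suc) (g ∘ suc)))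
  (+-interchange (f zero) (g zero) _ _)

∑-*ˡ : (c : ℤ) (f : Fin n → ℤ) → ∑ (λ i → c * f i) ≡ c * ∑ f
∑-*ˡ {zero}  c f = sym (ℤₚ.*-zeroʳ c)
∑-*ˡ {suc n} c f = trans (cong (_+_ (c * f zero)) (∑-*ˡ c (f ∘ suc)))
  (sym (ℤₚ.*-distribˡ-+ c (f zero) _))

∑-*ʳ : (c : ℤ) (f : Fin n → ℤ) → ∑ (λ i → f i * c) ≡ ∑ f * c
∑-*ʳ c f = trans (∑-cong (λ i → ℤₚ.*-comm (f i) c)) (trans (∑-*ˡ c f) (ℤₚ.*-comm c _))

∑-linear : (a b : ℤ) (f g : Fin n → ℤ) →
  ∑ (λ i → a * f i + b * g i) ≡ a * ∑ f + b * ∑ g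
∑-linear a b f g = trans (∑-+ (λ i → a * f i) (λ i → b * g i)) (cong₂ _+_ (∑-*ˡ a f) (∑-*ˡ b g))

∑-neg : (f : Fin n → ℤ) → ∑ (λ i → - f i) ≡ - ∑ f
∑-neg {zero}  f = refl
∑-neg {suc n} f = trans (cong (_+_ (- f zero)) (∑-neg (f ∘ suc)))
  (sym (ℤₚ.neg-distrib-+ (f zero) _))

∑-swap : (f : Fin m → Fin n → ℤ) → ∑ (λ i → ∑ (f i)) ≡ ∑ (λ j → ∑ (λ i → f i j))
∑-swap {zero}  {n} f = sym (∑-zero {n} (λ _ → refl))
∑-swap {suc m} f = trans (cong (_+_ (∑ (f zero))) (∑-swap (f ∘ suc)))
  (sym (∑-+ (f zero) (λ j → ∑ (λ i → f (suc i) j))))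

∑-snoc : (f : Fin (suc n) → ℤ) → ∑ f ≡ ∑ (f ∘ inject₁) + f (fromℕ n)
∑-snoc {zero}  f = ℤₚ.+-comm (f zero) (+ 0)
∑-snoc {suc n} f = trans (cong (_+_ (f zero)) (∑-snoc (f ∘ suc))) (sym (ℤₚ.+-assoc (f zero) _ _))

∑-punchIn : (j : Fin (suc n)) (f : Fin (suc n) → ℤ) → ∑ f ≡ f j + ∑ (f ∘ punchIn j)
∑-punchIn zero f = refl
∑-punchIn {suc n} (suc j) f = trans (cong (_+_ (f zero)) (∑-punchIn j (f ∘ suc))) (lemma (f zero) (f (suc j)) _)
  where
  lemma : ∀ a b c → a + (b + c) ≡ b + (a + c)
  lemma = solve-∀

∑-∣ : {N : ℤ} {f : Fin n → ℤ} → (∀ i → N ∣ f i) → N ∣ ∑ f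
∑-∣ {zero}  {N} h = divides (+ 0) refl
∑-∣ {suc n} h = ℤ∣.∣m∣n⇒∣m+n (h zero) (∑-∣ (h ∘ suc))

∑-const : (c : ℤ) → ∑ {n} (λ _ → c) ≡ + n * c
∑-const {zero}  c = refl
∑-const {suc n} c = trans (cong (_+_ c) (∑-const {n} c)) (sym (ℤₚ.suc-* (+ n) c))

δ-refl : (i : Fin n) → δ i i ≡ + 1
δ-refl i with i ≟ i
... | yes _   = refl
... | no  i≢i = contradiction refl i≢i

δ-≢ : {i j : Fin n} → i ≢ j → δ i j ≡ + 0
δ-≢ {i = i} {j} i≢j with i ≟ j
... | yes i≡j = contradiction i≡j i≢j
... | no  _   = refl

δ-sym : (i j : Fin n) → δ i j ≡ δ j i
δ-sym i j with i ≟ j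
... | yes refl = sym (δ-refl i)
... | no  i≢j  = sym (δ-≢ (i≢j ∘ sym))

δ-suc : (i j : Fin n) → δ (suc i) (suc j) ≡ δ i j
δ-suc i j with i ≟ j
... | yes _ = refl
... | no  _ = refl

∑-δˡ : (i : Fin n) (f : Fin n → ℤ) → ∑ (λ k → δ i k * f k) ≡ f i
∑-δˡ {suc n} zero f = trans (cong₂ _+_ (ℤₚ.*-identityˡ (f zero)) (∑-zero {n} (λ _ → refl))) (ℤₚ.+-identityʳ _)
∑-δˡ {suc n} (suc i) f = trans (ℤₚ.+-identityˡ _)
  (trans (∑-cong (λ k → cong (_* f (suc k)) (δ-suc i k))) (∑-δˡ i (f ∘ suc)))

∑-δʳ : (i : Fin n) (f : Fin n → ℤ) → ∑ (λ k → f k * δ k i) ≡ f i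
∑-δʳ i f = trans (∑-cong (λ k → trans (ℤₚ.*-comm (f k) _) (cong (_* f k) (δ-sym k i)))) (∑-δˡ i f)

-- Determinants

infixr 5 _◂_
_◂_ : {A : Set} → A → (Fin n → A) → Fin (suc n) → A
(x ◂ R) zero    = x
(x ◂ R) (suc i) = R i

record IsLinear (f : (Fin m → ℤ) → Fin n → ℤ) : Set where
  field
    map-cong   : ∀ {x y} → (∀ i → x i ≡ y i) → ∀ j → f x j ≡ f y j
    map-linear : ∀ a b x y j → f (λ i → a * x i + b * y i) j ≡ a * f x j + b * f y j

record IsFunctional (f : (Fin n → ℤ) → ℤ) : Set where
  field
    fun-cong   : ∀ {x y} → (∀ i → x i ≡ y i) → f x ≡ f y
    fun-linear : ∀ a b x y → f (λ i → a * x i + b * y i) ≡ a * f x + b * f y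

functional-expand : {f : (Fin n → ℤ) → ℤ} → IsFunctional f → ∀ x → f x ≡ ∑ (λ k → x k * f (δ k))
-- An empty vector equals `0 x + 0 x`, so linearity itself gives the value 0.
functional-expand {zero} L x = trans (fun-cong (λ ())) (fun-linear (+ 0) (+ 0) x x)
  where open IsFunctional L
functional-expand {suc n} {f} L x = begin
  f x ≡⟨ fun-cong split ⟩
  f (λ i → x zero * δ zero i + + 1 * (+ 0 ◂ x ∘ suc) i) ≡⟨ fun-linear (x zero) (+ 1) (δ zero) (+ 0 ◂ x ∘ suc) ⟩
  x zero * f (δ zero) + + 1 * f (+ 0 ◂ x ∘ suc) ≡⟨ cong (_+_ (x zero * f (δ zero))) (trans (ℤₚ.*-identityˡ _) (functional-expand tail (x ∘ suc))) ⟩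
  x zero * f (δ zero) + ∑ (λ k → x (suc k) * f (+ 0 ◂ δ k)) ≡⟨ cong (_+_ (x zero * f (δ zero))) (∑-cong (λ k → cong (x (suc k) *_) (fun-cong (unit k)))) ⟩
  x zero * f (δ zero) + ∑ (λ k → x (suc k) * f (δ (suc k))) ∎
  where
  open IsFunctional L
  one : ∀ a → a ≡ a * + 1 + + 1 * + 0
  one = solve-∀
  two : ∀ a b → b ≡ a * + 0 + + 1 * b
  two = solve-∀
  split : ∀ i → x i ≡ x zero * δ zero i + + 1 * (+ 0 ◂ x ∘ suc) i
  split zero    = one (x zero)
  split (suc i) = two (x zero) (x (suc i))
  unit : ∀ k i → (+ 0 ◂ δ k) i ≡ δ (suc k) i
  unit k zero    = refl
  unit k (suc i) = sym (δ-suc k i)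
  three : ∀ a b → + 0 ≡ a * + 0 + b * + 0
  three = solve-∀
  tail : IsFunctional (λ y → f (+ 0 ◂ y))
  tail = record
    { fun-cong   = λ h → fun-cong λ { zero → refl ; (suc i) → h i }
    ; fun-linear = λ a b y z → trans (fun-cong λ { zero → three a b ; (suc i) → refl })
        (fun-linear a b (+ 0 ◂ y) (+ 0 ◂ z))
    }

-- Product formula and adjugate identity are derived from the uniqueness of alternating multilinear
-- forms (`altForm-unique`), hence an arbitrary `F`. Row linearity compares three matrices that
-- agree off row `r`, pointwise. The numbers of rows and columns may differ, as they do once rows
-- are frozen by `fix-head`.
record IsAltForm (F : (Fin m → Fin n → ℤ) → ℤ) : Set where
  field
    form-cong   : ∀ {M N} → (∀ i j → M i j ≡ N i j) → F M ≡ F N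
    form-linear : ∀ r a b {M N P} → (∀ j → M r j ≡ a * N r j + b * P r j) →
      (∀ i → i ≢ r → ∀ j → M i j ≡ N i j) → (∀ i → i ≢ r → ∀ j → M i j ≡ P i j) →
      F M ≡ a * F N + b * F P
    alternating : ∀ {r s} M → r ≢ s → (∀ j → M r j ≡ M s j) → F M ≡ + 0

fix-head : {F : (Fin (suc m) → Fin n → ℤ) → ℤ} → IsAltForm F → ∀ x → IsAltForm (λ R → F (x ◂ R))
fix-head {F = F} A x = record
  { form-cong   = λ h → form-cong λ { zero j → refl ; (suc i) j → h i j }
  ; form-linear = λ r a b h h₁ h₂ → form-linear (suc r) a b h
      (λ { zero _ j → refl ; (suc i) i≢r j → h₁ i (i≢r ∘ cong suc) j })
      (λ { zero _ j → refl ; (suc i) i≢r j → h₂ i (i≢r ∘ cong suc) j })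
  ; alternating = λ M r≢s h → alternating (x ◂ M) (r≢s ∘ Finₚ.suc-injective) h
  }
  where open IsAltForm A

map-rows : ∀ {l} {F : (Fin m → Fin n → ℤ) → ℤ} {f : (Fin l → ℤ) → Fin n → ℤ} →
  IsAltForm F → IsLinear f → IsAltForm (λ M → F (λ i → f (M i)))
map-rows {f = f} A L = record
  { form-cong   = λ h → form-cong (λ i → map-cong (h i))
  ; form-linear = λ r a b {M} {N} {P} h h₁ h₂ → form-linear r a b
      (λ j → trans (map-cong h j) (map-linear a b (N r) (P r) j))
      (λ i i≢r → map-cong (h₁ i i≢r)) (λ i i≢r → map-cong (h₂ i i≢r))
  ; alternating = λ M r≢s h → alternating (λ i → f (M i)) r≢s (map-cong h)
  }
  where open IsAltForm A; open IsLinear L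

setRow : {A : Set} → (Fin m → A) → Fin m → A → Fin m → A
setRow M r x i with i ≟ r
... | yes _ = x
... | no  _ = M i

setRow-≡ : {A : Set} (M : Fin m → A) (r : Fin m) (x : A) → setRow M r x r ≡ x
setRow-≡ M r x with r ≟ r
... | yes _   = refl
... | no  r≢r = contradiction refl r≢r

setRow-≢ : {A : Set} (M : Fin m → A) {r i : Fin m} (x : A) → i ≢ r → setRow M r x i ≡ M i
setRow-≢ M {r} {i} x i≢r with i ≟ r
... | yes i≡r = contradiction i≡r i≢r
... | no  _   = refl

module AltForm {F : (Fin m → Fin n → ℤ) → ℤ} (A : IsAltForm F) where
  open IsAltForm A public

  row-functional : ∀ M r → IsFunctional (λ x → F (setRow M r x))
  row-functional M r = record
    { fun-cong   = λ {x} {y} h → form-cong (λ i j → cong-at h i j)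
    ; fun-linear = λ a b x y → form-linear r a b
        (λ j → trans (at _ j) (sym (cong₂ _+_ (cong (a *_) (at x j)) (cong (b *_) (at y j)))))
        (off _ x) (off _ y)
    }
    where
    at : ∀ x j → setRow M r x r j ≡ x j
    at x j = cong (λ f → f j) (setRow-≡ M r x)
    off : ∀ x y i → i ≢ r → ∀ j → setRow M r x i j ≡ setRow M r y i j
    off x y i i≢r j = cong (λ f → f j) (trans (setRow-≢ M x i≢r) (sym (setRow-≢ M y i≢r)))
    cong-at : ∀ {x y} → (∀ i → x i ≡ y i) → ∀ i j → setRow M r x i j ≡ setRow M r y i j
    cong-at h i j with i ≟ r
    ... | yes _ = h j
    ... | no  _ = refl

  add-row : ∀ {r s} c {M N} → r ≢ s → (∀ j → N r j ≡ M r j + c * M s j) →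
    (∀ i → i ≢ r → ∀ j → N i j ≡ M i j) → F N ≡ F M
  add-row {r} {s} c {M} {N} r≢s h h′ = begin
    F N ≡⟨ form-linear r (+ 1) c {P = P}
                                      (λ j → trans (h j) (cong₂ _+_ (sym (ℤₚ.*-identityˡ (M r j))) (cong (c *_) (sym (at j))))) h′
                                      (λ i i≢r j → trans (h′ i i≢r j) (sym (off i i≢r j))) ⟩
    + 1 * F M + c * F P ≡⟨ cong (λ z → + 1 * F M + c * z) (alternating P r≢s (λ j → trans (at j) (sym (off s (r≢s ∘ sym) j)))) ⟩
    + 1 * F M + c * + 0 ≡⟨ lemma (F M) c ⟩
    F M ∎
    where
    P = setRow M r (M s)
    at : ∀ j → P r j ≡ M s j
    at j = cong (λ f → f j) (setRow-≡ M r (M s))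
    off : ∀ i → i ≢ r → ∀ j → P i j ≡ M i j
    off i i≢r j = cong (λ f → f j) (setRow-≢ M (M s) i≢r)
    lemma : ∀ a b → + 1 * a + b * + 0 ≡ a
    lemma = solve-∀

  scale-row : ∀ {r} c {M N} → (∀ j → N r j ≡ c * M r j) → (∀ i → i ≢ r → ∀ j → N i j ≡ M i j) → F N ≡ c * F M
  scale-row {r} c {M} h h′ = trans (form-linear r c (+ 0) (λ j → trans (h j) (lemma c (M r j) )) h′ h′) (sym (lemma c (F M)))
    where
    lemma : ∀ c a → c * a ≡ c * a + + 0 * a
    lemma = solve-∀

  -- (x, y) → (x, y + x) → (-y, y + x) → (-y, x)
  swap-rows : ∀ {r s M N} → r ≢ s → (∀ j → N r j ≡ M s j) → (∀ j → N s j ≡ M r j) →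
    (∀ i → i ≢ r → i ≢ s → ∀ j → N i j ≡ M i j) → F N ≡ - F M
  swap-rows {r} {s} {M} {N} r≢s hr hs h = begin
    F N ≡⟨ scale-row {r} (- + 1) {M₃} {N} (λ j → trans (hr j) (trans (neg (M s j)) (cong (- + 1 *_) (sym (at₃r j)))))
                           (λ i i≢r j → other i i≢r j) ⟩
    - + 1 * F M₃ ≡⟨ ℤₚ.-1*i≡-i (F M₃) ⟩
    - F M₃ ≡⟨ cong -_ (trans (add-row {s} {r} (+ 1) (r≢s ∘ sym)
                             (λ j → trans (at₃s j) (trans (lem₃ (M r j) (M s j)) (cong₂ (λ x y → x + + 1 * y) (sym (at₂s j)) (sym (at₂r j)))))
                             (λ i i≢s j → off M₂ i≢s j))
                          (trans (add-row {r} {s} (- + 1) r≢s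
                             (λ j → trans (at₂r j) (trans (lem₂ (M r j) (M s j)) (cong₂ (λ x y → x + - + 1 * y) (sym (at₁r j)) (sym (at₁s j)))))
                             (λ i i≢r j → off M₁ i≢r j))
                           (add-row {s} {r} (+ 1) (r≢s ∘ sym)
                             (λ j → trans (at₁s j) (cong (_+_ (M s j)) (sym (ℤₚ.*-identityˡ (M r j)))))
                             (λ i i≢s j → off M i≢s j)))) ⟩
    - F M ∎
    where
    sum = λ j → M s j + M r j
    M₁ = setRow M s sum
    M₂ = setRow M₁ r (λ j → - M s j)
    M₃ = setRow M₂ s (M r)
    on : ∀ P {i} {x : Fin _ → ℤ} j → setRow P i x i j ≡ x j
    on P {i} {x} j = cong (λ f → f j) (setRow-≡ P i x)
    off : ∀ P {i l} {x : Fin _ → ℤ} → l ≢ i → ∀ j → setRow P i x l j ≡ P l j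
    off P l≢i j = cong (λ f → f j) (setRow-≢ P _ l≢i)
    at₁s : ∀ j → M₁ s j ≡ M s j + M r j
    at₁s = on M {s} {sum}
    at₁r : ∀ j → M₁ r j ≡ M r j
    at₁r = off M r≢s
    at₂r : ∀ j → M₂ r j ≡ - M s j
    at₂r = on M₁ {r} {λ j → - M s j}
    at₂s : ∀ j → M₂ s j ≡ M s j + M r j
    at₂s j = trans (off M₁ (r≢s ∘ sym) j) (at₁s j)
    at₃s : ∀ j → M₃ s j ≡ M r j
    at₃s = on M₂ {s} {M r}
    at₃r : ∀ j → M₃ r j ≡ - M s j
    at₃r j = trans (off M₂ r≢s j) (at₂r j)
    neg : ∀ a → a ≡ - + 1 * - a
    neg = solve-∀
    lem₂ : ∀ a b → - b ≡ a + - + 1 * (b + a)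
    lem₂ = solve-∀
    lem₃ : ∀ a b → a ≡ b + a + + 1 * - b
    lem₃ = solve-∀
    other : ∀ i → i ≢ r → ∀ j → N i j ≡ M₃ i j
    other i i≢r j with i ≟ s
    ... | yes refl = hs j
    ... | no  i≢s  = trans (h i i≢r i≢s j) (sym (trans (off M₁ i≢r j) (off M i≢s j)))

swap-head : {F : (Fin (suc (suc m)) → Fin n → ℤ) → ℤ} → IsAltForm F → ∀ x y R →
  F (x ◂ y ◂ R) ≡ - F (y ◂ x ◂ R)
swap-head A x y R = AltForm.swap-rows A {zero} {suc zero} (λ ()) (λ _ → refl) (λ _ → refl)
  λ { zero 0≢0 _ → contradiction refl 0≢0 ; (suc zero) _ 1≢1 → contradiction refl 1≢1 ; (suc (suc i)) _ _ _ → refl }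

-- To treat the remaining rows by induction, the already modified row `y` is swapped to the head and
-- frozen there by `fix-head`; swapping back cancels the sign, and a single `add-row` then restores
-- `y`.
clear-tail : {F : (Fin (suc m) → Fin n → ℤ) → ℤ} → IsAltForm F → ∀ x R (c : Fin m → ℤ) →
  F (x ◂ (λ i j → R i j + c i * x j)) ≡ F (x ◂ R)
clear-tail {zero}  A x R c = IsAltForm.form-cong A λ { zero j → refl }
clear-tail {suc m} {F = F} A x R c = begin
  F (x ◂ (λ i j → R i j + c i * x j)) ≡⟨ form-cong (λ { zero _ → refl ; (suc zero) _ → refl ; (suc (suc i)) _ → refl }) ⟩
  F (x ◂ y ◂ T) ≡⟨ swap-head A x y T ⟩
  - F (y ◂ x ◂ T) ≡⟨ cong -_ (clear-tail (fix-head A y) x (R ∘ suc) (c ∘ suc)) ⟩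
  - F (y ◂ x ◂ (R ∘ suc)) ≡⟨ sym (swap-head A x y (R ∘ suc)) ⟩
  F (x ◂ y ◂ (R ∘ suc)) ≡⟨ add-row {suc zero} {zero} (c zero) (λ ()) (λ _ → refl)
                                             (λ { zero _ _ → refl ; (suc zero) 1≢1 _ → contradiction refl 1≢1 ; (suc (suc i)) _ _ → refl }) ⟩
  F (x ◂ R) ∎
  where
  open AltForm A
  y = λ j → R zero j + c zero * x j
  T = λ i j → R (suc i) j + c (suc i) * x j

-- Row `j` reaches the front by `j` adjacent swaps, each contributing one sign.
rotate : {F : (Fin (suc m) → Fin n → ℤ) → ℤ} → IsAltForm F → ∀ R j →
  F (R j ◂ R ∘ punchIn j) ≡ alt (toℕ j) (F R)
rotate A R zero = IsAltForm.form-cong A λ { zero _ → refl ; (suc i) _ → refl }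
rotate {suc m} {F = F} A R (suc j) = begin
  F (R (suc j) ◂ R ∘ punchIn (suc j)) ≡⟨ form-cong (λ { zero _ → refl ; (suc zero) _ → refl ; (suc (suc i)) _ → refl }) ⟩
  F (R (suc j) ◂ R zero ◂ (R ∘ suc) ∘ punchIn j) ≡⟨ swap-head A _ _ _ ⟩
  - F (R zero ◂ R (suc j) ◂ (R ∘ suc) ∘ punchIn j) ≡⟨ cong -_ (rotate (fix-head A (R zero)) (R ∘ suc) j) ⟩
  - alt (toℕ j) (F (R zero ◂ R ∘ suc)) ≡⟨ cong (λ x → - alt (toℕ j) x) (form-cong λ { zero _ → refl ; (suc i) _ → refl }) ⟩
  - alt (toℕ j) (F R) ∎
  where open IsAltForm A

-- The inclusion of shorter vectors as the hyperplane where coordinate `j` vanishes. Pulling an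
-- alternating form back along it lowers the number of columns in `altForm-unique`.
insertZero : Fin (suc n) → (Fin n → ℤ) → Fin (suc n) → ℤ
insertZero j x k with j ≟ k
... | yes _   = + 0
... | no  j≢k = x (punchOut j≢k)

insertZero-linear : (j : Fin (suc n)) → IsLinear (insertZero j)
insertZero-linear j = record { map-cong = λ h → cg h ; map-linear = ln }
  where
  cg : ∀ {x y} → (∀ i → x i ≡ y i) → ∀ k → insertZero j x k ≡ insertZero j y k
  cg h k with j ≟ k
  ... | yes _   = refl
  ... | no  j≢k = h _
  zeros : ∀ a b → + 0 ≡ a * + 0 + b * + 0
  zeros = solve-∀
  ln : ∀ a b x y k → insertZero j (λ i → a * x i + b * y i) k ≡ a * insertZero j x k + b * insertZero j y k
  ln a b x y k with j ≟ k
  ... | yes _   = zeros a b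
  ... | no  j≢k = refl

insertZero-punchIn : (j : Fin (suc n)) (x : Fin (suc n) → ℤ) → ∀ k →
  insertZero j (x ∘ punchIn j) k ≡ x k + - x j * δ j k
insertZero-punchIn j x k with j ≟ k
... | yes refl = lemma (x j)
  where
  lemma : ∀ a → + 0 ≡ a + - a * + 1
  lemma = solve-∀
... | no j≢k = trans (cong x (Finₚ.punchIn-punchOut j≢k)) (lemma (x j) (x k))
  where
  lemma : ∀ a b → b ≡ b + - a * + 0
  lemma = solve-∀

sgn : ℕ → ℤ
sgn k = alt k (+ 1)

alt-sgn : ∀ k x → alt k x ≡ sgn k * x
alt-sgn zero    x = sym (ℤₚ.*-identityˡ x)
alt-sgn (suc k) x = trans (cong -_ (alt-sgn k x)) (ℤₚ.neg-distribˡ-* (sgn k) x)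

minor : Matrix ℤ (suc n) → Fin (suc n) → Matrix ℤ n
minor M j i k = M (suc i) (punchIn j k)

det-expand : (M : Matrix ℤ (suc n)) → detℤ M ≡ ∑ (λ j → sgn (toℕ j) * (M zero j * detℤ (minor M j)))
det-expand M = ∑-cong (λ j → alt-sgn (toℕ j) (M zero j * detℤ (minor M j)))

det-cong : {M N : Matrix ℤ n} → (∀ i j → M i j ≡ N i j) → detℤ M ≡ detℤ N
det-cong {zero}  h = refl
det-cong {suc n} h = ∑-cong (λ j → cong (alt (toℕ j))
  (cong₂ _*_ (h zero j) (det-cong (λ i k → h (suc i) (punchIn j k)))))

-- Swap j k j′ k′: removing column j and then column k of the rest removes the
-- same two columns as removing j′ and then k′, in the opposite order.
data Swap : ∀ {n} → Fin (suc n) → Fin n → Fin (suc n) → Fin n → Set where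
  base : (k : Fin (suc n)) → Swap zero k (suc k) zero
  step : {j j′ : Fin (suc n)} {k k′ : Fin n} → Swap j k j′ k′ → Swap (suc j) (suc k) (suc j′) (suc k′)

-- The terms with `j` zero cancel through `base` against those with `k` zero and `j` positive; the
-- remaining terms form the same double sum one size smaller, matched by `step`.
∑-Swap : (h : Fin (suc n) → Fin n → ℤ) → (∀ {j k j′ k′} → Swap j k j′ k′ → h j k + h j′ k′ ≡ + 0) →
  ∑ (λ j → ∑ (h j)) ≡ + 0
∑-Swap {zero}  h cancel = refl
∑-Swap {suc n} h cancel = begin
  ∑ (h zero) + ∑ (λ j → h (suc j) zero + ∑ (λ k → h (suc j) (suc k)))
    ≡⟨ cong (_+_ (∑ (h zero))) (∑-+ (λ j → h (suc j) zero) (λ j → ∑ (λ k → h (suc j) (suc k)))) ⟩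
  ∑ (h zero) + (∑ (λ j → h (suc j) zero) + ∑ (λ j → ∑ (λ k → h (suc j) (suc k))))
    ≡⟨ sym (ℤₚ.+-assoc (∑ (h zero)) _ _) ⟩
  ∑ (h zero) + ∑ (λ j → h (suc j) zero) + ∑ (λ j → ∑ (λ k → h (suc j) (suc k)))
    ≡⟨ cong₂ _+_ (trans (sym (∑-+ (h zero) (λ j → h (suc j) zero))) (∑-zero (λ k → cancel (base k))))
                 (∑-Swap (λ j k → h (suc j) (suc k)) (cancel ∘ step)) ⟩
  + 0 ∎

Swap-punchInˡ : {j j′ : Fin (suc n)} {k k′ : Fin n} → Swap j k j′ k′ → punchIn j k ≡ j′
Swap-punchInˡ (base k) = refl
Swap-punchInˡ (step s) = cong suc (Swap-punchInˡ s)

Swap-punchInʳ : {j j′ : Fin (suc n)} {k k′ : Fin n} → Swap j k j′ k′ → punchIn j′ k′ ≡ j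
Swap-punchInʳ (base k) = refl
Swap-punchInʳ (step s) = cong suc (Swap-punchInʳ s)

Swap-sgn : {j j′ : Fin (suc n)} {k k′ : Fin n} → Swap j k j′ k′ →
  sgn (toℕ j′) * sgn (toℕ k′) ≡ - (sgn (toℕ j) * sgn (toℕ k))
Swap-sgn (base k) = lemma (sgn (toℕ k))
  where
  lemma : ∀ a → - a * + 1 ≡ - (+ 1 * a)
  lemma = solve-∀
Swap-sgn {j = suc j} {suc j′} {suc k} {suc k′} (step s) =
  trans (lemma (sgn (toℕ j′)) _) (trans (Swap-sgn s) (cong -_ (sym (lemma (sgn (toℕ j)) _))))
  where
  lemma : ∀ a b → - a * - b ≡ a * b
  lemma = solve-∀

Swap-punchIn² : {j j′ : Fin (suc (suc n))} {k k′ : Fin (suc n)} → Swap j k j′ k′ →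
  ∀ c → punchIn j (punchIn k c) ≡ punchIn j′ (punchIn k′ c)
Swap-punchIn² (base k) c = refl
Swap-punchIn² (step s) zero = refl
Swap-punchIn² {suc n} (step s) (suc c) = cong suc (Swap-punchIn² s c)

-- Expanding along the first two rows gives a sum over ordered pairs of distinct columns. Exchanging
-- the two columns preserves the product of entries, because the rows agree, and the remaining
-- minor, but flips the sign.
det-alternating₀₁ : (M : Matrix ℤ (suc (suc n))) → (∀ j → M zero j ≡ M (suc zero) j) → detℤ M ≡ + 0
det-alternating₀₁ {n} M eq = begin
  detℤ M ≡⟨ det-expand M ⟩
  ∑ (λ j → sgn (toℕ j) * (M zero j * detℤ (minor M j)))
    ≡⟨ ∑-cong (λ j → trans (cong (λ z → sgn (toℕ j) * (M zero j * z)) (det-expand (minor M j)))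
         (trans (sym (ℤₚ.*-assoc (sgn (toℕ j)) (M zero j) _))
         (sym (∑-*ˡ (sgn (toℕ j) * M zero j) (λ k → sgn (toℕ k) * (M (suc zero) (punchIn j k) * D j k)))))) ⟩
  ∑ (λ j → ∑ (h j)) ≡⟨ ∑-Swap h cancel ⟩
  + 0 ∎
  where
  D : Fin (suc (suc n)) → Fin (suc n) → ℤ
  D j k = detℤ (minor (minor M j) k)
  h : Fin (suc (suc n)) → Fin (suc n) → ℤ
  h j k = sgn (toℕ j) * M zero j * (sgn (toℕ k) * (M (suc zero) (punchIn j k) * D j k))
  shape : ∀ s a t b d → s * a * (t * (b * d)) ≡ s * t * (a * b * d)
  shape = solve-∀
  zeroed : ∀ s a b d → s * (a * b * d) + - s * (b * a * d) ≡ + 0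
  zeroed = solve-∀
  cancel : ∀ {j k j′ k′} → Swap j k j′ k′ → h j k + h j′ k′ ≡ + 0
  cancel {j} {k} {j′} {k′} s = begin
    h j k + h j′ k′
      ≡⟨ cong₂ _+_ (trans (shape (sgn (toℕ j)) (M zero j) (sgn (toℕ k)) (M (suc zero) (punchIn j k)) (D j k))
            (cong (λ z → sgn (toℕ j) * sgn (toℕ k) * (M zero j * z * D j k)) (trans (cong (M (suc zero)) (Swap-punchInˡ s)) (sym (eq j′)))))
           (trans (shape (sgn (toℕ j′)) (M zero j′) (sgn (toℕ k′)) (M (suc zero) (punchIn j′ k′)) (D j′ k′))
            (cong₂ _*_ (Swap-sgn s) (cong₂ (λ z d → M zero j′ * z * d) (trans (cong (M (suc zero)) (Swap-punchInʳ s)) (sym (eq j)))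
               (det-cong (λ i c → cong (M (suc (suc i))) (sym (Swap-punchIn² s c))))))) ⟩
    sgn (toℕ j) * sgn (toℕ k) * (M zero j * M zero j′ * D j k) + - (sgn (toℕ j) * sgn (toℕ k)) * (M zero j′ * M zero j * D j k)
      ≡⟨ zeroed (sgn (toℕ j) * sgn (toℕ k)) (M zero j) (M zero j′) (D j k) ⟩
    + 0 ∎

det-linear : ∀ r a b {M N P : Matrix ℤ n} → (∀ j → M r j ≡ a * N r j + b * P r j) →
  (∀ i → i ≢ r → ∀ j → M i j ≡ N i j) → (∀ i → i ≢ r → ∀ j → M i j ≡ P i j) →
  detℤ M ≡ a * detℤ N + b * detℤ P
det-linear {suc n} r a b {M} {N} {P} h h₁ h₂ = begin
  detℤ M ≡⟨ det-expand M ⟩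
  ∑ (term M) ≡⟨ ∑-cong (λ j → pointwise r h h₁ h₂ j) ⟩
  ∑ (λ j → a * term N j + b * term P j) ≡⟨ ∑-linear a b (term N) (term P) ⟩
  a * ∑ (term N) + b * ∑ (term P) ≡⟨ cong₂ (λ x y → a * x + b * y) (sym (det-expand N)) (sym (det-expand P)) ⟩
  a * detℤ N + b * detℤ P ∎
  where
  term : Matrix ℤ (suc n) → Fin (suc n) → ℤ
  term M j = sgn (toℕ j) * (M zero j * detℤ (minor M j))
  at-zero : ∀ s a b x y d → s * ((a * x + b * y) * d) ≡ a * (s * (x * d)) + b * (s * (y * d))
  at-zero = solve-∀
  at-suc : ∀ s a b x d e → s * (x * (a * d + b * e)) ≡ a * (s * (x * d)) + b * (s * (x * e))
  at-suc = solve-∀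
  pointwise : ∀ r → (∀ j → M r j ≡ a * N r j + b * P r j) →
    (∀ i → i ≢ r → ∀ j → M i j ≡ N i j) → (∀ i → i ≢ r → ∀ j → M i j ≡ P i j) →
    ∀ j → term M j ≡ a * term N j + b * term P j
  pointwise zero h h₁ h₂ j = begin
    term M j ≡⟨ cong (λ x → sgn (toℕ j) * (x * detℤ (minor M j))) (h j) ⟩
    sgn (toℕ j) * ((a * N zero j + b * P zero j) * detℤ (minor M j))
               ≡⟨ at-zero (sgn (toℕ j)) a b (N zero j) (P zero j) (detℤ (minor M j)) ⟩
    a * (sgn (toℕ j) * (N zero j * detℤ (minor M j))) + b * (sgn (toℕ j) * (P zero j * detℤ (minor M j)))
               ≡⟨ cong₂ (λ d e → a * (sgn (toℕ j) * (N zero j * d)) + b * (sgn (toℕ j) * (P zero j * e)))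
                    (det-cong (λ i k → h₁ (suc i) (λ ()) _)) (det-cong (λ i k → h₂ (suc i) (λ ()) _)) ⟩
    a * term N j + b * term P j ∎
  pointwise (suc r) h h₁ h₂ j = begin
    term M j ≡⟨ cong (λ d → sgn (toℕ j) * (M zero j * d)) (det-linear r a b {minor M j} {minor N j} {minor P j} (λ k → h (punchIn j k))
                    (λ i i≢r k → h₁ (suc i) (i≢r ∘ Finₚ.suc-injective) _) (λ i i≢r k → h₂ (suc i) (i≢r ∘ Finₚ.suc-injective) _)) ⟩
    sgn (toℕ j) * (M zero j * (a * detℤ (minor N j) + b * detℤ (minor P j)))
               ≡⟨ at-suc (sgn (toℕ j)) a b (M zero j) (detℤ (minor N j)) (detℤ (minor P j)) ⟩
    a * (sgn (toℕ j) * (M zero j * detℤ (minor N j))) + b * (sgn (toℕ j) * (M zero j * detℤ (minor P j)))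
               ≡⟨ cong₂ (λ x y → a * (sgn (toℕ j) * (x * detℤ (minor N j))) + b * (sgn (toℕ j) * (y * detℤ (minor P j))))
                    (h₁ zero (λ ()) j) (h₂ zero (λ ()) j) ⟩
    a * term N j + b * term P j ∎

det-isAltForm : ∀ n → IsAltForm (detℤ {n})
det-alternating : ∀ n {r s} (M : Matrix ℤ n) → r ≢ s → (∀ j → M r j ≡ M s j) → detℤ M ≡ + 0

det-isAltForm n = record
  { form-cong   = det-cong
  ; form-linear = λ r a b {M} {N} {P} → det-linear r a b {M} {N} {P}
  ; alternating = det-alternating n
  }

-- Alternation below the head row comes from the minors, that is, from `det-alternating` at size
-- `n`. This makes row swaps in the tail available before alternation at size `n + 1` is
-- established.
det-tail-isAltForm : (x : Fin (suc n) → ℤ) → IsAltForm (λ R → detℤ {suc n} (x ◂ R))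
det-tail-isAltForm {n} x = record
  { form-cong   = λ {M} {N} h → det-cong {M = x ◂ M} {x ◂ N} λ { zero _ → refl ; (suc i) j → h i j }
  ; form-linear = λ r a b {M} {N} {P} h h₁ h₂ → det-linear (suc r) a b {x ◂ M} {x ◂ N} {x ◂ P} h
      (λ { zero _ j → refl ; (suc i) i≢r j → h₁ i (i≢r ∘ cong suc) j })
      (λ { zero _ j → refl ; (suc i) i≢r j → h₂ i (i≢r ∘ cong suc) j })
  ; alternating = λ {r} {s} R r≢s h → trans (det-expand (x ◂ R)) (∑-zero (λ j →
      trans (cong (λ z → sgn (toℕ j) * (x j * z)) (det-alternating n {r} {s} (minor (x ◂ R) j) r≢s (λ k → h (punchIn j k))))
            (zeroed (sgn (toℕ j)) (x j))))
  }
  where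
  zeroed : ∀ a b → a * (b * + 0) ≡ + 0
  zeroed = solve-∀

-- A swap within the tail moves the row equal to the head into second place, which reduces the claim
-- to `det-alternating₀₁`.
det-alternating₀ : ∀ {s} (M : Matrix ℤ (suc n)) → (∀ j → M zero j ≡ M (suc s) j) → detℤ M ≡ + 0
det-alternating₀ {suc n} {zero} M h = det-alternating₀₁ M h
det-alternating₀ {suc n} {suc s} M h = begin
  detℤ M ≡⟨ det-cong {M = M} {M zero ◂ M ∘ suc} (λ { zero _ → refl ; (suc i) _ → refl }) ⟩
  detℤ (M zero ◂ M ∘ suc) ≡⟨ AltForm.swap-rows (det-tail-isAltForm (M zero)) {zero} {suc s} {R} {M ∘ suc} (λ ())
                                       (λ j → sym (cong (λ f → f j) (setRow-≡ R₀ (suc s) (M (suc zero)))))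
                                       (λ j → refl)
                                       (λ { zero 0≢0 _ _ → contradiction refl 0≢0
                                          ; (suc i) _ i≢s j → sym (cong (λ f → f j) (setRow-≢ R₀ (M (suc zero)) i≢s)) }) ⟩
  - detℤ (M zero ◂ R) ≡⟨ cong -_ (det-alternating₀₁ (M zero ◂ R) (λ j → h j)) ⟩
  + 0 ∎
  where
  R₀ = setRow (M ∘ suc) zero (M (suc (suc s)))
  R = setRow R₀ (suc s) (M (suc zero))

det-alternating (suc n) {zero} {zero} M r≢s h = contradiction refl r≢s
det-alternating (suc n) {zero} {suc s} M r≢s h = det-alternating₀ M h
det-alternating (suc n) {suc r} {zero} M r≢s h = det-alternating₀ M (sym ∘ h)
det-alternating (suc n) {suc r} {suc s} M r≢s h =
  trans (det-cong {M = M} {M zero ◂ M ∘ suc} (λ { zero _ → refl ; (suc i) _ → refl }))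
    (IsAltForm.alternating (det-tail-isAltForm (M zero)) (M ∘ suc) (r≢s ∘ cong suc) h)

-- Expand the head row in unit vectors. With head `δ j`, column `j` of the other rows can be
-- cleared, so `F` becomes an alternating form in the minor and induction applies. What is left is
-- `F` on a rearranged identity matrix, and `rotate` supplies the sign of the Laplace expansion.
altForm-unique : {F : Matrix ℤ n → ℤ} → IsAltForm F → ∀ M → F M ≡ detℤ M * F δ
altForm-unique {zero} {F} A M = trans (IsAltForm.form-cong A (λ ())) (sym (ℤₚ.*-identityˡ (F δ)))
altForm-unique {suc n} {F} A M = begin
  F M ≡⟨ form-cong (λ { zero _ → refl ; (suc i) _ → refl }) ⟩
  F (M zero ◂ M ∘ suc) ≡⟨ functional-expand head (M zero) ⟩
  ∑ (λ j → M zero j * F (δ j ◂ M ∘ suc)) ≡⟨ ∑-cong (λ j → trans (cong (M zero j *_) (evaluate j)) (shape (M zero j) (detℤ (minor M j)) (sgn (toℕ j)) (F δ))) ⟩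
  ∑ (λ j → sgn (toℕ j) * (M zero j * detℤ (minor M j)) * F δ) ≡⟨ ∑-*ʳ (F δ) (λ j → sgn (toℕ j) * (M zero j * detℤ (minor M j))) ⟩
  ∑ (λ j → sgn (toℕ j) * (M zero j * detℤ (minor M j))) * F δ ≡⟨ cong (_* F δ) (sym (det-expand M)) ⟩
  detℤ M * F δ ∎
  where
  open IsAltForm A
  head : IsFunctional (λ x → F (x ◂ M ∘ suc))
  head = record
    { fun-cong   = λ h → form-cong λ { zero j → h j ; (suc i) j → refl }
    ; fun-linear = λ a b x y → form-linear zero a b (λ j → refl)
        (λ { zero 0≢0 j → contradiction refl 0≢0 ; (suc i) _ j → refl })
        (λ { zero 0≢0 j → contradiction refl 0≢0 ; (suc i) _ j → refl })
    }
  shape : ∀ a d s f → a * (d * (s * f)) ≡ s * (a * d) * f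
  shape = solve-∀
  unit : ∀ j i k → insertZero j (δ i) k ≡ δ (punchIn j i) k
  unit j i k with j ≟ k
  ... | yes refl = sym (δ-≢ (Finₚ.punchInᵢ≢i j i))
  ... | no j≢k with i ≟ punchOut j≢k
  ...   | yes refl = sym (trans (cong (λ z → δ z k) (Finₚ.punchIn-punchOut j≢k)) (δ-refl k))
  ...   | no  i≢k  = sym (δ-≢ (λ eq → i≢k (trans (sym (Finₚ.punchOut-punchIn j {i}))
                       (Finₚ.punchOut-cong j eq))))
  evaluate : ∀ j → F (δ j ◂ M ∘ suc) ≡ detℤ (minor M j) * (sgn (toℕ j) * F δ)
  evaluate j = begin
    F (δ j ◂ M ∘ suc)
      ≡⟨ sym (clear-tail A (δ j) (M ∘ suc) (λ i → - M (suc i) j)) ⟩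
    F (δ j ◂ (λ i k → M (suc i) k + - M (suc i) j * δ j k))
      ≡⟨ form-cong (λ { zero _ → refl ; (suc i) k → sym (insertZero-punchIn j (M (suc i)) k) }) ⟩
    F (δ j ◂ (λ i → insertZero j (minor M j i)))
      ≡⟨ altForm-unique (map-rows (fix-head A (δ j)) (insertZero-linear j)) (minor M j) ⟩
    detℤ (minor M j) * F (δ j ◂ (λ i → insertZero j (δ i)))
      ≡⟨ cong (detℤ (minor M j) *_) (form-cong (λ { zero _ → refl ; (suc i) k → unit j i k })) ⟩
    detℤ (minor M j) * F (δ j ◂ δ ∘ punchIn j)
      ≡⟨ cong (detℤ (minor M j) *_) (trans (rotate A δ j) (alt-sgn (toℕ j) (F δ))) ⟩
    detℤ (minor M j) * (sgn (toℕ j) * F δ) ∎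

-- Matrix products, the adjugate and one-sided inverses.

infixl 7 _∙_
_∙_ : ∀ {l} → (Fin m → Fin n → ℤ) → (Fin n → Fin l → ℤ) → Fin m → Fin l → ℤ
(M ∙ N) i j = ∑ (λ k → M i k * N k j)

infix 10 _ᵀ
_ᵀ : {A : Set} → (Fin m → Fin n → A) → Fin n → Fin m → A
(M ᵀ) i j = M j i

∙-cong : ∀ {l} {M M′ : Fin m → Fin n → ℤ} {N N′ : Fin n → Fin l → ℤ} →
  (∀ i j → M i j ≡ M′ i j) → (∀ i j → N i j ≡ N′ i j) → ∀ i j → (M ∙ N) i j ≡ (M′ ∙ N′) i j
∙-cong h h′ i j = ∑-cong (λ k → cong₂ _*_ (h i k) (h′ k j))

∙-assoc : ∀ {l o} (M : Fin m → Fin n → ℤ) (N : Fin n → Fin l → ℤ) (P : Fin l → Fin o → ℤ) →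
  ∀ i j → ((M ∙ N) ∙ P) i j ≡ (M ∙ (N ∙ P)) i j
∙-assoc M N P i j = begin
  ∑ (λ k → ∑ (λ a → M i a * N a k) * P k j)
    ≡⟨ ∑-cong (λ k → sym (∑-*ʳ (P k j) (λ a → M i a * N a k))) ⟩
  ∑ (λ k → ∑ (λ a → M i a * N a k * P k j))
    ≡⟨ ∑-swap (λ k a → M i a * N a k * P k j) ⟩
  ∑ (λ a → ∑ (λ k → M i a * N a k * P k j))
    ≡⟨ ∑-cong (λ a → trans (∑-cong (λ k → ℤₚ.*-assoc (M i a) (N a k) (P k j)))
                            (∑-*ˡ (M i a) (λ k → N a k * P k j))) ⟩
  ∑ (λ a → M i a * ∑ (λ k → N a k * P k j)) ∎

∑-scaled-δˡ : (c : ℤ) (i : Fin n) (f : Fin n → ℤ) → ∑ (λ k → c * δ i k * f k) ≡ c * f i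
∑-scaled-δˡ c i f = trans (∑-cong (λ k → ℤₚ.*-assoc c (δ i k) (f k)))
  (trans (∑-*ˡ c (λ k → δ i k * f k)) (cong (c *_) (∑-δˡ i f)))

∑-scaled-δʳ : (c : ℤ) (i : Fin n) (f : Fin n → ℤ) → ∑ (λ k → f k * (c * δ k i)) ≡ c * f i
∑-scaled-δʳ c i f = trans (∑-cong (λ k → trans (ℤₚ.*-comm (f k) (c * δ k i)) (cong (λ z → c * z * f k) (δ-sym k i))))
  (∑-scaled-δˡ c i f)

right-mul-linear : ∀ {l} (N : Fin m → Fin l → ℤ) → IsLinear (λ x j → ∑ (λ k → x k * N k j))
right-mul-linear N = record
  { map-cong   = λ h j → ∑-cong (λ k → cong (_* N k j) (h k))
  ; map-linear = λ a b x y j → trans (∑-cong (λ k → distr a b (x k) (y k) (N k j)))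
      (∑-linear a b (λ k → x k * N k j) (λ k → y k * N k j))
  }
  where
  distr : ∀ a b x y z → (a * x + b * y) * z ≡ a * (x * z) + b * (y * z)
  distr = solve-∀

-- For fixed `N` the determinant of the product is an alternating form in the rows of `M`, with
-- value `detℤ N` at the identity.
det-∙ : (M N : Matrix ℤ n) → detℤ (M ∙ N) ≡ detℤ M * detℤ N
det-∙ {n} M N = trans (altForm-unique (map-rows (det-isAltForm n) (right-mul-linear N)) M)
  (cong (detℤ M *_) (det-cong {M = δ ∙ N} {N} (λ i j → ∑-δˡ i (λ k → N k j))))

-- The cofactor at row `i` and column `k`, written as a determinant of full size with row `i`
-- replaced by a unit vector. Linearity in that row then gives the product with `M` without minors
-- or signs.
adjugate : Matrix ℤ n → Matrix ℤ n
adjugate M k i = detℤ (setRow M i (δ k))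

∙-adjugate : (M : Matrix ℤ n) → ∀ i j → (M ∙ adjugate M) i j ≡ detℤ M * δ i j
∙-adjugate {n} M i j = trans (sym (functional-expand (AltForm.row-functional (det-isAltForm n) M j) (M i))) (replaced i)
  where
  replaced : ∀ i → detℤ (setRow M j (M i)) ≡ detℤ M * δ i j
  replaced i with i ≟ j
  ... | yes refl = trans (det-cong {M = setRow M i (M i)} {M} same) (sym (ℤₚ.*-identityʳ (detℤ M)))
    where
    same : ∀ k l → setRow M i (M i) k l ≡ M k l
    same k l with k ≟ i
    ... | yes refl = refl
    ... | no  _    = refl
  ... | no i≢j = trans (det-alternating n {i} {j} (setRow M j (M i)) i≢j
      (λ l → cong (λ f → f l) (trans (setRow-≢ M (M i) i≢j) (sym (setRow-≡ M j (M i))))))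
    (sym (ℤₚ.*-zeroʳ (detℤ M)))

∏ : (Fin n → ℤ) → ℤ
∏ {zero}  f = + 1
∏ {suc n} f = f zero * ∏ (f ∘ suc)

det-column-zero : (M : Matrix ℤ (suc n)) → (∀ i → M i zero ≡ + 0) → detℤ M ≡ + 0
det-column-zero {n} M h = trans (det-expand M) (∑-zero term)
  where
  coefficient : ∀ a b → a * (+ 0 * b) ≡ + 0
  coefficient = solve-∀
  cofactor : ∀ a b → a * (b * + 0) ≡ + 0
  cofactor = solve-∀
  minor-zero : ∀ {n} (M : Matrix ℤ (suc n)) → (∀ i → M i zero ≡ + 0) → ∀ j → detℤ (minor M (suc j)) ≡ + 0
  minor-zero {suc n} M h j = det-column-zero (minor M (suc j)) (λ i → h (suc i))
  term : ∀ j → sgn (toℕ j) * (M zero j * detℤ (minor M j)) ≡ + 0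
  term zero = trans (cong (λ z → + 1 * (z * detℤ (minor M zero))) (h zero)) (coefficient (+ 1) (detℤ (minor M zero)))
  term (suc j) = trans (cong (λ z → sgn (suc (toℕ j)) * (M zero (suc j) * z)) (minor-zero M h j))
    (cofactor (sgn (suc (toℕ j))) (M zero (suc j)))

det-block : (M : Matrix ℤ (suc n)) → (∀ i → M (suc i) zero ≡ + 0) →
  detℤ M ≡ M zero zero * detℤ (λ i j → M (suc i) (suc j))
det-block {n} M h = begin
  detℤ M ≡⟨ det-expand M ⟩
  + 1 * (M zero zero * detℤ (minor M zero)) + ∑ (λ j → sgn (suc (toℕ j)) * (M zero (suc j) * detℤ (minor M (suc j))))
    ≡⟨ cong₂ _+_ (ℤₚ.*-identityˡ (M zero zero * detℤ (minor M zero)))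
         (∑-zero (λ j → trans (cong (λ z → sgn (suc (toℕ j)) * (M zero (suc j) * z)) (vanish M h j)) (cofactor (sgn (suc (toℕ j))) (M zero (suc j))))) ⟩
  M zero zero * detℤ (minor M zero) + + 0 ≡⟨ ℤₚ.+-identityʳ (M zero zero * detℤ (minor M zero)) ⟩
  M zero zero * detℤ (minor M zero) ∎
  where
  cofactor : ∀ a b → a * (b * + 0) ≡ + 0
  cofactor = solve-∀
  vanish : ∀ {n} (M : Matrix ℤ (suc n)) → (∀ i → M (suc i) zero ≡ + 0) → ∀ j → detℤ (minor M (suc j)) ≡ + 0
  vanish {suc n} M h j = det-column-zero (minor M (suc j)) h

det-diagonal : (d : Fin n → ℤ) → detℤ (λ i j → δ i j * d i) ≡ ∏ d
det-diagonal {zero}  d = refl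
det-diagonal {suc n} d = trans (det-block (λ i j → δ i j * d i) (λ i → refl))
  (cong₂ _*_ (ℤₚ.*-identityˡ (d zero)) (trans (det-cong {M = λ i j → δ (suc i) (suc j) * d (suc i)} {λ i j → δ i j * d (suc i)}
     (λ i j → cong (_* d (suc i)) (δ-suc i j))) (det-diagonal (d ∘ suc))))

∏-≢0 : {d : Fin n → ℤ} → (∀ i → d i ≢ + 0) → ∏ d ≢ + 0
∏-≢0 {zero}  h ()
∏-≢0 {suc n} {d} h eq with ℤₚ.i*j≡0⇒i≡0∨j≡0 (d zero) eq
... | inj₁ e = h zero e
... | inj₂ e = ∏-≢0 (λ i → h (suc i)) e

det-δ : ∀ n → detℤ {n} δ ≡ + 1
det-δ zero    = refl
det-δ (suc n) = trans (det-block {n} δ (λ i → refl))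
  (trans (ℤₚ.*-identityˡ (detℤ {n} (λ i j → δ (suc i) (suc j)))) (trans (det-cong {n} δ-suc) (det-δ n)))

*-cancelˡ-≢0 : ∀ {c x y} → c ≢ + 0 → c * x ≡ c * y → x ≡ y
*-cancelˡ-≢0 {c} {x} {y} c≢0 = ℤₚ.*-cancelˡ-≡ c x y {{ℤ.≢-nonZero c≢0}}

*-≢0 : ∀ {a b} → a ≢ + 0 → b ≢ + 0 → a * b ≢ + 0
*-≢0 {a} a≢0 b≢0 eq with ℤₚ.i*j≡0⇒i≡0∨j≡0 a eq
... | inj₁ e = a≢0 e
... | inj₂ e = b≢0 e

det-scalar-≢0 : ∀ {c} → c ≢ + 0 → detℤ {n} (λ i j → c * δ i j) ≢ + 0
det-scalar-≢0 {n} {c} c≢0 eq = ∏-≢0 {n} {λ _ → c} (λ _ → c≢0)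
  (trans (sym (det-diagonal {n} (λ _ → c))) (trans (det-cong {n} (λ i j → ℤₚ.*-comm (δ i j) c)) eq))

-- Let D be the determinant of `N`. Multiplying `M N = c` by the adjugate of `N` on the right gives
-- `c adj N = D M`; multiplying this by `N` on the left gives `D (N M) = D c`. Here D is nonzero
-- because the determinant of `c I` is. This replaces the passage to a rational inverse throughout.
∙-comm-scalar : (M N : Matrix ℤ n) {c : ℤ} → c ≢ + 0 → (∀ i j → (M ∙ N) i j ≡ c * δ i j) →
  ∀ i j → (N ∙ M) i j ≡ c * δ i j
∙-comm-scalar {n} M N {c} c≢0 h i j = *-cancelˡ-≢0 D≢0 (begin
  D * (N ∙ M) i j ≡⟨ sym (∑-*ˡ D (λ k → N i k * M k j)) ⟩
  ∑ (λ k → D * (N i k * M k j)) ≡⟨ ∑-cong (λ k → trans (left-comm D (N i k) (M k j)) (trans (cong (N i k *_) (sym (proportional k j)))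
                                               (left-comm (N i k) c (adjugate N k j)))) ⟩
  ∑ (λ k → c * (N i k * adjugate N k j)) ≡⟨ ∑-*ˡ c (λ k → N i k * adjugate N k j) ⟩
  c * (N ∙ adjugate N) i j ≡⟨ cong (c *_) (∙-adjugate N i j) ⟩
  c * (D * δ i j) ≡⟨ left-comm c D (δ i j) ⟩
  D * (c * δ i j) ∎)
  where
  D = detℤ N
  left-comm : ∀ a b c → a * (b * c) ≡ b * (a * c)
  left-comm = solve-∀
  D≢0 : D ≢ + 0
  D≢0 eq = det-scalar-≢0 {n} c≢0 (trans (det-cong {M = λ i j → c * δ i j} {M ∙ N} (λ i j → sym (h i j)))
    (trans (det-∙ M N) (trans (cong (detℤ M *_) eq) (ℤₚ.*-zeroʳ (detℤ M)))))
  proportional : ∀ i j → c * adjugate N i j ≡ D * M i j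
  proportional i j = begin
    c * adjugate N i j ≡⟨ sym (∑-scaled-δˡ c i (λ k → adjugate N k j)) ⟩
    ∑ (λ k → c * δ i k * adjugate N k j) ≡⟨ ∑-cong (λ k → cong (_* adjugate N k j) (sym (h i k))) ⟩
    ((M ∙ N) ∙ adjugate N) i j ≡⟨ ∙-assoc M N (adjugate N) i j ⟩
    (M ∙ (N ∙ adjugate N)) i j ≡⟨ ∑-cong (λ k → cong (M i k *_) (∙-adjugate N k j)) ⟩
    ∑ (λ k → M i k * (D * δ k j)) ≡⟨ ∑-scaled-δʳ D j (M i) ⟩
    D * M i j ∎

∣-*-cong : ∀ {N a b c d} → N ∣ a - b → N ∣ c - d → N ∣ a * c - b * d
∣-*-cong {N} {a} {b} {c} {d} h h′ = subst (N ∣_) (lemma a b c d)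
  (ℤ∣.∣m∣n⇒∣m+n (ℤ∣.∣m⇒∣m*n c h) (ℤ∣.∣n⇒∣m*n b h′))
  where
  lemma : ∀ a b c d → (a - b) * c + b * (c - d) ≡ a * c - b * d
  lemma = solve-∀

∣-∑-cong : ∀ {N} {f g : Fin n → ℤ} → (∀ i → N ∣ f i - g i) → N ∣ ∑ f - ∑ g
∣-∑-cong {N = N} {f} {g} h = subst (N ∣_) (trans (∑-+ f (λ i → - g i)) (cong (_+_ (∑ f)) (∑-neg g))) (∑-∣ h)

det-∣ : ∀ {N} {P Q : Matrix ℤ n} → (∀ i j → N ∣ P i j - Q i j) → N ∣ detℤ P - detℤ Q
det-∣ {zero}  {N} h = divides (+ 0) refl
det-∣ {suc n} {N} {P} {Q} h = subst (N ∣_) (cong₂ _-_ (sym (det-expand P)) (sym (det-expand Q)))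
  (∣-∑-cong {f = λ j → s j * (P zero j * detℤ (minor P j))} {λ j → s j * (Q zero j * detℤ (minor Q j))} (λ j → ∣-*-cong {N} {s j} {s j} {P zero j * detℤ (minor P j)} {Q zero j * detℤ (minor Q j)}
     (divides (+ 0) (ℤₚ.i≡j⇒i-j≡0 {s j} refl))
     (∣-*-cong {N} {P zero j} {Q zero j} (h zero j) (det-∣ {n} {N} {minor P j} {minor Q j} (λ i k → h (suc i) (punchIn j k))))))
  where
  s : Fin (suc n) → ℤ
  s j = sgn (toℕ j)

-- Characteristic polynomials as power series

open RingOps PSops using () renaming (_*_ to _⊛_)

shift : PS → PS
shift f k = f (suc k)

convUpTo-shift : ∀ f g k i → convUpTo f g (suc k) (suc i) ≡ f 0 * g (suc k) + convUpTo (shift f) g k i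
convUpTo-shift f g k zero    = ℤₚ.+-comm (f 1 * g k) (f 0 * g (suc k))
convUpTo-shift f g k (suc i) = trans (cong (_+_ (f (suc (suc i)) * g (k ℕ.∸ suc i))) (convUpTo-shift f g k i))
  (lemma (f (suc (suc i)) * g (k ℕ.∸ suc i)) (f 0 * g (suc k)) (convUpTo (shift f) g k i))
  where
  lemma : ∀ a b c → a + (b + c) ≡ b + (a + c)
  lemma = solve-∀

⊛-shift : ∀ f g k → (f ⊛ g) (suc k) ≡ f 0 * g (suc k) + (shift f ⊛ g) k
⊛-shift f g k = convUpTo-shift f g k k

Degree≤ : ℕ → PS → Set
Degree≤ d f = ∀ k → d ℕ.< k → f k ≡ + 0

convUpTo-zeroˡ : ∀ f g → (∀ k → f k ≡ + 0) → ∀ k i → convUpTo f g k i ≡ + 0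
convUpTo-zeroˡ f g h k zero    = cong (_* g k) (h 0)
convUpTo-zeroˡ f g h k (suc i) = cong₂ _+_ (cong (_* g (k ℕ.∸ suc i)) (h (suc i))) (convUpTo-zeroˡ f g h k i)

shift-degree : ∀ {d f} → Degree≤ (suc d) f → Degree≤ d (shift f)
shift-degree h k d<k = h (suc k) (ℕ.s≤s d<k)

⊛-degree₀ : ∀ f g → Degree≤ 0 f → ∀ k → (f ⊛ g) k ≡ f 0 * g k
⊛-degree₀ f g h zero    = refl
⊛-degree₀ f g h (suc k) = trans (⊛-shift f g k)
  (trans (cong (_+_ (f 0 * g (suc k))) (convUpTo-zeroˡ (shift f) g (λ k → h (suc k) (ℕ.s≤s ℕ.z≤n)) k k))
    (ℤₚ.+-identityʳ (f 0 * g (suc k))))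

⊛-degree : ∀ a b {f g} → Degree≤ a f → Degree≤ b g → Degree≤ (a ℕ.+ b) (f ⊛ g)
⊛-degree zero b {f} {g} hf hg k b<k = trans (⊛-degree₀ f g hf k)
  (trans (cong (f 0 *_) (hg k b<k)) (ℤₚ.*-zeroʳ (f 0)))
⊛-degree (suc a) b {f} {g} hf hg (suc k) (ℕ.s≤s a+b<k) = trans (⊛-shift f g k)
  (cong₂ _+_ (trans (cong (f 0 *_) (hg (suc k) (ℕₚ.≤-<-trans (ℕₚ.m≤n+m b a) (ℕₚ.<-trans a+b<k (ℕₚ.n<1+n k))))) (ℤₚ.*-zeroʳ (f 0)))
    (⊛-degree a b (shift-degree {a} {f} hf) hg k a+b<k))

-- heval s t d f is t^d · f (s / t), for f of degree at most d.
module Homogenised (s t : ℤ) where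

  pow : ℕ → ℤ
  pow zero    = + 1
  pow (suc k) = t * pow k

  heval : ℕ → PS → ℤ
  heval zero    f = f 0
  heval (suc d) f = f 0 * pow (suc d) + s * heval d (shift f)

  heval-cong : ∀ d {f g} → (∀ k → f k ≡ g k) → heval d f ≡ heval d g
  heval-cong zero    h = h 0
  heval-cong (suc d) h = cong₂ (λ x y → x * pow (suc d) + s * y) (h 0) (heval-cong d (λ k → h (suc k)))

  heval-linear : ∀ d a b f g → heval d (λ k → a * f k + b * g k) ≡ a * heval d f + b * heval d g
  heval-linear zero    a b f g = refl
  heval-linear (suc d) a b f g = trans (cong (λ y → (a * f 0 + b * g 0) * pow (suc d) + s * y) (heval-linear d a b (shift f) (shift g)))
    (lemma a b (f 0) (g 0) (pow (suc d)) s (heval d (shift f)) (heval d (shift g)))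
    where
    lemma : ∀ a b x y p s u v → (a * x + b * y) * p + s * (a * u + b * v) ≡ a * (x * p + s * u) + b * (y * p + s * v)
    lemma = solve-∀

  heval-zero : ∀ d → heval d (λ _ → + 0) ≡ + 0
  heval-zero d = trans (heval-linear d (+ 0) (+ 0) (λ _ → + 0) (λ _ → + 0)) refl

  heval-scale : ∀ d c f → heval d (λ k → c * f k) ≡ c * heval d f
  heval-scale d c f = trans (heval-cong d (λ k → lemma c (f k))) (trans (heval-linear d c (+ 0) f f) (sym (lemma c (heval d f))))
    where
    lemma : ∀ c x → c * x ≡ c * x + + 0 * x
    lemma = solve-∀

  heval-+ : ∀ d f g → heval d (λ k → f k + g k) ≡ heval d f + heval d g
  heval-+ d f g = trans (heval-cong d (λ k → lemma (f k) (g k))) (trans (heval-linear d (+ 1) (+ 1) f g) (sym (lemma (heval d f) (heval d g))))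
    where
    lemma : ∀ x y → x + y ≡ + 1 * x + + 1 * y
    lemma = solve-∀

  -- Overestimating the degree by `a` only contributes the factor t^a. The product rule needs this
  -- because the constant term of `f` multiplies `g` at the full degree of the product.
  heval-raise : ∀ a b g → Degree≤ b g → heval (a ℕ.+ b) g ≡ pow a * heval b g
  heval-raise zero    b g h = sym (ℤₚ.*-identityˡ (heval b g))
  heval-raise (suc a) b g h = trans (heval-suc (a ℕ.+ b) g (λ k lt → h k (ℕₚ.≤-<-trans (ℕₚ.m≤n+m b a) lt)))
    (trans (cong (t *_) (heval-raise a b g h)) (sym (ℤₚ.*-assoc t (pow a) (heval b g))))
    where
    heval-suc : ∀ d g → Degree≤ d g → heval (suc d) g ≡ t * heval d g
    heval-suc zero g h = trans (cong (λ z → g 0 * pow 1 + s * z) (h 1 (ℕ.s≤s ℕ.z≤n))) (lemma (g 0) t s)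
      where
      lemma : ∀ x t s → x * (t * + 1) + s * + 0 ≡ t * x
      lemma = solve-∀
    heval-suc (suc d) g h = trans (cong (λ z → g 0 * pow (suc (suc d)) + s * z) (heval-suc d (shift g) (shift-degree {d} {g} h)))
      (lemma (g 0) t (pow (suc d)) s (heval d (shift g)))
      where
      lemma : ∀ x t p s u → x * (t * p) + s * (t * u) ≡ t * (x * p + s * u)
      lemma = solve-∀

  heval-⊛ : ∀ a b f g → Degree≤ a f → Degree≤ b g → heval (a ℕ.+ b) (f ⊛ g) ≡ heval a f * heval b g
  heval-⊛ zero    b f g hf hg = trans (heval-cong b (⊛-degree₀ f g hf)) (heval-scale b (f 0) g)
  heval-⊛ (suc a) b f g hf hg = begin
    f 0 * g 0 * (t * pow (a ℕ.+ b)) + s * heval (a ℕ.+ b) (shift (f ⊛ g))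
      ≡⟨ cong (λ z → f 0 * g 0 * (t * pow (a ℕ.+ b)) + s * z) (trans (heval-cong (a ℕ.+ b) (⊛-shift f g))
           (trans (heval-+ (a ℕ.+ b) (λ k → f 0 * g (suc k)) (shift f ⊛ g))
             (cong₂ _+_ (heval-scale (a ℕ.+ b) (f 0) (shift g)) (heval-⊛ a b (shift f) g (shift-degree {a} {f} hf) hg)))) ⟩
    f 0 * g 0 * (t * pow (a ℕ.+ b)) + s * (f 0 * heval (a ℕ.+ b) (shift g) + heval a (shift f) * heval b g)
      ≡⟨ regroup (f 0) (g 0) (t * pow (a ℕ.+ b)) s (heval (a ℕ.+ b) (shift g)) (heval a (shift f) * heval b g) ⟩
    f 0 * heval (suc a ℕ.+ b) g + s * (heval a (shift f) * heval b g)
      ≡⟨ cong (λ z → f 0 * z + s * (heval a (shift f) * heval b g)) (heval-raise (suc a) b g hg) ⟩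
    f 0 * (pow (suc a) * heval b g) + s * (heval a (shift f) * heval b g)
      ≡⟨ factor (f 0) (pow (suc a)) (heval b g) s (heval a (shift f)) ⟩
    heval (suc a) f * heval b g ∎
    where
    regroup : ∀ x y p s u v → x * y * p + s * (x * u + v) ≡ x * (y * p + s * u) + s * v
    regroup = solve-∀
    factor : ∀ x p h s u → x * (p * h) + s * (u * h) ≡ (x * p + s * u) * h
    factor = solve-∀

open Homogenised using (heval)

module LP = Lin PSops

∑ₚ-degree : ∀ d (f : Fin n → PS) → (∀ i → Degree≤ d (f i)) → Degree≤ d (LP.sumF f)
∑ₚ-degree {zero}  d f h k lt = refl
∑ₚ-degree {suc n} d f h k lt = cong₂ _+_ (h zero k lt) (∑ₚ-degree d (λ i → f (suc i)) (λ i → h (suc i)) k lt)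

altₚ-degree : ∀ d j f → Degree≤ d f → Degree≤ d (LP.alt j f)
altₚ-degree d zero    f h k lt = h k lt
altₚ-degree d (suc j) f h k lt = cong -_ (altₚ-degree d j f h k lt)

detₚ-degree : (P : Fin n → Fin n → PS) → (∀ i j → Degree≤ 1 (P i j)) → Degree≤ n (LP.det n P)
detₚ-degree {zero}  P h (suc k) lt = refl
detₚ-degree {suc n} P h = ∑ₚ-degree (suc n) _ (λ j → altₚ-degree (suc n) (toℕ j) _
  (⊛-degree 1 n {P zero j} (h zero j) (detₚ-degree (λ i k → P (suc i) (punchIn j k)) (λ i k → h (suc i) (punchIn j k)))))

module _ (s t : ℤ) where
  open Homogenised s t hiding (heval)

  heval-∑ : ∀ d (f : Fin n → PS) → heval s t d (LP.sumF f) ≡ ∑ (λ i → heval s t d (f i))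
  heval-∑ {zero}  d f = heval-zero d
  heval-∑ {suc n} d f = trans (heval-+ d (f zero) (LP.sumF (λ i → f (suc i)))) (cong (_+_ (heval s t d (f zero))) (heval-∑ d (λ i → f (suc i))))

  heval-alt : ∀ d j f → heval s t d (LP.alt j f) ≡ alt j (heval s t d f)
  heval-alt d zero    f = refl
  heval-alt d (suc j) f = trans (heval-cong d (λ k → sym (ℤₚ.-1*i≡-i (LP.alt j f k)))) (trans (heval-scale d (- + 1) (LP.alt j f))
    (trans (ℤₚ.-1*i≡-i (heval s t d (LP.alt j f))) (cong -_ (heval-alt d j f))))

  heval-det : (P : Fin n → Fin n → PS) → (∀ i j → Degree≤ 1 (P i j)) →
    heval s t n (LP.det n P) ≡ detℤ (λ i j → heval s t 1 (P i j))
  heval-det {zero}  P h = refl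
  heval-det {suc n} P h = trans (heval-∑ (suc n) term) (∑-cong (λ j →
    trans (heval-alt (suc n) (toℕ j) (P zero j ⊛ cofactor j)) (cong (alt (toℕ j))
      (trans (heval-⊛ 1 n (P zero j) (cofactor j) (h zero j) (detₚ-degree _ (λ i k → h (suc i) (punchIn j k))))
        (cong (heval s t 1 (P zero j) *_) (heval-det (λ i k → P (suc i) (punchIn j k)) (λ i k → h (suc i) (punchIn j k))))))))
    where
    cofactor : Fin (suc n) → PS
    cofactor j = LP.det n (λ i k → P (suc i) (punchIn j k))
    term : Fin (suc n) → PS
    term j = LP.alt (toℕ j) (P zero j ⊛ cofactor j)

charEntry : Matrix ℤ n → Fin n → Fin n → PS
charEntry M i j k = (LP.δ i j ⊛ Defs.X) k + constPS (- M i j) k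

δₚ-degree : (i j : Fin n) → Degree≤ 0 (LP.δ i j)
δₚ-degree i j (suc k) lt with i ≟ j
... | yes _ = refl
... | no  _ = refl

δₚ-zero : (i j : Fin n) → LP.δ i j 0 ≡ δ i j
δₚ-zero i j with i ≟ j
... | yes _ = refl
... | no  _ = refl

charEntry-degree : (M : Matrix ℤ n) → ∀ i j → Degree≤ 1 (charEntry M i j)
charEntry-degree M i j (suc (suc k)) lt = cong (_+ + 0) (trans (⊛-degree₀ (LP.δ i j) Defs.X (δₚ-degree i j) (suc (suc k)))
  (ℤₚ.*-zeroʳ (LP.δ i j 0)))
charEntry-degree M i j (suc zero) (ℕ.s≤s ())

charPoly-degree : (M : Matrix ℤ n) → Degree≤ n (charPoly M)
charPoly-degree M = detₚ-degree (charEntry M) (charEntry-degree M)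

heval-charPoly : ∀ s t (M : Matrix ℤ n) → heval s t n (charPoly M) ≡ detℤ (λ i j → s * δ i j - t * M i j)
heval-charPoly s t M = trans (heval-det s t (charEntry M) (charEntry-degree M))
  (det-cong {M = λ i j → heval s t 1 (charEntry M i j)} (λ i j → trans
    (cong₂ (λ x y → x * (t * + 1) + s * y)
      (cong (_+ - M i j) (trans (⊛-degree₀ (LP.δ i j) Defs.X (δₚ-degree i j) 0) (ℤₚ.*-zeroʳ (LP.δ i j 0))))
      (cong (_+ + 0) (trans (⊛-degree₀ (LP.δ i j) Defs.X (δₚ-degree i j) 1) (cong (_* + 1) (δₚ-zero i j)))))
    (lemma s t (δ i j) (M i j))))
  where
  lemma : ∀ s t d m → (+ 0 + - m) * (t * + 1) + s * (d * + 1 + + 0) ≡ s * d - t * m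
  lemma = solve-∀

-- Both parameters are kept free because the characteristic matrices are later used in the reversed
-- form I - tA and, for the complement, with s = -1 - t.
sameSpectrum⇒det : {M N : Matrix ℤ n} → SameSpectrum M N → ∀ s t →
  detℤ (λ i j → s * δ i j - t * M i j) ≡ detℤ (λ i j → s * δ i j - t * N i j)
sameSpectrum⇒det {n} {M} {N} h s t = trans (sym (heval-charPoly s t M))
  (trans (Homogenised.heval-cong s t n h) (heval-charPoly s t N))

-- The divisor `∣ x ∣ + 1` is already too large for a nonzero `x`.
∣-all⇒≡0 : ∀ x → (∀ k → + suc k ∣ x) → x ≡ + 0
∣-all⇒≡0 x h with ∣ x ∣ in eq | ℤ∣.∣⇒∣ᵤ (h ∣ x ∣)
... | zero  | _ = ℤₚ.∣i∣≡0⇒i≡0 eq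
... | suc a | d = contradiction (ℕ∣.∣⇒≤ d) (ℕₚ.<⇒≱ ℕₚ.≤-refl)

-- Evaluating at s > 0 only: f 0 - g 0 is divisible by every s, hence zero, and then s cancels.
heval-injective : ∀ d {f g} → Degree≤ d f → Degree≤ d g →
  (∀ k → heval (+ suc k) (+ 1) d f ≡ heval (+ suc k) (+ 1) d g) → ∀ k → f k ≡ g k
heval-injective zero    hf hg h zero    = h 0
heval-injective zero    hf hg h (suc k) = trans (hf (suc k) (ℕ.s≤s ℕ.z≤n)) (sym (hg (suc k) (ℕ.s≤s ℕ.z≤n)))
heval-injective (suc d) {f} {g} hf hg h = all
  where
  pow1 : ∀ s e → Homogenised.pow s (+ 1) e ≡ + 1
  pow1 s zero    = refl
  pow1 s (suc e) = trans (ℤₚ.*-identityˡ (Homogenised.pow s (+ 1) e)) (pow1 s e)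
  values : ∀ k → f 0 + + suc k * heval (+ suc k) (+ 1) d (shift f) ≡ g 0 + + suc k * heval (+ suc k) (+ 1) d (shift g)
  values k = trans (sym (unit (f 0) (heval (+ suc k) (+ 1) d (shift f)))) (trans (h k) (unit (g 0) (heval (+ suc k) (+ 1) d (shift g))))
    where
    unit : ∀ x y → x * Homogenised.pow (+ suc k) (+ 1) (suc d) + + suc k * y ≡ x + + suc k * y
    unit x y = cong (_+ + suc k * y) (trans (cong (x *_) (pow1 (+ suc k) (suc d))) (ℤₚ.*-identityʳ x))
  lemma : ∀ x y s u v → x + s * u ≡ y + s * v → x - y ≡ (v - u) * s
  lemma x y s u v eq = trans (l₁ x y s u) (trans (cong (λ z → z - y - s * u) eq) (l₂ y s u v))
    where
    l₁ : ∀ x y s u → x - y ≡ x + s * u - y - s * u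
    l₁ = solve-∀
    l₂ : ∀ y s u v → y + s * v - y - s * u ≡ (v - u) * s
    l₂ = solve-∀
  f0≡g0 : f 0 ≡ g 0
  f0≡g0 = ℤₚ.i-j≡0⇒i≡j (f 0) (g 0) (∣-all⇒≡0 (f 0 - g 0) (λ k → divides (heval (+ suc k) (+ 1) d (shift g) - heval (+ suc k) (+ 1) d (shift f))
    (lemma (f 0) (g 0) (+ suc k) (heval (+ suc k) (+ 1) d (shift f)) (heval (+ suc k) (+ 1) d (shift g)) (values k))))
  rest : ∀ k → heval (+ suc k) (+ 1) d (shift f) ≡ heval (+ suc k) (+ 1) d (shift g)
  rest k = *-cancelˡ-≢0 {+ suc k} (λ ()) (∙-cancelˡ (g 0) (+ suc k * heval (+ suc k) (+ 1) d (shift f)) (+ suc k * heval (+ suc k) (+ 1) d (shift g))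
    (trans (cong (_+ + suc k * heval (+ suc k) (+ 1) d (shift f)) (sym f0≡g0)) (values k)))
  all : ∀ k → f k ≡ g k
  all zero    = f0≡g0
  all (suc k) = heval-injective d {shift f} {shift g} (shift-degree {d} {f} hf) (shift-degree {d} {g} hg) rest k

det⇒sameSpectrum : {M N : Matrix ℤ n} →
  (∀ s → detℤ (λ i j → s * δ i j - + 1 * M i j) ≡ detℤ (λ i j → s * δ i j - + 1 * N i j)) → SameSpectrum M N
det⇒sameSpectrum {n} {M} {N} h = heval-injective n (charPoly-degree M) (charPoly-degree N)
  (λ k → trans (heval-charPoly (+ suc k) (+ 1) M) (trans (h (+ suc k)) (sym (heval-charPoly (+ suc k) (+ 1) N))))

-- Walk vectors and walk counts

infix 8 _⋆_
_⋆_ : (Fin n → ℤ) → (Fin n → ℤ) → ℤ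
x ⋆ y = ∑ (λ i → x i * y i)

infixr 9 _⊙_
_⊙_ : (Fin m → Fin n → ℤ) → (Fin n → ℤ) → Fin m → ℤ
(M ⊙ x) i = M i ⋆ x

⋆-cong : {x x′ y y′ : Fin n → ℤ} → (∀ i → x i ≡ x′ i) → (∀ i → y i ≡ y′ i) → x ⋆ y ≡ x′ ⋆ y′
⋆-cong h h′ = ∑-cong (λ i → cong₂ _*_ (h i) (h′ i))

⋆-comm : (x y : Fin n → ℤ) → x ⋆ y ≡ y ⋆ x
⋆-comm x y = ∑-cong (λ i → ℤₚ.*-comm (x i) (y i))

⋆-linear : (x : Fin n → ℤ) (a b : ℤ) (y z : Fin n → ℤ) →
  x ⋆ (λ i → a * y i + b * z i) ≡ a * x ⋆ y + b * x ⋆ z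
⋆-linear x a b y z = trans (∑-cong (λ i → lemma (x i) a b (y i) (z i))) (∑-linear a b (λ i → x i * y i) (λ i → x i * z i))
  where
  lemma : ∀ x a b y z → x * (a * y + b * z) ≡ a * (x * y) + b * (x * z)
  lemma = solve-∀

⋆-∑ : (x : Fin n → ℤ) (c : Fin m → ℤ) (y : Fin m → Fin n → ℤ) →
  x ⋆ (λ i → ∑ (λ k → c k * y k i)) ≡ ∑ (λ k → c k * x ⋆ y k)
⋆-∑ x c y = begin
  ∑ (λ i → x i * ∑ (λ k → c k * y k i)) ≡⟨ ∑-cong (λ i → sym (∑-*ˡ (x i) (λ k → c k * y k i))) ⟩
  ∑ (λ i → ∑ (λ k → x i * (c k * y k i))) ≡⟨ ∑-swap (λ i k → x i * (c k * y k i)) ⟩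
  ∑ (λ k → ∑ (λ i → x i * (c k * y k i))) ≡⟨ ∑-cong (λ k → trans (∑-cong (λ i → lemma (x i) (c k) (y k i))) (∑-*ˡ (c k) (λ i → x i * y k i))) ⟩
  ∑ (λ k → c k * x ⋆ y k) ∎
  where
  lemma : ∀ x c y → x * (c * y) ≡ c * (x * y)
  lemma = solve-∀

⋆-⊙ : (x : Fin m → ℤ) (M : Fin m → Fin n → ℤ) (y : Fin n → ℤ) → x ⋆ (M ⊙ y) ≡ (M ᵀ ⊙ x) ⋆ y
⋆-⊙ x M y = begin
  x ⋆ (M ⊙ y) ≡⟨ ⋆-cong {x = x} (λ _ → refl) (λ i → ∑-cong (λ k → ℤₚ.*-comm (M i k) (y k))) ⟩
  x ⋆ (λ i → ∑ (λ k → y k * M i k)) ≡⟨ ⋆-∑ x y (M ᵀ) ⟩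
  y ⋆ (λ k → x ⋆ (M ᵀ) k) ≡⟨ ⋆-comm y (λ k → x ⋆ (M ᵀ) k) ⟩
  (λ k → x ⋆ (M ᵀ) k) ⋆ y ≡⟨ ⋆-cong {y = y} (λ k → ⋆-comm x ((M ᵀ) k)) (λ _ → refl) ⟩
  (M ᵀ ⊙ x) ⋆ y ∎

adjMat-sym : (G : Graph n) → ∀ i j → adjMat G i j ≡ adjMat G j i
adjMat-sym G i j = cong (λ b → if b then + 1 else + 0) (Graph.sym G i j)

adjMat-diagonal : (G : Graph n) → ∀ i → adjMat G i i ≡ + 0
adjMat-diagonal G i = cong (λ b → if b then + 1 else + 0) (Graph.irrefl G i)

⋆-adjMat : (G : Graph n) (x y : Fin n → ℤ) → x ⋆ (adjMat G ⊙ y) ≡ (adjMat G ⊙ x) ⋆ y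
⋆-adjMat G x y = trans (⋆-⊙ x (adjMat G) y)
  (⋆-cong {y = y} (λ i → ⋆-cong {y = x} (λ k → adjMat-sym G k i) (λ _ → refl)) (λ _ → refl))

walkCount : Graph n → ℕ → ℤ
walkCount G k = ∑ (walkVec G k)

walkVec-⋆ : (G : Graph n) → ∀ a b → walkVec G a ⋆ walkVec G b ≡ walkCount G (a ℕ.+ b)
walkVec-⋆ G zero    b = ∑-cong (λ i → ℤₚ.*-identityˡ (walkVec G b i))
walkVec-⋆ G (suc a) b = trans (sym (⋆-adjMat G (walkVec G a) (walkVec G b)))
  (trans (walkVec-⋆ G a (suc b)) (cong (walkCount G) (ℕₚ.+-suc a b)))

-- Walk counts of generalized cospectral graphs.

det-scale : ∀ c (M : Matrix ℤ n) → detℤ (λ i j → c * M i j) ≡ detℤ (λ i j → c * δ {n} i j) * detℤ M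
det-scale c M = trans (det-cong {M = λ i j → c * M i j} {(λ i j → c * δ i j) ∙ M} (λ i j → sym (∑-scaled-δˡ c i (λ k → M k j))))
  (det-∙ (λ i j → c * δ i j) M)

det-scale-cancel : ∀ {c} → c ≢ + 0 → (M N : Matrix ℤ n) →
  detℤ (λ i j → c * M i j) ≡ detℤ (λ i j → c * N i j) → detℤ M ≡ detℤ N
det-scale-cancel {n} {c} c≢0 M N h = *-cancelˡ-≢0 (det-scalar-≢0 {n} c≢0) (trans (sym (det-scale c M)) (trans h (det-scale c N)))

-- The two products of the bordered matrices are block triangular.
det-rank-one : (u : Fin n → ℤ) → detℤ (λ i j → δ i j + u j) ≡ + 1 + ∑ u
det-rank-one {n} u = begin
  detℤ (λ i j → δ i j + u j) ≡⟨ sym (ℤₚ.*-identityˡ (detℤ (λ i j → δ i j + u j))) ⟩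
  + 1 * detℤ (λ i j → δ i j + u j)
    ≡⟨ cong₂ _*_ (sym (∑-δˡ zero (λ k → P k zero))) (det-cong (λ i j → sym (EP-block i j))) ⟩
  (E ∙ P) zero zero * detℤ (λ i j → (E ∙ P) (suc i) (suc j))
    ≡⟨ sym (det-block (E ∙ P) (λ i → trans (cong (_+_ (+ 1)) (∑-δˡ i (λ _ → - + 1))) refl)) ⟩
  detℤ (E ∙ P) ≡⟨ det-∙ E P ⟩
  detℤ E * detℤ P ≡⟨ ℤₚ.*-comm (detℤ E) (detℤ P) ⟩
  detℤ P * detℤ E ≡⟨ sym (det-∙ P E) ⟩
  detℤ (P ∙ E) ≡⟨ det-block (P ∙ E) (λ i → trans (cong (_+_ (- + 1)) (∑-δˡ i (λ _ → + 1))) refl) ⟩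
  (P ∙ E) zero zero * detℤ (λ i j → (P ∙ E) (suc i) (suc j))
    ≡⟨ cong₂ _*_ (cong (_+_ (+ 1)) (∑-cong (λ k → ℤₚ.*-identityʳ (u k)))) (trans (det-cong PE-block) (det-δ n)) ⟩
  (+ 1 + ∑ u) * + 1 ≡⟨ ℤₚ.*-identityʳ (+ 1 + ∑ u) ⟩
  + 1 + ∑ u ∎
  where
  E P : Matrix ℤ (suc n)
  E = (+ 1 ◂ (λ _ → + 0)) ◂ (λ i → + 1 ◂ δ i)
  P = (+ 1 ◂ u) ◂ (λ i → - + 1 ◂ δ i)
  EP-block : ∀ i j → (E ∙ P) (suc i) (suc j) ≡ δ i j + u j
  EP-block i j = trans (cong₂ _+_ (ℤₚ.*-identityˡ (u j)) (∑-δˡ i (λ k → δ k j))) (ℤₚ.+-comm (u j) (δ i j))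
  PE-block : ∀ i j → (P ∙ E) (suc i) (suc j) ≡ δ i j
  PE-block i j = trans (cong (_+_ (- + 1 * + 0)) (∑-δˡ i (λ k → δ k j))) (ℤₚ.+-identityˡ (δ i j))

module WalkSeries (G : Graph n) (t : ℤ) where
  open Homogenised (+ 1) t using (pow)

  resolvent : Matrix ℤ n
  resolvent i j = + 1 * δ i j - t * adjMat G i j

  partialVec : ℕ → Fin n → ℤ
  partialVec zero    j = + 0
  partialVec (suc k) j = partialVec k j + t * (pow k * walkVec G k j)

  partialSum : ℕ → ℤ
  partialSum zero    = + 0
  partialSum (suc k) = partialSum k + t * (pow k * walkCount G k)

  ∑-partialVec : ∀ k → ∑ (partialVec k) ≡ partialSum k
  ∑-partialVec zero    = ∑-zero {n} (λ _ → refl)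
  ∑-partialVec (suc k) = trans (∑-+ (partialVec k) (λ j → t * (pow k * walkVec G k j)))
    (cong₂ _+_ (∑-partialVec k) (trans (∑-*ˡ t (λ j → pow k * walkVec G k j)) (cong (t *_) (∑-*ˡ (pow k) (walkVec G k)))))

  telescope : ∀ k j → partialVec k ⋆ (λ i → resolvent i j) ≡ t - t * (pow k * walkVec G k j)
  telescope zero    j = trans (∑-zero {n} (λ _ → refl)) (lemma t)
    where
    lemma : ∀ t → + 0 ≡ t - t * (+ 1 * + 1)
    lemma = solve-∀
  telescope (suc k) j = begin
    partialVec (suc k) ⋆ (λ i → resolvent i j)
      ≡⟨ trans (∑-cong (λ i → expand (partialVec k i) t (pow k) (walkVec G k i) (δ i j) (adjMat G i j)))
           (∑-linear (+ 1) (t * pow k) (λ i → partialVec k i * resolvent i j) (λ i → walkVec G k i * δ i j + - t * (adjMat G i j * walkVec G k i))) ⟩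
    + 1 * partialVec k ⋆ (λ i → resolvent i j) + t * pow k * ∑ (λ i → walkVec G k i * δ i j + - t * (adjMat G i j * walkVec G k i))
      ≡⟨ cong₂ (λ x y → + 1 * x + t * pow k * y) (telescope k j)
           (trans (∑-+ (λ i → walkVec G k i * δ i j) (λ i → - t * (adjMat G i j * walkVec G k i)))
             (cong₂ _+_ (∑-δʳ j (walkVec G k)) (trans (∑-*ˡ (- t) (λ i → adjMat G i j * walkVec G k i))
               (cong (- t *_) (∑-cong (λ i → cong (_* walkVec G k i) (adjMat-sym G i j))))))) ⟩
    + 1 * (t - t * (pow k * walkVec G k j)) + t * pow k * (walkVec G k j + - t * walkVec G (suc k) j)
      ≡⟨ collapse t (pow k) (walkVec G k j) (walkVec G (suc k) j) ⟩
    t - t * (t * pow k * walkVec G (suc k) j) ∎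
    where
    expand : ∀ v t p w d a → (v + t * (p * w)) * (+ 1 * d - t * a) ≡ + 1 * (v * (+ 1 * d - t * a)) + t * p * (w * d + - t * (a * w))
    expand = solve-∀
    collapse : ∀ t p w x → + 1 * (t - t * (p * w)) + t * p * (w + - t * x) ≡ t - t * (t * p * x)
    collapse = solve-∀

  -- With v the partial vector, (I + e v^T)(I - tA) differs from I - tA + tJ by t^(k+1) e (A^k e)^T
  -- only, and `det-rank-one` evaluates the determinant of the first factor.
  det-series : ∀ k → pow (suc k) ∣ detℤ (λ i j → resolvent i j + t) - (+ 1 + partialSum k) * detℤ resolvent
  det-series k = subst (λ z → pow (suc k) ∣ detℤ (λ i j → resolvent i j + t) - z)
    (trans (det-∙ (λ i j → δ i j + partialVec k j) resolvent)
      (cong (_* detℤ resolvent) (trans (det-rank-one (partialVec k)) (cong (_+_ (+ 1)) (∑-partialVec k)))))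
    (det-∣ (λ i j → divides (walkVec G k j) (trans (cong (λ z → resolvent i j + t - z) (product i j))
      (lemma (resolvent i j) t (pow k) (walkVec G k j)))))
    where
    lemma : ∀ x t p w → x + t - (x + (t - t * (p * w))) ≡ w * (t * p)
    lemma = solve-∀
    product : ∀ i j → ((λ i j → δ i j + partialVec k j) ∙ resolvent) i j ≡ resolvent i j + (t - t * (pow k * walkVec G k j))
    product i j = trans (∑-cong (λ l → ℤₚ.*-distribʳ-+ (resolvent l j) (δ i l) (partialVec k l)))
      (trans (∑-+ (λ l → δ i l * resolvent l j) (λ l → partialVec k l * resolvent l j))
        (cong₂ _+_ (∑-δˡ i (λ l → resolvent l j)) (telescope k j)))

  det-resolvent : t ∣ detℤ resolvent - + 1
  det-resolvent = subst (λ z → t ∣ detℤ resolvent - z) (det-δ n)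
    (det-∣ (λ i j → divides (- adjMat G i j) (lemma (δ i j) t (adjMat G i j))))
    where
    lemma : ∀ d t a → + 1 * d - t * a - d ≡ - a * t
    lemma = solve-∀

open WalkSeries using (resolvent; partialSum)

-- Substitute J - I - A for the complement: the parameter -1 - t is the one for which its
-- characteristic matrix becomes -(I - tA + tJ).
compAdjMat-resolvent : (G : Graph n) (t : ℤ) → ∀ i j →
  (- + 1 - t) * δ i j - t * compAdjMat G i j ≡ - + 1 * (resolvent G t i j + t)
compAdjMat-resolvent G t i j with i ≟ j
... | yes refl = trans (on t) (cong (λ z → - + 1 * (+ 1 * + 1 - t * z + t)) (sym (adjMat-diagonal G i)))
  where
  on : ∀ t → (- + 1 - t) * + 1 - t * + 0 ≡ - + 1 * (+ 1 * + 1 - t * + 0 + t)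
  on = solve-∀
... | no _ with Graph.adj G i j
...   | true  = off t
  where
  off : ∀ t → (- + 1 - t) * + 0 - t * + 0 ≡ - + 1 * (+ 1 * + 0 - t * + 1 + t)
  off = solve-∀
...   | false = off t
  where
  off : ∀ t → (- + 1 - t) * + 0 - t * + 1 ≡ - + 1 * (+ 1 * + 0 - t * + 0 + t)
  off = solve-∀

∣-unit : ∀ {t x d} → t ∣ x * d → t ∣ d - + 1 → t ∣ x
∣-unit {t} {x} {d} h h′ = subst (t ∣_) (lemma x d) (ℤ∣.∣m∣n⇒∣m-n h (ℤ∣.∣n⇒∣m*n x h′))
  where
  lemma : ∀ x d → x * d - x * (d - + 1) ≡ x
  lemma = solve-∀

-- By strong induction the partial sums of both graphs agree below `k`. Subtracting the two
-- congruences modulo t^(k+2) and cancelling t^(k+1) leaves t dividing the difference of the `k`-th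
-- counts times det(I - tA). That determinant is 1 modulo t, so every positive t divides the
-- difference, which is therefore zero.
genCospectral⇒walkCount : {G H : Graph n} → GenCospectral G H → ∀ k → walkCount G k ≡ walkCount H k
genCospectral⇒walkCount {n} {G} {H} (spec , compSpec) k = below (suc k) k ℕₚ.≤-refl
  where
  d₀ : ∀ t → detℤ (resolvent G t) ≡ detℤ (resolvent H t)
  d₀ t = sameSpectrum⇒det {M = adjMat G} {adjMat H} spec (+ 1) t
  d₁ : ∀ t → detℤ (λ i j → resolvent G t i j + t) ≡ detℤ (λ i j → resolvent H t i j + t)
  d₁ t = det-scale-cancel {c = - + 1} (λ ()) (λ i j → resolvent G t i j + t) (λ i j → resolvent H t i j + t)
    (trans (det-cong (λ i j → sym (compAdjMat-resolvent G t i j)))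
      (trans (sameSpectrum⇒det {M = compAdjMat G} {compAdjMat H} compSpec (- + 1 - t) t) (det-cong (compAdjMat-resolvent H t))))
  partial-≡ : ∀ t k → (∀ l → l ℕ.< k → walkCount G l ≡ walkCount H l) → partialSum G t k ≡ partialSum H t k
  partial-≡ t zero    h = refl
  partial-≡ t (suc k) h = cong₂ (λ x y → x + t * (Homogenised.pow (+ 1) t k * y)) (partial-≡ t k (λ l lt → h l (ℕₚ.m<n⇒m<1+n lt))) (h k ℕₚ.≤-refl)
  pow≢0 : ∀ t → t ≢ + 0 → ∀ k → Homogenised.pow (+ 1) t k ≢ + 0
  pow≢0 t t≢0 zero    ()
  pow≢0 t t≢0 (suc k) = *-≢0 t≢0 (pow≢0 t t≢0 k)
  next : ∀ k → (∀ l → l ℕ.< k → walkCount G l ≡ walkCount H l) → walkCount G k ≡ walkCount H k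
  next k h = ℤₚ.i-j≡0⇒i≡j (walkCount G k) (walkCount H k) (∣-all⇒≡0 (walkCount G k - walkCount H k) (λ t′ → divisible (+ suc t′) (λ ())))
    where
    divisible : ∀ t → t ≢ + 0 → t ∣ walkCount G k - walkCount H k
    divisible t t≢0 = ∣-unit {d = detℤ (resolvent G t)} (ℤ∣.*-cancelˡ-∣ (t * pow k) {{ℤ.≢-nonZero (*-≢0 t≢0 (pow≢0 t t≢0 k))}}
      (subst₂ _∣_ (ℤₚ.*-comm t (t * pow k))
        (trans (cong₂ (λ x y → x - (+ 1 + partialSum H t (suc k)) * y - (detℤ (λ i j → resolvent G t i j + t) - (+ 1 + partialSum G t (suc k)) * detℤ (resolvent G t)))
           (sym (d₁ t)) (sym (d₀ t)))
          (trans (cong (λ p → detℤ (λ i j → resolvent G t i j + t) - (+ 1 + (p + t * (pow k * walkCount H k))) * detℤ (resolvent G t)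
                 - (detℤ (λ i j → resolvent G t i j + t) - (+ 1 + partialSum G t (suc k)) * detℤ (resolvent G t))) (sym (partial-≡ t k h)))
           (lemma (detℤ (λ i j → resolvent G t i j + t)) (partialSum G t k) t (pow k) (walkCount G k) (walkCount H k) (detℤ (resolvent G t)))))
        (ℤ∣.∣m∣n⇒∣m-n (WalkSeries.det-series H t (suc k)) (WalkSeries.det-series G t (suc k)))))
      (WalkSeries.det-resolvent G t)
      where
      open Homogenised (+ 1) t using (pow)
      lemma : ∀ D p t w a b d → D - (+ 1 + (p + t * (w * b))) * d - (D - (+ 1 + (p + t * (w * a))) * d) ≡ t * w * ((a - b) * d)
      lemma = solve-∀
  below : ∀ k l → l ℕ.< k → walkCount G l ≡ walkCount H l
  below (suc k) l (ℕ.s≤s l≤k) = next l (λ j j<l → below k j (ℕₚ.<-≤-trans j<l l≤k))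

-- The kernel of the transposed walk matrix

-- In U M V = diag, `u` and `b` are the rows of U and the columns of its inverse, `v*` and `v` the
-- rows of the inverse of V and the columns of V. These are two pairs of dual bases, and the Smith
-- form says that M carries `v i` to `d i` times `b i`.
record SmithBases (M : Matrix ℤ n) (d : Fin n → ℤ) : Set where
  field
    u b v v* : Fin n → Fin n → ℤ
    expand-u : ∀ y a → y a ≡ ∑ (λ i → b i ⋆ y * u i a)
    expand-b : ∀ x a → x a ≡ ∑ (λ i → u i ⋆ x * b i a)
    expand-v : ∀ x a → x a ≡ ∑ (λ i → v* i ⋆ x * v i a)
    b⋆u      : ∀ i → b i ⋆ u i ≡ + 1
    v*⋆v     : ∀ i → v* i ⋆ v i ≡ + 1
    image-v  : ∀ i a → (M ⊙ v i) a ≡ d i * b i a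
    coimage-u : ∀ i k → u i ⋆ (λ a → M a k) ≡ d i * v* i k

unimodular-inverse : {U : Matrix ℤ n} → Unimodular U →
  ∃[ U⁻ ] (∀ i j → (U ∙ U⁻) i j ≡ δ i j) × (∀ i j → (U⁻ ∙ U) i j ≡ δ i j)
unimodular-inverse {n} {U} unimodular = U⁻ , right , left
  where
  ±1 : detℤ U * detℤ U ≡ + 1
  ±1 = [ cong (λ x → x * x) , cong (λ x → x * x) ]′ unimodular
  U⁻ : Matrix ℤ n
  U⁻ i j = detℤ U * adjugate U i j
  left-comm : ∀ a b c → a * (b * c) ≡ b * (a * c)
  left-comm = solve-∀
  right : ∀ i j → (U ∙ U⁻) i j ≡ δ i j
  right i j = begin
    ∑ (λ k → U i k * (detℤ U * adjugate U k j)) ≡⟨ ∑-cong (λ k → left-comm (U i k) (detℤ U) (adjugate U k j)) ⟩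
    ∑ (λ k → detℤ U * (U i k * adjugate U k j)) ≡⟨ ∑-*ˡ (detℤ U) (λ k → U i k * adjugate U k j) ⟩
    detℤ U * (U ∙ adjugate U) i j ≡⟨ cong (detℤ U *_) (∙-adjugate U i j) ⟩
    detℤ U * (detℤ U * δ i j) ≡⟨ sym (ℤₚ.*-assoc (detℤ U) (detℤ U) (δ i j)) ⟩
    detℤ U * detℤ U * δ i j ≡⟨ trans (cong (_* δ i j) ±1) (ℤₚ.*-identityˡ (δ i j)) ⟩
    δ i j ∎
  left : ∀ i j → (U⁻ ∙ U) i j ≡ δ i j
  left i j = trans (∙-comm-scalar U U⁻ {+ 1} (λ ()) (λ i j → trans (right i j) (sym (ℤₚ.*-identityˡ (δ i j)))) i j) (ℤₚ.*-identityˡ (δ i j))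

inverse-expand : (P Q : Matrix ℤ n) → (∀ i j → (P ∙ Q) i j ≡ δ i j) → ∀ y a → y a ≡ ∑ (λ i → (P ᵀ) i ⋆ y * Q i a)
inverse-expand P Q h y a = begin
  y a ≡⟨ sym (∑-δʳ a y) ⟩
  ∑ (λ c → y c * δ c a) ≡⟨ ∑-cong (λ c → cong (y c *_) (trans (sym (h c a)) (⋆-comm (P c) (λ i → Q i a)))) ⟩
  y ⋆ (λ c → ∑ (λ i → Q i a * P c i)) ≡⟨ ⋆-∑ y (λ i → Q i a) (P ᵀ) ⟩
  ∑ (λ i → Q i a * y ⋆ (P ᵀ) i) ≡⟨ ∑-cong (λ i → trans (ℤₚ.*-comm (Q i a) (y ⋆ (P ᵀ) i)) (cong (_* Q i a) (⋆-comm y ((P ᵀ) i)))) ⟩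
  ∑ (λ i → (P ᵀ) i ⋆ y * Q i a) ∎

hasSNF⇒smithBases : {M : Matrix ℤ n} {d : Fin n → ℤ} → HasSNF M d → SmithBases M d
hasSNF⇒smithBases {n} {M} {d} (U , V , unimodU , unimodV , snf) =
  assemble (unimodular-inverse {U = U} unimodU) (unimodular-inverse {U = V} unimodV)
  where
  assemble : ∃[ U⁻ ] (∀ i j → (U ∙ U⁻) i j ≡ δ i j) × (∀ i j → (U⁻ ∙ U) i j ≡ δ i j) →
    ∃[ V⁻ ] (∀ i j → (V ∙ V⁻) i j ≡ δ i j) × (∀ i j → (V⁻ ∙ V) i j ≡ δ i j) → SmithBases M d
  assemble (U⁻ , UU⁻ , U⁻U) (V⁻ , VV⁻ , V⁻V) = record
    { u = U ; b = U⁻ ᵀ ; v = V ᵀ ; v* = V⁻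
    ; expand-u = inverse-expand U⁻ U U⁻U
    ; expand-b = inverse-expand (U ᵀ) (U⁻ ᵀ) (λ c a → trans (⋆-comm (λ i → U i c) (U⁻ a)) (trans (U⁻U a c) (δ-sym a c)))
    ; expand-v = inverse-expand (V⁻ ᵀ) (V ᵀ) (λ c a → trans (⋆-comm (λ i → V⁻ i c) (V a)) (trans (VV⁻ a c) (δ-sym a c)))
    ; b⋆u = λ i → trans (⋆-comm ((U⁻ ᵀ) i) (U i)) (trans (UU⁻ i i) (δ-refl i))
    ; v*⋆v = λ i → trans (V⁻V i i) (δ-refl i)
    ; image-v = image
    ; coimage-u = coimage
    }
    where
    image : ∀ i a → (M ⊙ (V ᵀ) i) a ≡ d i * U⁻ a i
    image i a = begin
      (M ∙ V) a i ≡⟨ sym (∑-δˡ a (λ k → (M ∙ V) k i)) ⟩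
      (δ ∙ (M ∙ V)) a i ≡⟨ ∙-cong {N = M ∙ V} (λ a b → sym (U⁻U a b)) (λ _ _ → refl) a i ⟩
      ((U⁻ ∙ U) ∙ (M ∙ V)) a i ≡⟨ ∙-assoc U⁻ U (M ∙ V) a i ⟩
      (U⁻ ∙ (U ∙ (M ∙ V))) a i ≡⟨ ∙-cong {M = U⁻} (λ _ _ → refl) (λ k i → trans (sym (∙-assoc U M V k i)) (snf k i)) a i ⟩
      ∑ (λ k → U⁻ a k * (δ k i * d k)) ≡⟨ ∑-cong (λ k → lemma (U⁻ a k) (δ k i) (d k)) ⟩
      ∑ (λ k → d k * U⁻ a k * δ k i) ≡⟨ ∑-δʳ i (λ k → d k * U⁻ a k) ⟩
      d i * U⁻ a i ∎
      where
      lemma : ∀ a b c → a * (b * c) ≡ c * a * b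
      lemma = solve-∀
    coimage : ∀ i k → (U ∙ M) i k ≡ d i * V⁻ i k
    coimage i k = begin
      (U ∙ M) i k ≡⟨ sym (∑-δʳ k ((U ∙ M) i)) ⟩
      ((U ∙ M) ∙ δ) i k ≡⟨ ∙-cong {M = U ∙ M} (λ _ _ → refl) (λ a b → sym (VV⁻ a b)) i k ⟩
      ((U ∙ M) ∙ (V ∙ V⁻)) i k ≡⟨ sym (∙-assoc (U ∙ M) V V⁻ i k) ⟩
      (((U ∙ M) ∙ V) ∙ V⁻) i k ≡⟨ ∙-cong {N = V⁻} snf (λ _ _ → refl) i k ⟩
      ∑ (λ l → δ i l * d i * V⁻ l k) ≡⟨ ∑-cong (λ l → cong (_* V⁻ l k) (ℤₚ.*-comm (δ i l) (d i))) ⟩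
      ∑ (λ l → d i * δ i l * V⁻ l k) ≡⟨ ∑-scaled-δˡ (d i) i (λ l → V⁻ l k) ⟩
      d i * V⁻ i k ∎

*-mono-∣ : ∀ {a b c d} → a ∣ b → c ∣ d → a * c ∣ b * d
*-mono-∣ {a} {b} {c} {d} h h′ = ℤ∣.∣-trans (ℤ∣.*-monoʳ-∣ a h′) (ℤ∣.*-monoˡ-∣ d h)

⋆-∣ : ∀ {a b} {x y : Fin n → ℤ} → (∀ i → a ∣ x i) → (∀ i → b ∣ y i) → a * b ∣ x ⋆ y
⋆-∣ h h′ = ∑-∣ (λ i → *-mono-∣ (h i) (h′ i))

⋆-∣ˡ : ∀ {N} {x y : Fin n → ℤ} → (∀ i → N ∣ x i) → N ∣ x ⋆ y
⋆-∣ˡ {y = y} h = ∑-∣ (λ i → ℤ∣.∣m⇒∣m*n (y i) (h i))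

⋆-∣ʳ : ∀ {N} {x y : Fin n → ℤ} → (∀ i → N ∣ y i) → N ∣ x ⋆ y
⋆-∣ʳ {x = x} h = ∑-∣ (λ i → ℤ∣.∣n⇒∣m*n (x i) (h i))

∑-∣-single : ∀ {N} (j : Fin n) (f : Fin n → ℤ) → (∀ i → i ≢ j → N ∣ f i) → N ∣ ∑ f - f j
∑-∣-single {suc n} {N} j f h = subst (N ∣_)
  (trans (lemma (f j) (∑ (f ∘ punchIn j))) (cong (_- f j) (sym (∑-punchIn j f))))
  (∑-∣ (λ i → h (punchIn j i) (Finₚ.punchInᵢ≢i j i)))
  where
  lemma : ∀ a b → b ≡ a + b - a
  lemma = solve-∀

Invertible : ℤ → ℤ → Set
Invertible N x = ∃[ y ] N ∣ x * y - + 1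

invertible-cancel : ∀ {N} x y → Invertible N x → N ∣ x * y → N ∣ y
invertible-cancel {N} x y (x′ , h) h′ = ∣-unit {N} {y} {x * x′} (subst (N ∣_) (lemma x y x′) (ℤ∣.∣n⇒∣m*n x′ h′)) h
  where
  lemma : ∀ x y x′ → x′ * (x * y) ≡ y * (x * x′)
  lemma = solve-∀

Kernel : Graph n → ℤ → (Fin n → ℤ) → Set
Kernel {n} G N y = ∀ (k : Fin n) → N ∣ walkVec G (toℕ k) ⋆ y

W⊙-⋆ : (G : Graph n) (g y : Fin n → ℤ) → (W G ⊙ g) ⋆ y ≡ g ⋆ (λ k → walkVec G (toℕ k) ⋆ y)
W⊙-⋆ G g y = trans (⋆-comm (W G ⊙ g) y) (trans (⋆-⊙ y (W G) g) (⋆-comm (W G ᵀ ⊙ y) g))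

-- A vector g is read as the coefficients of a polynomial, and `W G ⊙ g` as that polynomial in A
-- applied to e. The shift is multiplication by the variable with the top coefficient dropped;
-- `W-shiftV` restores the missing term.
shiftV : (Fin (suc n) → ℤ) → Fin (suc n) → ℤ
shiftV g zero    = + 0
shiftV g (suc i) = g (inject₁ i)

W-shiftV : (G : Graph (suc n)) (g : Fin (suc n) → ℤ) → ∀ a →
  (adjMat G ⊙ (W G ⊙ g)) a ≡ (W G ⊙ shiftV g) a + g (fromℕ n) * walkVec G (suc n) a
W-shiftV {n} G g a = begin
  adjMat G a ⋆ (W G ⊙ g)
    ≡⟨ ⋆-cong {x = adjMat G a} (λ _ → refl) (λ i → ⋆-comm (W G i) g) ⟩
  adjMat G a ⋆ (λ i → ∑ (λ k → g k * W G i k))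
    ≡⟨ ⋆-∑ (adjMat G a) g (W G ᵀ) ⟩
  ∑ (λ k → g k * walkVec G (suc (toℕ k)) a)
    ≡⟨ ∑-snoc (λ k → g k * walkVec G (suc (toℕ k)) a) ⟩
  ∑ (λ i → g (inject₁ i) * walkVec G (suc (toℕ (inject₁ i))) a) + g (fromℕ n) * walkVec G (suc (toℕ (fromℕ n))) a
    ≡⟨ cong₂ _+_ (∑-cong (λ i → trans (cong (λ k → g (inject₁ i) * walkVec G (suc k) a) (Finₚ.toℕ-inject₁ i))
          (ℤₚ.*-comm (g (inject₁ i)) (walkVec G (suc (toℕ i)) a))))
         (cong (λ k → g (fromℕ n) * walkVec G (suc k) a) (Finₚ.toℕ-fromℕ n)) ⟩
  ∑ (λ i → walkVec G (suc (toℕ i)) a * g (inject₁ i)) + g (fromℕ n) * walkVec G (suc n) a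
    ≡⟨ cong (_+ g (fromℕ n) * walkVec G (suc n) a) (sym (ℤₚ.+-identityˡ (∑ (λ i → walkVec G (suc (toℕ i)) a * g (inject₁ i))))) ⟩
  (W G ⊙ shiftV g) a + g (fromℕ n) * walkVec G (suc n) a ∎

module SmithKernel (G : Graph n) {d : Fin n → ℤ} (S : SmithBases (W G) d) where
  open SmithBases S

  image-⋆ : ∀ i y → (W G ⊙ v i) ⋆ y ≡ d i * b i ⋆ y
  image-⋆ i y = trans (∑-cong (λ a → trans (cong (_* y a) (image-v i a)) (ℤₚ.*-assoc (d i) (b i a) (y a)))) (∑-*ˡ (d i) (λ a → b i a * y a))

  kernel-coordinate : ∀ {N y} → Kernel G N y → ∀ i → N ∣ d i * b i ⋆ y
  kernel-coordinate {N} {y} ker i = subst (N ∣_) (trans (sym (W⊙-⋆ G (v i) y)) (image-⋆ i y)) (⋆-∣ʳ {x = v i} ker)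

  u-kernel : ∀ {N} i → N ∣ d i → Kernel G N (u i)
  u-kernel {N} i h k = subst (N ∣_) (trans (sym (coimage-u i k)) (⋆-comm (u i) (walkVec G (toℕ k)))) (ℤ∣.∣m⇒∣m*n (v* i k) h)

  module _ {N : ℤ} (ι : Fin n) (regular : ∀ i → i ≢ ι → ∀ {y} → N ∣ d i * y → N ∣ y) where

    -- Pairing the kernel condition with `v i` kills `d i` times the coordinate `b i ⋆ y`, and away
    -- from `ι` the factor `d i` cancels modulo `N`. Only the `u ι` term in the expansion of `y` is
    -- left.
    kernel-span : ∀ {y} → Kernel G N y → ∀ a → N ∣ y a - b ι ⋆ y * u ι a
    kernel-span {y} ker a = subst (λ z → N ∣ z - b ι ⋆ y * u ι a) (sym (expand-u y a))
      (∑-∣-single ι (λ i → b i ⋆ y * u i a) (λ i i≢ι → ℤ∣.∣m⇒∣m*n (u i a) (regular i i≢ι (kernel-coordinate ker i))))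

    relation-span : ∀ {g} → (∀ a → N ∣ (W G ⊙ g) a) → ∀ a → N ∣ g a - v* ι ⋆ g * v ι a
    relation-span {g} rel a = subst (λ z → N ∣ z - v* ι ⋆ g * v ι a) (sym (expand-v g a))
      (∑-∣-single ι (λ i → v* i ⋆ g * v i a) (λ i i≢ι → ℤ∣.∣m⇒∣m*n (v i a) (regular i i≢ι (subst (N ∣_) (coordinate i) (⋆-∣ʳ {x = u i} rel)))))
      where
      coordinate : ∀ i → u i ⋆ (W G ⊙ g) ≡ d i * v* i ⋆ g
      coordinate i = begin
        u i ⋆ (W G ⊙ g) ≡⟨ ⋆-⊙ (u i) (W G) g ⟩
        (W G ᵀ ⊙ u i) ⋆ g ≡⟨ ⋆-cong {y = g} (λ k → trans (⋆-comm ((W G ᵀ) k) (u i)) (coimage-u i k)) (λ _ → refl) ⟩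
        ∑ (λ k → d i * v* i k * g k) ≡⟨ trans (∑-cong (λ k → ℤₚ.*-assoc (d i) (v* i k) (g k))) (∑-*ˡ (d i) (λ k → v* i k * g k)) ⟩
        d i * v* i ⋆ g ∎

-- Here `r` stands for an odd prime and `N` for a power of it: `N = r` for the primes of b, and both
-- `N = p` and `N = p²` for p. Primality enters only through `unit` and `r∤1`.
module Eigen (G : Graph (suc n)) {d : Fin (suc n) → ℤ} (S : SmithBases (W G) d)
  {r N : ℤ} (r∤1 : ¬ r ∣ + 1) (r∣N : r ∣ N) (unit : ∀ x → ¬ r ∣ x → Invertible N x)
  (r∤d : ∀ i → i ≢ fromℕ n → ¬ r ∣ d i) (N∣dι : N ∣ d (fromℕ n)) where

  open SmithBases S
  open SmithKernel G S

  A : Matrix ℤ (suc n)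
  A = adjMat G

  ι : Fin (suc n)
  ι = fromℕ n

  regular : ∀ i → i ≢ ι → ∀ {y} → N ∣ d i * y → N ∣ y
  regular i i≢ι {y} = invertible-cancel (d i) y (unit (d i) (r∤d i i≢ι))

  regular′ : ∀ i → i ≢ ι → ∀ {y} → r ∣ d i * y → r ∣ y
  regular′ i i≢ι {z} with unit (d i) (r∤d i i≢ι)
  ... | y , h = invertible-cancel (d i) z (y , ℤ∣.∣-trans r∣N h)

  relation-vι : ∀ a → N ∣ (W G ⊙ v ι) a
  relation-vι a = subst (N ∣_) (sym (image-v ι a)) (ℤ∣.∣m⇒∣m*n (b ι a) N∣dι)

  -- Otherwise the shifted relation is a relation too, hence a multiple of v ι modulo r,
  -- and v ι vanishes modulo r from the top coefficient downwards.
  vι-top : ¬ r ∣ v ι ι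
  vι-top h = r∤1 (subst (r ∣_) (v*⋆v ι) (⋆-∣ʳ {x = v* ι} all))
    where
    shifted : ∀ a → r ∣ (W G ⊙ shiftV (v ι)) a
    shifted a = ℤ∣.∣m+n∣n⇒∣m {m = (W G ⊙ shiftV (v ι)) a} (subst (r ∣_) (W-shiftV G (v ι) a) (⋆-∣ʳ {x = A a} (λ i → ℤ∣.∣-trans r∣N (relation-vι i))))
      (ℤ∣.∣m⇒∣m*n (walkVec G (suc n) a) h)
    span : ∀ a → r ∣ shiftV (v ι) a - v* ι ⋆ shiftV (v ι) * v ι a
    span = relation-span ι regular′ {shiftV (v ι)} shifted
    all : ∀ a → r ∣ v ι a
    all = >-weakInduction (λ a → r ∣ v ι a) h (λ i h′ → ℤ∣.∣m+n∣n⇒∣m {m = v ι (inject₁ i)} (span (suc i)) (ℤ∣.∣m⇒∣-m (ℤ∣.∣n⇒∣m*n (v* ι ⋆ shiftV (v ι)) h′)))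

  -- Applying A to the relation `v ι` expresses `v ι ι` times the next walk vector by the earlier
  -- ones modulo `N`, and `v ι ι` is a unit by `vι-top`. This takes the place of the Cayley-Hamilton
  -- theorem.
  kernel-next : ∀ {y} → Kernel G N y → N ∣ walkVec G (suc n) ⋆ y
  kernel-next {y} ker = invertible-cancel (v ι ι) (walkVec G (suc n) ⋆ y) (unit (v ι ι) vι-top) (ℤ∣.∣m+n∣m⇒∣n {m = (W G ⊙ shiftV (v ι)) ⋆ y}
    (subst (N ∣_) split (⋆-∣ˡ {x = A ⊙ (W G ⊙ v ι)} {y} (λ a → ⋆-∣ʳ {x = A a} relation-vι)))
    (subst (N ∣_) (sym (W⊙-⋆ G (shiftV (v ι)) y)) (⋆-∣ʳ {x = shiftV (v ι)} ker)))
    where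
    distr : ∀ s c w y → (s + c * w) * y ≡ + 1 * (s * y) + c * (w * y)
    distr = solve-∀
    split : (A ⊙ (W G ⊙ v ι)) ⋆ y ≡ (W G ⊙ shiftV (v ι)) ⋆ y + v ι ι * walkVec G (suc n) ⋆ y
    split = begin
      (A ⊙ (W G ⊙ v ι)) ⋆ y
        ≡⟨ ∑-cong (λ a → trans (cong (_* y a) (W-shiftV G (v ι) a)) (distr ((W G ⊙ shiftV (v ι)) a) (v ι ι) (walkVec G (suc n) a) (y a))) ⟩
      ∑ (λ a → + 1 * ((W G ⊙ shiftV (v ι)) a * y a) + v ι ι * (walkVec G (suc n) a * y a))
        ≡⟨ ∑-linear (+ 1) (v ι ι) (λ a → (W G ⊙ shiftV (v ι)) a * y a) (λ a → walkVec G (suc n) a * y a) ⟩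
      + 1 * (W G ⊙ shiftV (v ι)) ⋆ y + v ι ι * walkVec G (suc n) ⋆ y
        ≡⟨ cong (_+ v ι ι * walkVec G (suc n) ⋆ y) (ℤₚ.*-identityˡ ((W G ⊙ shiftV (v ι)) ⋆ y)) ⟩
      (W G ⊙ shiftV (v ι)) ⋆ y + v ι ι * walkVec G (suc n) ⋆ y ∎

  kernel-invariant : ∀ {y} → Kernel G N y → Kernel G N (A ⊙ y)
  kernel-invariant {y} ker k = subst (N ∣_) (sym (⋆-adjMat G (walkVec G (toℕ k)) y)) shifted
    where
    shifted : N ∣ walkVec G (suc (toℕ k)) ⋆ y
    shifted with toℕ k ℕ.≟ n
    ... | yes eq = subst (λ k → N ∣ walkVec G (suc k) ⋆ y) (sym eq) (kernel-next {y} ker)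
    ... | no neq = subst (λ k → N ∣ walkVec G k ⋆ y) (Finₚ.toℕ-fromℕ< lt) (ker (fromℕ< lt))
      where
      lt : suc (toℕ k) ℕ.< suc n
      lt = ℕ.s≤s (ℕₚ.≤∧≢⇒< (ℕ.s≤s⁻¹ (Finₚ.toℕ<n k)) neq)

  -- The coordinate of `A ⊙ u ι` along `u ι`. As A preserves the kernel modulo `N`, which `u ι`
  -- spans, this is the scalar called c in the overview; it is distinct from the `c` defined further
  -- down.
  eigenvalue : ℤ
  eigenvalue = b ι ⋆ (A ⊙ u ι)

  -- The operator A minus the eigenvalue; the factor `+ 1` is written out so that it has the shape
  -- of `⋆-linear`.
  L : (Fin (suc n) → ℤ) → Fin (suc n) → ℤ
  L y a = + 1 * (A ⊙ y) a + - eigenvalue * y a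

  L-linear : ∀ c e y z a → L (λ i → c * y i + e * z i) a ≡ c * L y a + e * L z a
  L-linear c e y z a = trans (cong (λ x → + 1 * x + - eigenvalue * (c * y a + e * z a)) (⋆-linear (A a) c e y z))
    (lemma c e ((A ⊙ y) a) ((A ⊙ z) a) eigenvalue (y a) (z a))
    where
    lemma : ∀ c e Y Z l y z → + 1 * (c * Y + e * Z) + - l * (c * y + e * z) ≡ c * (+ 1 * Y + - l * y) + e * (+ 1 * Z + - l * z)
    lemma = solve-∀

  L-cong : ∀ {y z} → (∀ a → y a ≡ z a) → ∀ a → L y a ≡ L z a
  L-cong {y} {z} h a = cong₂ (λ x y → + 1 * x + - eigenvalue * y) (⋆-cong {x = A a} (λ _ → refl) h) (h a)

  L-∣ : ∀ {N y} → (∀ a → N ∣ y a) → ∀ a → N ∣ L y a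
  L-∣ {N} {y} h a = ℤ∣.∣m∣n⇒∣m+n (ℤ∣.∣n⇒∣m*n (+ 1) (⋆-∣ʳ {x = A a} h)) (ℤ∣.∣n⇒∣m*n (- eigenvalue) (h a))

  L-≡ : ∀ {N y z} → (∀ a → N ∣ y a - z a) → (∀ a → N ∣ L z a) → ∀ a → N ∣ L y a
  L-≡ {N} {y} {z} h hz a = subst (N ∣_) (trans (sym (L-linear (+ 1) (+ 1) (λ a → y a - z a) z a)) (L-cong {λ i → + 1 * (y i - z i) + + 1 * z i} {y} (λ a → lemma (y a) (z a)) a))
    (ℤ∣.∣m∣n⇒∣m+n (ℤ∣.∣n⇒∣m*n (+ 1) (L-∣ h a)) (ℤ∣.∣n⇒∣m*n (+ 1) (hz a)))
    where
    lemma : ∀ y z → + 1 * (y - z) + + 1 * z ≡ y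
    lemma = solve-∀

  L-self-adjoint : ∀ x y → x ⋆ L y ≡ L x ⋆ y
  L-self-adjoint x y = begin
    x ⋆ L y ≡⟨ ⋆-linear x (+ 1) (- eigenvalue) (A ⊙ y) y ⟩
    + 1 * x ⋆ (A ⊙ y) + - eigenvalue * x ⋆ y ≡⟨ cong₂ (λ p q → + 1 * p + - eigenvalue * q) (trans (⋆-adjMat G x y) (⋆-comm (A ⊙ x) y)) (⋆-comm x y) ⟩
    + 1 * y ⋆ (A ⊙ x) + - eigenvalue * y ⋆ x ≡⟨ sym (⋆-linear y (+ 1) (- eigenvalue) (A ⊙ x) x) ⟩
    y ⋆ L x ≡⟨ ⋆-comm y (L x) ⟩
    L x ⋆ y ∎

  uι-kernel : Kernel G N (u ι)
  uι-kernel = u-kernel ι N∣dι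

  kernel-eigen : ∀ {y} → Kernel G N y → ∀ a → N ∣ L y a
  kernel-eigen {y} ker = L-≡ {y = y} {λ a → b ι ⋆ y * u ι a} (kernel-span ι regular {y} ker) (λ a → subst (N ∣_)
      (sym (trans (L-cong {λ a → b ι ⋆ y * u ι a} {λ a → b ι ⋆ y * u ι a + + 0 * u ι a} (λ a → pad (b ι ⋆ y) (u ι a)) a)
        (trans (L-linear (b ι ⋆ y) (+ 0) (u ι) (u ι) a) (sym (pad (b ι ⋆ y) (L (u ι) a))))))
      (ℤ∣.∣n⇒∣m*n (b ι ⋆ y) (eigen-uι a)))
    where
    pad : ∀ c x → c * x ≡ c * x + + 0 * x
    pad = solve-∀
    shape : ∀ x l y → x - l * y ≡ + 1 * x + - l * y
    shape = solve-∀
    eigen-uι : ∀ a → N ∣ L (u ι) a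
    eigen-uι a = subst (N ∣_) (shape ((A ⊙ u ι) a) eigenvalue (u ι a))
      (kernel-span ι regular {A ⊙ u ι} (kernel-invariant {u ι} uι-kernel) a)

  module _ {x : Fin (suc n) → ℤ} (ker-x : Kernel G N x) (r∤x : ¬ r ∣ b ι ⋆ x) (N∣x⋆x : N ∣ x ⋆ x) where

    -- Modulo `N` the vector `x` is `b ι ⋆ x` times `u ι`, so its square is that unit times
    -- `u ι ⋆ x`.
    uι⋆x : N ∣ u ι ⋆ x
    uι⋆x = invertible-cancel (b ι ⋆ x) (u ι ⋆ x) (unit (b ι ⋆ x) r∤x) (subst (N ∣_)
      (trans (cong (λ z → x ⋆ x - z) (trans (∑-cong (λ a → distr (x a) (b ι ⋆ x) (u ι a))) (⋆-linear x (+ 1) (- (b ι ⋆ x)) x (u ι))))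
        (trans (lemma (x ⋆ x) (b ι ⋆ x) (x ⋆ u ι)) (cong (b ι ⋆ x *_) (⋆-comm x (u ι)))))
      (ℤ∣.∣m∣n⇒∣m-n N∣x⋆x (⋆-∣ʳ {x = x} (kernel-span ι regular {x} ker-x))))
      where
      distr : ∀ x c u → x * (x - c * u) ≡ x * (+ 1 * x + - c * u)
      distr = solve-∀
      lemma : ∀ s c t → s - (+ 1 * s + - c * t) ≡ c * t
      lemma = solve-∀

    inverse-d : Fin (suc n) → ℤ
    inverse-d i with i ≟ ι
    -- The factor `d ι` vanishes modulo `N`, but so does `u ι ⋆ x`, hence 0 is a correct choice
    -- here.
    ... | yes _   = + 0
    ... | no  i≢ι = proj₁ (unit (d i) (r∤d i i≢ι))

    -- Since `W` carries `v i` to `d i` times `b i`, the equation `W g = x` is solved modulo `N` by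
    -- dividing each coordinate of `x` in the basis `b` by `d i`.
    g₀ : Fin (suc n) → ℤ
    g₀ k = ∑ (λ i → inverse-d i * u i ⋆ x * v i k)

    W-g₀ : ∀ a → N ∣ (W G ⊙ g₀) a - x a
    W-g₀ a = subst (N ∣_) (cong₂ _-_ (sym image) (sym (expand-b x a)))
      (∣-∑-cong {f = λ i → inverse-d i * u i ⋆ x * (d i * b i a)} {λ i → u i ⋆ x * b i a} term)
      where
      image : (W G ⊙ g₀) a ≡ ∑ (λ i → inverse-d i * u i ⋆ x * (d i * b i a))
      image = trans (⋆-∑ (W G a) (λ i → inverse-d i * u i ⋆ x) v) (∑-cong (λ i → cong (inverse-d i * u i ⋆ x *_) (image-v i a)))
      term : ∀ i → N ∣ inverse-d i * u i ⋆ x * (d i * b i a) - u i ⋆ x * b i a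
      term i with i ≟ ι
      ... | yes refl = ℤ∣.∣m∣n⇒∣m-n (subst (N ∣_) (sym (zeroed (u i ⋆ x) (d i * b i a))) (divides (+ 0) refl)) (ℤ∣.∣m⇒∣m*n (b i a) uι⋆x)
        where
        zeroed : ∀ p q → + 0 * p * q ≡ + 0
        zeroed = solve-∀
      ... | no i≢ι with unit (d i) (r∤d i i≢ι)
      ...   | d′ , h = subst (N ∣_) (factor (u i ⋆ x) (b i a) (d i) d′) (ℤ∣.∣n⇒∣m*n (u i ⋆ x * b i a) h)
        where
        factor : ∀ p q d d′ → p * q * (d * d′ - + 1) ≡ d′ * p * (d * q) - p * q
        factor = solve-∀

    kinv : Invertible N (v ι ι)
    kinv = unit (v ι ι) vι-top

    α β : ℤ
    α = g₀ ι * proj₁ kinv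
    β = + 1 * g₀ ι + - α * v ι ι

    N∣β : N ∣ β
    N∣β = subst (N ∣_) (lemma (g₀ ι) (v ι ι) (proj₁ kinv)) (ℤ∣.∣n⇒∣m*n (- g₀ ι) (proj₂ kinv))
      where
      lemma : ∀ g k k′ → - g * (k * k′ - + 1) ≡ + 1 * g + - (g * k′) * k
      lemma = solve-∀

    -- Subtracting `α` times the relation `v ι` makes the top coefficient divisible by `N`, and
    -- subtracting `β` there makes it exactly zero. Exactness matters: A then acts on `W G ⊙ g` as
    -- the shift of `g` with no error term, and this identity is used modulo N^2, while the other
    -- ingredients are known only modulo `N`.
    g : Fin (suc n) → ℤ
    g a = + 1 * (+ 1 * g₀ a + - α * v ι a) + - β * δ ι a

    g-top : g ι ≡ + 0
    g-top = trans (cong (λ z → + 1 * β + - β * z) (δ-refl ι)) (lemma β)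
      where
      lemma : ∀ b → + 1 * b + - b * + 1 ≡ + 0
      lemma = solve-∀

    W-g : ∀ a → N ∣ (W G ⊙ g) a - x a
    W-g a = subst (N ∣_) (sym (trans (cong (_- x a) expand) (regroup ((W G ⊙ g₀) a) α ((W G ⊙ v ι) a) β ((W G ⊙ δ ι) a) (x a))))
      (ℤ∣.∣m∣n⇒∣m+n (ℤ∣.∣m∣n⇒∣m+n (W-g₀ a) (ℤ∣.∣n⇒∣m*n (- α) (relation-vι a))) (ℤ∣.∣m⇒∣m*n ((W G ⊙ δ ι) a) (ℤ∣.∣m⇒∣-m N∣β)))
      where
      expand : (W G ⊙ g) a ≡ + 1 * (+ 1 * (W G ⊙ g₀) a + - α * (W G ⊙ v ι) a) + - β * (W G ⊙ δ ι) a
      expand = trans (⋆-linear (W G a) (+ 1) (- β) (λ a → + 1 * g₀ a + - α * v ι a) (δ ι))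
        (cong (λ z → + 1 * z + - β * (W G ⊙ δ ι) a) (⋆-linear (W G a) (+ 1) (- α) g₀ (v ι)))
      regroup : ∀ p α q β s x → + 1 * (+ 1 * p + - α * q) + - β * s - x ≡ p - x + - α * q + - β * s
      regroup = solve-∀

    relation : Fin (suc n) → ℤ
    relation a = + 1 * shiftV g a + - eigenvalue * g a

    W-relation : ∀ a → (W G ⊙ relation) a ≡ L (W G ⊙ g) a
    W-relation a = trans (⋆-linear (W G a) (+ 1) (- eigenvalue) (shiftV g) g)
      (cong (λ z → + 1 * z + - eigenvalue * (W G ⊙ g) a) (sym (trans (W-shiftV G g a)
        (trans (cong (λ z → (W G ⊙ shiftV g) a + z * walkVec G (suc n) a) g-top) (ℤₚ.+-identityʳ ((W G ⊙ shiftV g) a))))))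

    relation-kernel : ∀ a → N ∣ (W G ⊙ relation) a
    relation-kernel a = subst (N ∣_) (sym (W-relation a)) (L-≡ {y = W G ⊙ g} {x} W-g (kernel-eigen {x} ker-x) a)

    c : ℤ
    c = v* ι ⋆ relation

    relation-≡ : ∀ a → N ∣ relation a - c * v ι a
    relation-≡ = relation-span ι regular {relation} relation-kernel

    -- If `r` divided `c`, then `relation` would vanish modulo `r`. Its entries are g_i - eigenvalue
    -- * g_(i+1) and the top entry of `g` is zero, so `g`, and with it `x`, would vanish modulo `r`
    -- from the top downwards.
    r∤c : ¬ r ∣ c
    r∤c r∣c = r∤x (⋆-∣ʳ {x = b ι} (λ a → ∣-difference (ℤ∣.∣-trans r∣N (W-g a)) (⋆-∣ʳ {x = W G a} r∣g)))
      where
      ∣-difference : ∀ {p q} → r ∣ p - q → r ∣ p → r ∣ q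
      ∣-difference {p} {q} h h′ = subst (r ∣_) (lemma p q) (ℤ∣.∣m∣n⇒∣m-n h′ h)
        where
        lemma : ∀ p q → p - (p - q) ≡ q
        lemma = solve-∀
      r∣relation : ∀ a → r ∣ relation a
      r∣relation a = ℤ∣.∣m+n∣n⇒∣m {m = relation a} (ℤ∣.∣-trans r∣N (relation-≡ a)) (ℤ∣.∣m⇒∣-m (ℤ∣.∣m⇒∣m*n (v ι a) r∣c))
      r∣g : ∀ a → r ∣ g a
      r∣g = >-weakInduction (λ a → r ∣ g a) (subst (r ∣_) (sym g-top) (divides (+ 0) refl))
        (λ i h → subst (r ∣_) (ℤₚ.*-identityˡ (g (inject₁ i))) (ℤ∣.∣m+n∣n⇒∣m {m = + 1 * g (inject₁ i)} (r∣relation (suc i)) (ℤ∣.∣n⇒∣m*n (- eigenvalue) h)))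

    -- Precision doubles because the error is a sum of two inner products whose two factors are each
    -- divisible by `N`: `relation - c v` against the walk pairings of `y`, and `W g - x` against
    -- `L y`.
    ⋆-L : ∀ {y} → Kernel G N y → N * N ∣ x ⋆ L y - c * (d ι * b ι ⋆ y)
    ⋆-L {y} ker = subst (N * N ∣_) (sym identity)
      (ℤ∣.∣m∣n⇒∣m-n (⋆-∣ relation-≡ ker) (⋆-∣ W-g (kernel-eigen {y} ker)))
      where
      sub-⋆ : ∀ {m} (p q z : Fin m → ℤ) → (λ i → p i - q i) ⋆ z ≡ p ⋆ z - q ⋆ z
      sub-⋆ p q z = trans (∑-cong (λ i → distr (p i) (q i) (z i))) (trans (∑-+ (λ i → p i * z i) (λ i → - (q i * z i))) (cong (_+_ (p ⋆ z)) (∑-neg (λ i → q i * z i))))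
        where
        distr : ∀ p q z → (p - q) * z ≡ p * z + - (q * z)
        distr = solve-∀
      ker-y = λ k → walkVec G (toℕ k) ⋆ y
      image : (W G ⊙ g) ⋆ L y ≡ relation ⋆ ker-y
      image = trans (L-self-adjoint (W G ⊙ g) y) (trans (⋆-cong {y = y} (λ a → sym (W-relation a)) (λ _ → refl)) (W⊙-⋆ G relation y))
      top : (λ a → c * v ι a) ⋆ ker-y ≡ c * (d ι * b ι ⋆ y)
      top = trans (trans (∑-cong (λ k → ℤₚ.*-assoc c (v ι k) (ker-y k))) (∑-*ˡ c (λ k → v ι k * ker-y k)))
        (cong (c *_) (trans (sym (W⊙-⋆ G (v ι) y)) (image-⋆ ι y)))
      lemma : ∀ p q s → p - q ≡ s - q - (s - p)
      lemma = solve-∀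
      identity : x ⋆ L y - c * (d ι * b ι ⋆ y) ≡ (λ a → relation a - c * v ι a) ⋆ ker-y - (λ a → (W G ⊙ g) a - x a) ⋆ L y
      identity = begin
        x ⋆ L y - c * (d ι * b ι ⋆ y)
          ≡⟨ lemma (x ⋆ L y) (c * (d ι * b ι ⋆ y)) (relation ⋆ ker-y) ⟩
        relation ⋆ ker-y - c * (d ι * b ι ⋆ y) - (relation ⋆ ker-y - x ⋆ L y)
          ≡⟨ cong₂ (λ p q → relation ⋆ ker-y - p - (q - x ⋆ L y)) (sym top) (sym image) ⟩
        relation ⋆ ker-y - (λ a → c * v ι a) ⋆ ker-y - ((W G ⊙ g) ⋆ L y - x ⋆ L y)
          ≡⟨ cong₂ _-_ (sym (sub-⋆ relation (λ a → c * v ι a) ker-y)) (sym (sub-⋆ (W G ⊙ g) x (L y))) ⟩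
        (λ a → relation a - c * v ι a) ⋆ ker-y - (λ a → (W G ⊙ g) a - x a) ⋆ L y ∎

  ⋆-L-leading : ∀ x → Kernel G N x → ¬ r ∣ b ι ⋆ x → N ∣ x ⋆ x →
    ∃[ c ] (¬ r ∣ c) × (∀ y → Kernel G N y → N * N ∣ x ⋆ L y - c * (d ι * b ι ⋆ y))
  ⋆-L-leading x ker r∤x N∣x⋆x = c {x} ker r∤x N∣x⋆x , r∤c {x} ker r∤x N∣x⋆x , λ y → ⋆-L {x} ker r∤x N∣x⋆x {y}

-- Units modulo a prime and modulo products.

+-∣ : ∀ {a b} → a ℕ∣.∣ b → + a ∣ + b
+-∣ = ℤ∣.∣ᵤ⇒∣

prime∤⇒coprime : ∀ {r x} → Prime r → ¬ r ℕ∣.∣ x → Coprime r x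
prime∤⇒coprime {r} {x} pr r∤x (e∣r , e∣x) with prime⇒irreducible pr e∣r
... | inj₁ e≡1 = e≡1
... | inj₂ refl = contradiction e∣x r∤x

coprime⇒invertible : ∀ {r x} → Coprime r x → Invertible (+ r) (+ x)
coprime⇒invertible {r} {x} coprime with coprime-Bézout coprime
... | Bézout.+- a b eq = - + b , divides (- + a) (trans (lemma (+ x) (+ b)) (trans (cong -_ eq′) (ℤₚ.neg-distribˡ-* (+ a) (+ r))))
  where
  lemma : ∀ x b → x * - b - + 1 ≡ - (+ 1 + b * x)
  lemma = solve-∀
  eq′ : + 1 + + b * + x ≡ + a * + r
  eq′ = trans (cong (_+_ (+ 1)) (sym (ℤₚ.pos-* b x))) (trans (cong +_ eq) (ℤₚ.pos-* a r))
... | Bézout.-+ a b eq = + b , divides (+ a) (trans (cong (_- + 1) (trans (ℤₚ.*-comm (+ x) (+ b)) (sym eq′))) (lemma (+ a * + r)))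
  where
  lemma : ∀ z → + 1 + z - + 1 ≡ z
  lemma = solve-∀
  eq′ : + 1 + + a * + r ≡ + b * + x
  eq′ = trans (cong (_+_ (+ 1)) (sym (ℤₚ.pos-* a r))) (trans (cong +_ eq) (ℤₚ.pos-* b x))

prime-unit : ∀ {r} → Prime r → ∀ x → ¬ + r ∣ x → Invertible (+ r) x
prime-unit {r} pr (+ x) r∤x = coprime⇒invertible (prime∤⇒coprime pr (r∤x ∘ +-∣))
prime-unit {r} pr x@(ℤ.-[1+ m ]) r∤x with coprime⇒invertible (prime∤⇒coprime pr (λ h → r∤x (ℤ∣.∣ᵤ⇒∣ h)))
... | y , h = - y , subst (λ z → + r ∣ z - + 1) (lemma (+ suc m) y) h
  where
  lemma : ∀ a b → a * b ≡ - a * - b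
  lemma = solve-∀

-- 1 - (1 - xy)(1 - xz) is divisible by x
invertible-* : ∀ {a b x} → Invertible a x → Invertible b x → Invertible (a * b) x
invertible-* {a} {b} {x} (y , hy) (z , hz) = y + z - x * y * z ,
  subst (a * b ∣_) (lemma x y z) (ℤ∣.∣m⇒∣-m (*-mono-∣ hy hz))
  where
  lemma : ∀ x y z → - ((x * y - + 1) * (x * z - + 1)) ≡ x * (y + z - x * y * z) - + 1
  lemma = solve-∀

-- Integral multiples of the orthogonal matrices between two graphs

-- `M` is `ℓ` times a regular orthogonal Q with Q^T A Q = B, cleared of denominators. The multiplier
-- need not be the level: `M` may still have common factors, which `reduce` later divides out.
record Scaled (G H : Graph n) (ℓ : ℤ) (M : Matrix ℤ n) : Set where
  field
    orthogonal : ∀ i j → (M ᵀ) i ⋆ (M ᵀ) j ≡ ℓ * ℓ * δ i j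
    intertwine : ∀ j a → (adjMat G ⊙ (M ᵀ) j) a ≡ ∑ (λ k → adjMat H k j * (M ᵀ) k a)
    column-sum : ∀ j → ∑ ((M ᵀ) j) ≡ ℓ
    row-sum    : ∀ i → ∑ (M i) ≡ ℓ

module _ {G H : Graph n} {ℓ : ℤ} {M : Matrix ℤ n} (scaled : Scaled G H ℓ M) where
  open Scaled scaled

  ⋆-intertwine : ∀ x j → x ⋆ (adjMat G ⊙ (M ᵀ) j) ≡ ∑ (λ k → adjMat H k j * x ⋆ (M ᵀ) k)
  ⋆-intertwine x j = trans (⋆-cong {x = x} (λ _ → refl) (intertwine j)) (⋆-∑ x (λ k → adjMat H k j) (M ᵀ))

  walkVec-⋆-column : ∀ k j → walkVec G k ⋆ (M ᵀ) j ≡ ℓ * walkVec H k j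
  walkVec-⋆-column zero    j = trans (∑-cong (λ a → ℤₚ.*-identityˡ (M a j))) (trans (column-sum j) (sym (ℤₚ.*-identityʳ ℓ)))
  walkVec-⋆-column (suc k) j = begin
    (adjMat G ⊙ walkVec G k) ⋆ (M ᵀ) j ≡⟨ sym (⋆-adjMat G (walkVec G k) ((M ᵀ) j)) ⟩
    walkVec G k ⋆ (adjMat G ⊙ (M ᵀ) j) ≡⟨ ⋆-intertwine (walkVec G k) j ⟩
    ∑ (λ i → adjMat H i j * walkVec G k ⋆ (M ᵀ) i) ≡⟨ ∑-cong (λ i → trans (cong₂ _*_ (adjMat-sym H i j) (walkVec-⋆-column k i)) (lemma (adjMat H j i) ℓ (walkVec H k i))) ⟩
    ∑ (λ i → ℓ * (adjMat H j i * walkVec H k i)) ≡⟨ ∑-*ˡ ℓ (λ i → adjMat H j i * walkVec H k i) ⟩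
    ℓ * walkVec H (suc k) j ∎
    where
    lemma : ∀ a b c → a * (b * c) ≡ b * (a * c)
    lemma = solve-∀

  column-kernel : ∀ {N} → N ∣ ℓ → ∀ j → Kernel G N ((M ᵀ) j)
  column-kernel {N} h j k = subst (N ∣_) (sym (walkVec-⋆-column (toℕ k) j)) (ℤ∣.∣m⇒∣m*n (walkVec H (toℕ k) j) h)

-- Odd primes and the level.

module OddPart {G : Graph (suc n)} {d : Fin (suc n) → ℤ} (S : SmithBases (W G) d)
  {r N : ℤ} (r∤1 : ¬ r ∣ + 1) (r∣N : r ∣ N) (unit : ∀ x → ¬ r ∣ x → Invertible N x)
  (r∤d : ∀ i → i ≢ fromℕ n → ¬ r ∣ d i) (N∣dι : N ∣ d (fromℕ n)) where

  open SmithBases S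
  open SmithKernel G S
  open Eigen G S r∤1 r∣N unit r∤d N∣dι using (A; ι; L; eigenvalue; regular; kernel-eigen; ⋆-L-leading)

  kernel-vanish : ∀ {y} → Kernel G N y → r ∣ b ι ⋆ y → ∀ a → r ∣ y a
  kernel-vanish {y} ker h a = ℤ∣.∣m+n∣n⇒∣m {m = y a} (ℤ∣.∣-trans r∣N (kernel-span ι regular {y} ker a)) (ℤ∣.∣m⇒∣-m (ℤ∣.∣m⇒∣m*n (u ι a) h))

  kernel-multiple : ∀ {x y} → Kernel G N x → ¬ r ∣ b ι ⋆ x → Kernel G N y → ∃[ κ ] ∀ a → N ∣ y a - κ * x a
  kernel-multiple {x} {y} ker-x r∤x ker-y = let w , h = unit (b ι ⋆ x) r∤x in b ι ⋆ y * w , λ a → subst (N ∣_) (lemma (y a) (b ι ⋆ y) (u ι a) w (x a) (b ι ⋆ x))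
      (ℤ∣.∣m∣n⇒∣m-n (ℤ∣.∣m∣n⇒∣m-n (kernel-span ι regular {y} ker-y a) (ℤ∣.∣n⇒∣m*n (b ι ⋆ y * w) (kernel-span ι regular {x} ker-x a)))
        (ℤ∣.∣n⇒∣m*n (b ι ⋆ y * u ι a) h))
    where
    lemma : ∀ y p u w x q → y - p * u - p * w * (x - q * u) - p * u * (q * w - + 1) ≡ y - p * w * x
    lemma = solve-∀

  level-divisible : ¬ N * N ∣ d ι → ∀ {H ℓ M} → Scaled G H ℓ M → N ∣ ℓ → ∀ a j → r ∣ M a j
  level-divisible N²∤d {H} {ℓ} {M} scaled N∣ℓ a j = decide (r ℤ∣.∣? b ι ⋆ x)
    where
    open Scaled scaled
    x = (M ᵀ) j
    ker : Kernel G N x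
    ker = column-kernel scaled N∣ℓ j
    N²∣ℓ² : N * N ∣ ℓ * ℓ
    N²∣ℓ² = *-mono-∣ N∣ℓ N∣ℓ
    N²∣x⋆x : N * N ∣ x ⋆ x
    N²∣x⋆x = subst (N * N ∣_) (sym (orthogonal j j)) (ℤ∣.∣m⇒∣m*n (δ j j) N²∣ℓ²)
    N∣x⋆x : N ∣ x ⋆ x
    N∣x⋆x = ℤ∣.∣-trans (divides N refl) N²∣x⋆x
    N²∣x⋆Lx : N * N ∣ x ⋆ L x
    -- By intertwining, x^T A x is a combination of inner products of `x` with columns of `M`, all
    -- multiples of ℓ^2.
    N²∣x⋆Lx = subst (N * N ∣_) (sym (⋆-linear x (+ 1) (- eigenvalue) (A ⊙ x) x)) (ℤ∣.∣m∣n⇒∣m+n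
      (ℤ∣.∣n⇒∣m*n (+ 1) (subst (N * N ∣_) (sym (⋆-intertwine scaled x j)) (∑-∣ (λ k → ℤ∣.∣n⇒∣m*n (adjMat H k j)
        (subst (N * N ∣_) (sym (orthogonal j k)) (ℤ∣.∣m⇒∣m*n (δ j k) N²∣ℓ²))))))
      (ℤ∣.∣n⇒∣m*n (- eigenvalue) N²∣x⋆x))
    lemma : ∀ p q → p - (p - q) ≡ q
    lemma = solve-∀
    rotate-* : ∀ c d q → c * (d * q) ≡ q * (c * d)
    rotate-* = solve-∀
    cancel : ∀ p q → ¬ r ∣ p → N * N ∣ p * q → N * N ∣ q
    cancel p q r∤p = invertible-cancel p q (invertible-* {N} {N} {p} (unit p r∤p) (unit p r∤p))
    absurd : ¬ r ∣ b ι ⋆ x → N * N ∣ d ι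
    -- In the formula at y = x both `κ` and `b ι ⋆ x` are units modulo N^2; cancelling them leaves
    -- `d ι`.
    absurd r∤x = let κ , r∤κ , h = ⋆-L-leading x ker r∤x N∣x⋆x in cancel κ (d ι) r∤κ (cancel (b ι ⋆ x) (κ * d ι) r∤x
      (subst (N * N ∣_) (trans (lemma (x ⋆ L x) (κ * (d ι * b ι ⋆ x))) (rotate-* κ (d ι) (b ι ⋆ x)))
        (ℤ∣.∣m∣n⇒∣m-n N²∣x⋆Lx (h x ker))))
    decide : Dec (r ∣ b ι ⋆ x) → r ∣ M a j
    decide (yes h)  = kernel-vanish {x} ker h a
    decide (no r∤x) = contradiction (absurd r∤x) N²∤d

  -- With the pivot column `x` on the left this is the leading-term formula, whose main term
  -- vanishes modulo N^2. Any other column `y` is κ x modulo `N`, and the error (y - κ x) · L z is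
  -- again a product of two multiples of `N`.
  columns-⋆-adjMat : N * N ∣ d ι → {M : Matrix ℤ (suc n)} → (∀ j → Kernel G N ((M ᵀ) j)) →
    (∀ i j → N * N ∣ (M ᵀ) i ⋆ (M ᵀ) j) → ∀ j₀ → ¬ r ∣ b ι ⋆ (M ᵀ) j₀ →
    ∀ i j → N * N ∣ (M ᵀ) i ⋆ (A ⊙ (M ᵀ) j)
  columns-⋆-adjMat N²∣d {M} ker orth j₀ r∤x i j = subst (N * N ∣_) (lemma (y ⋆ (A ⊙ z)) eigenvalue (y ⋆ z))
    (ℤ∣.∣m∣n⇒∣m+n (subst (N * N ∣_) (⋆-linear y (+ 1) (- eigenvalue) (A ⊙ z) z) N²∣y⋆Lz) (ℤ∣.∣n⇒∣m*n eigenvalue (orth i j)))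
    where
    x = (M ᵀ) j₀
    y = (M ᵀ) i
    z = (M ᵀ) j
    lemma : ∀ p e q → + 1 * p + - e * q + e * q ≡ p
    lemma = solve-∀
    N∣x⋆x : N ∣ x ⋆ x
    N∣x⋆x = ℤ∣.∣-trans (divides N refl) (orth j₀ j₀)
    N²∣x⋆Lz : N * N ∣ x ⋆ L z
    N²∣x⋆Lz = let κ , _ , h = ⋆-L-leading x (ker j₀) r∤x N∣x⋆x in
      ℤ∣.∣m+n∣n⇒∣m {m = x ⋆ L z} (h z (ker j)) (ℤ∣.∣m⇒∣-m (ℤ∣.∣n⇒∣m*n κ (ℤ∣.∣m⇒∣m*n (b ι ⋆ z) N²∣d)))
    N²∣y⋆Lz : N * N ∣ y ⋆ L z
    N²∣y⋆Lz = let κ , h = kernel-multiple {x} {y} (ker j₀) r∤x (ker i) in subst (N * N ∣_) (trans (sym (∑-linear (+ 1) κ (λ a → (y a - κ * x a) * L z a) (λ a → x a * L z a)))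
          (∑-cong (λ a → expand (y a) κ (x a) (L z a))))
        (ℤ∣.∣m∣n⇒∣m+n (ℤ∣.∣n⇒∣m*n (+ 1) (⋆-∣ {x = λ a → y a - κ * x a} {L z} h (kernel-eigen {z} (ker j)))) (ℤ∣.∣n⇒∣m*n κ N²∣x⋆Lz))
      where
      expand : ∀ y κ x l → + 1 * ((y - κ * x) * l) + κ * (x * l) ≡ y * l
      expand = solve-∀

-- The prime two

odd⇒2∣x-1 : ∀ x → ¬ + 2 ∣ x → + 2 ∣ x - + 1
odd⇒2∣x-1 x 2∤x = remainder (x %ℤ + 2) (n%d<d x (+ 2)) (a≡a%n+[a/n]*n x (+ 2))
  where
  lemma : ∀ q → + 1 + q - + 1 ≡ q
  lemma = solve-∀
  remainder : ∀ m → m ℕ.< 2 → x ≡ + m + (x /ℤ + 2) * + 2 → + 2 ∣ x - + 1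
  remainder 0 lt eq = contradiction (divides (x /ℤ + 2) (trans eq (ℤₚ.+-identityˡ _))) 2∤x
  remainder 1 lt eq = divides (x /ℤ + 2) (trans (cong (_- + 1) eq) (lemma ((x /ℤ + 2) * + 2)))
  remainder (suc (suc m)) (ℕ.s≤s (ℕ.s≤s ())) eq

odd-cancel : ∀ {x} y → ¬ + 2 ∣ x → + 2 ∣ x * y → + 2 ∣ y
odd-cancel {x} y 2∤x h = ∣-unit {+ 2} {y} {x} (subst (+ 2 ∣_) (ℤₚ.*-comm x y) h) (odd⇒2∣x-1 x 2∤x)

2∣x*x-x : ∀ x → + 2 ∣ x * x - x
2∣x*x-x x = subst (+ 2 ∣_) (lemma x) (split (+ 2 ℤ∣.∣? x))
  where
  lemma : ∀ x → x * (x - + 1) ≡ x * x - x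
  lemma = solve-∀
  split : Dec (+ 2 ∣ x) → + 2 ∣ x * (x - + 1)
  split (yes h) = ℤ∣.∣m⇒∣m*n (x - + 1) h
  split (no h)  = ℤ∣.∣n⇒∣m*n x (odd⇒2∣x-1 x h)

∑-symmetric : ∀ {q} (h : Fin n → Fin n → ℤ) → (∀ i j → h i j ≡ h j i) → (∀ i j → i ≢ j → q ∣ h i j) →
  + 2 * q ∣ ∑ (λ i → ∑ (h i)) - ∑ (λ i → h i i)
∑-symmetric {zero}  h symm off = divides (+ 0) refl
∑-symmetric {suc n} {q} h symm off = subst (+ 2 * q ∣_) (sym identity)
  (ℤ∣.∣m∣n⇒∣m+n (ℤ∣.*-monoʳ-∣ (+ 2) (∑-∣ (λ j → off zero (suc j) (λ ()))))
    (∑-symmetric (λ i j → h (suc i) (suc j)) (λ i j → symm (suc i) (suc j)) (λ i j i≢j → off (suc i) (suc j) (i≢j ∘ Finₚ.suc-injective))))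
  where
  row = ∑ (λ j → h zero (suc j))
  rest = ∑ (λ i → ∑ (λ j → h (suc i) (suc j)))
  diagonal = ∑ (λ i → h (suc i) (suc i))
  lemma : ∀ a r s d → a + r + (r + s) - (a + d) ≡ + 2 * r + (s - d)
  lemma = solve-∀
  identity : ∑ (λ i → ∑ (h i)) - ∑ (λ i → h i i) ≡ + 2 * row + (rest - diagonal)
  identity = trans (cong (λ z → h zero zero + row + z - (h zero zero + diagonal))
      (trans (∑-+ (λ i → h (suc i) zero) (λ i → ∑ (λ j → h (suc i) (suc j)))) (cong (_+ rest) (∑-cong (λ i → symm (suc i) zero)))))
    (lemma (h zero zero) row rest diagonal)

double-or-odd : ∀ k → (∃[ j ] k ≡ j ℕ.+ j) ⊎ (∃[ j ] k ≡ suc (j ℕ.+ j))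
double-or-odd zero = inj₁ (0 , refl)
double-or-odd (suc k) with double-or-odd k
... | inj₁ (j , eq) = inj₂ (j , cong suc eq)
... | inj₂ (j , eq) = inj₁ (suc j , cong suc (trans eq (sym (ℕₚ.+-suc j j))))

-- The count is the quadratic form of A at the `j`-th walk vector; A is symmetric with zero
-- diagonal, so the terms pair off.
walkCount-odd : (G : Graph n) → ∀ j → + 2 ∣ walkCount G (suc (j ℕ.+ j))
walkCount-odd G j = subst (+ 2 ∣_) identity (∑-symmetric {q = + 1} h symm (λ i k _ → divides (h i k) (sym (ℤₚ.*-identityʳ (h i k)))))
  where
  w = walkVec G j
  h = λ i k → w i * (adjMat G i k * w k)
  swap-ends : ∀ a b c → a * (b * c) ≡ c * (b * a)
  swap-ends = solve-∀
  symm : ∀ i k → h i k ≡ h k i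
  symm i k = trans (swap-ends (w i) (adjMat G i k) (w k)) (cong (λ z → w k * (z * w i)) (adjMat-sym G i k))
  zeroed : ∀ a → a * (+ 0 * a) ≡ + 0
  zeroed = solve-∀
  identity : ∑ (λ i → ∑ (h i)) - ∑ (λ i → h i i) ≡ walkCount G (suc (j ℕ.+ j))
  identity = trans (cong₂ _-_ (∑-cong (λ i → ∑-*ˡ (w i) (λ k → adjMat G i k * w k)))
      (∑-zero (λ i → trans (cong (λ z → w i * (z * w i)) (adjMat-diagonal G i)) (zeroed (w i)))))
    (trans (ℤₚ.+-identityʳ (w ⋆ walkVec G (suc j))) (trans (walkVec-⋆ G j (suc j)) (cong (walkCount G) (ℕₚ.+-suc j j))))

walkCount-double : (G : Graph n) → ∀ j → + 2 ∣ walkCount G (j ℕ.+ j) - walkCount G j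
walkCount-double G j = subst (λ z → + 2 ∣ z - walkCount G j) (walkVec-⋆ G j j)
  (∣-∑-cong {f = λ i → walkVec G j i * walkVec G j i} {walkVec G j} (λ i → 2∣x*x-x (walkVec G j i)))

-- A square is congruent to its root modulo 2, so a count at an even index has the parity of the
-- count at half that index. Halving ends at an odd index.
walkCount-even : (G : Graph n) → ∀ k → 0 ℕ.< k → + 2 ∣ walkCount G k
walkCount-even G k 0<k = below (suc k) k ℕₚ.≤-refl 0<k
  where
  below : ∀ m k → k ℕ.< m → 0 ℕ.< k → + 2 ∣ walkCount G k
  below (suc m) k (ℕ.s≤s k≤m) 0<k with double-or-odd k
  ... | inj₂ (j , refl) = walkCount-odd G j
  ... | inj₁ (suc j , refl) = ∣-sum (walkCount-double G (suc j))
      (below m (suc j) (ℕₚ.≤-trans (ℕ.s≤s (ℕₚ.≤-trans (ℕₚ.m≤m+n (suc j) j) (ℕₚ.≤-reflexive (sym (ℕₚ.+-suc j j))))) k≤m) (ℕ.s≤s ℕ.z≤n))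
    where
    lemma : ∀ x y → x - y + y ≡ x
    lemma = solve-∀
    ∣-sum : ∀ {x y} → + 2 ∣ x - y → + 2 ∣ y → + 2 ∣ x
    ∣-sum {x} {y} h h′ = subst (+ 2 ∣_) (lemma x y) (ℤ∣.∣m∣n⇒∣m+n h h′)
  below (suc m) k (ℕ.s≤s k≤m) () | inj₁ (zero , refl)

-- At most `k` rows are nonzero modulo 2, against `k + 1` unknowns, so Gaussian elimination leaves a
-- free unknown. It will provide a linear relation modulo 2 among `k + 1` kernel vectors.
dependent-mod-2 : ∀ n r k (C : Fin n → Fin (suc k) → ℤ) → n ℕ.≤ r ℕ.+ k →
  (∀ i → toℕ i ℕ.< r → ∀ l → + 2 ∣ C i l) →
  ∃[ c ] (∃[ l ] ¬ + 2 ∣ c l) × (∀ i → + 2 ∣ C i ⋆ c)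
dependent-mod-2 zero r k C n≤ even = (λ _ → + 1) , (zero , (λ h → contradiction (ℤ∣.∣⇒∣ᵤ h) λ { (ℕ∣.divides zero ()) ; (ℕ∣.divides (suc q) ()) })) , λ ()
dependent-mod-2 (suc n) (suc r) k C (ℕ.s≤s n≤) even with dependent-mod-2 n r k (C ∘ suc) n≤ (λ i lt → even (suc i) (ℕ.s≤s lt))
... | c , odd , rest = c , odd , λ { zero → ⋆-∣ˡ {x = C zero} {c} (even zero (ℕ.s≤s ℕ.z≤n)) ; (suc i) → rest i }
dependent-mod-2 (suc n) zero k C n≤ even with Finₚ.all? (λ l → + 2 ℤ∣.∣? C zero l)
... | yes all-even with dependent-mod-2 n zero k (C ∘ suc) (ℕₚ.≤-trans (ℕₚ.n≤1+n n) n≤) (λ _ ())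
...   | c , odd , rest = c , odd , λ { zero → ⋆-∣ˡ {x = C zero} {c} all-even ; (suc i) → rest i }
dependent-mod-2 (suc n) zero (suc k) C (ℕ.s≤s n≤) even | no ¬all with Finₚ.¬∀⟶∃¬ (suc (suc k)) (λ l → + 2 ∣ C zero l) (λ l → + 2 ℤ∣.∣? C zero l) ¬all
... | j , odd-pivot = eliminate (dependent-mod-2 n zero k C′ n≤ (λ _ ()))
  where
  C′ : Fin n → Fin (suc k) → ℤ
  C′ i l = C (suc i) (punchIn j l) - C (suc i) j * C zero (punchIn j l)
  eliminate : ∃[ c ] (∃[ l ] ¬ + 2 ∣ c l) × (∀ i → + 2 ∣ C′ i ⋆ c) →
    ∃[ c ] (∃[ l ] ¬ + 2 ∣ c l) × (∀ i → + 2 ∣ C i ⋆ c)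
  eliminate (c′ , (l , odd) , rest) = c , (punchIn j l , λ h → odd (subst (+ 2 ∣_) (insertAt-punchIn c′ j q l) h)) , rows
    where
    -- Modulo 2 the pivot coefficient is 1, so this value of the eliminated unknown solves the pivot
    -- row.
    q = - ((λ l → C zero (punchIn j l)) ⋆ c′)
    c = insertAt c′ j q
    split : ∀ i → C i ⋆ c ≡ C i j * q + (λ l → C i (punchIn j l)) ⋆ c′
    split i = trans (∑-punchIn j (λ l → C i l * c l))
      (cong₂ _+_ (cong (C i j *_) (insertAt-lookup c′ j q)) (∑-cong (λ l → cong (C i (punchIn j l) *_) (insertAt-punchIn c′ j q l))))
    pivot : ∀ a s → (a - + 1) * - s ≡ a * - s + s
    pivot = solve-∀
    expand : ∀ x a y c → (x - a * y) * c ≡ + 1 * (x * c) + - a * (y * c)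
    expand = solve-∀
    regroup : ∀ x a y → + 1 * x + - a * y ≡ a * - y + x
    regroup = solve-∀
    rows : ∀ i → + 2 ∣ C i ⋆ c
    rows zero = subst (+ 2 ∣_) (trans (pivot (C zero j) ((λ l → C zero (punchIn j l)) ⋆ c′)) (sym (split zero))) (ℤ∣.∣m⇒∣m*n q (odd⇒2∣x-1 (C zero j) odd-pivot))
    rows (suc i) = subst (+ 2 ∣_) (trans (∑-cong (λ l → expand (C (suc i) (punchIn j l)) (C (suc i) j) (C zero (punchIn j l)) (c′ l)))
        (trans (∑-linear (+ 1) (- C (suc i) j) (λ l → C (suc i) (punchIn j l) * c′ l) (λ l → C zero (punchIn j l) * c′ l))
          (trans (regroup ((λ l → C (suc i) (punchIn j l)) ⋆ c′) (C (suc i) j) ((λ l → C zero (punchIn j l)) ⋆ c′)) (sym (split (suc i))))))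
      (rest i)

OddPower : ℕ → ℤ → Set
OddPower s x = ∃[ o ] (¬ + 2 ∣ o) × x ≡ + (2 ^ s) * o

+2^-+ : ∀ s t → + (2 ^ (s ℕ.+ t)) ≡ + (2 ^ s) * + (2 ^ t)
+2^-+ s t = trans (cong +_ (ℕₚ.^-distribˡ-+-* 2 s t)) (ℤₚ.pos-* (2 ^ s) (2 ^ t))

2^≢0 : ∀ s → + (2 ^ s) ≢ + 0
2^≢0 s eq = ℕ.≢-nonZero⁻¹ (2 ^ s) {{ℕₚ.m^n≢0 2 s}} (ℤₚ.+-injective eq)

2∤1 : ¬ + 2 ∣ + 1
2∤1 h = contradiction (ℤ∣.∣⇒∣ᵤ h) λ { (ℕ∣.divides zero ()) ; (ℕ∣.divides (suc q) ()) }

odd-* : ∀ {x y} → ¬ + 2 ∣ x → ¬ + 2 ∣ y → ¬ + 2 ∣ x * y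
odd-* {x} {y} 2∤x 2∤y h = 2∤y (odd-cancel y 2∤x h)

∏-const : ∀ n → ∏ {n} (λ _ → + 2) ≡ + (2 ^ n)
∏-const zero    = refl
∏-const (suc n) = trans (cong (+ 2 *_) (∏-const n)) (sym (ℤₚ.pos-* 2 (2 ^ n)))

-- Besides being the parity of `n`, `ε` is the index of the first walk vector used in the kernel
-- modulo 2: for odd `n` the vector e is excluded, as e · e = n is odd.
Halves : ℕ → ℕ → ℕ → Set
Halves n s ε = (n ≡ s ℕ.+ s × ε ≡ 0) ⊎ (n ≡ suc (s ℕ.+ s) × ε ≡ 1)

halves-bound : ∀ {n s ε i} → Halves n s ε → i ℕ.< s → (ε ℕ.+ i) ℕ.+ (ε ℕ.+ i) ℕ.< n
halves-bound (inj₁ (refl , refl)) i<s = ℕₚ.+-mono-< i<s i<s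
halves-bound (inj₂ (refl , refl)) i<s = ℕ.s≤s (ℕₚ.+-mono-≤ i<s i<s)

-- The row scaling that makes the Gram matrix of the walk vectors odd: every walk count is even,
-- except the number n of walks of length 0 when n is odd.
record RowScaling (G : Graph n) (s : ℕ) : Set where
  field
    t        : Fin n → ℤ
    1-or-2   : ∀ k → t k ≡ + 1 ⊎ t k ≡ + 2
    ∏t       : ∏ t ≡ + (2 ^ s) * + (2 ^ s)
    t∣count  : ∀ (k l : Fin n) → t k ∣ walkCount G (toℕ k ℕ.+ toℕ l)

rowScaling : (G : Graph n) → ∀ s {ε} → Halves n s ε → RowScaling G s
rowScaling {n} G s (inj₁ (refl , _)) = record
  { t = λ _ → + 2 ; 1-or-2 = λ _ → inj₂ refl
  ; ∏t = trans (∏-const n) (+2^-+ s s)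
  ; t∣count = λ k l → divisible (toℕ k ℕ.+ toℕ l) }
  where
  divisible : ∀ m → + 2 ∣ walkCount G m
  divisible zero    = divides (+ s) (trans (∑-const {n} (+ 1)) (trans (ℤₚ.*-identityʳ (+ n)) (double (+ s))))
    where
    double : ∀ x → x + x ≡ x * + 2
    double = solve-∀
  divisible (suc m) = walkCount-even G (suc m) (ℕ.s≤s ℕ.z≤n)
rowScaling G s (inj₂ (refl , _)) = record
  { t = + 1 ◂ (λ _ → + 2)
  ; 1-or-2 = λ { zero → inj₁ refl ; (suc _) → inj₂ refl }
  ; ∏t = trans (ℤₚ.*-identityˡ (∏ {s ℕ.+ s} (λ _ → + 2))) (trans (∏-const (s ℕ.+ s)) (+2^-+ s s))
  ; t∣count = λ { zero l → divides (walkCount G (toℕ l)) (sym (ℤₚ.*-identityʳ (walkCount G (toℕ l))))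
                ; (suc k) l → walkCount-even G (suc (toℕ k ℕ.+ toℕ l)) (ℕ.s≤s ℕ.z≤n) } }

-- The row scaling has determinant 2^(2s), the exact power of two in the determinant of W^T W, so
-- the rescaled matrix `M` has odd determinant. Divisibility by 4 before rescaling leaves
-- divisibility by 2 after it, and the adjugate of `M` then recovers `h` modulo 2.
gram-injective-mod-2 : (G : Graph n) → ∀ s {ε} → Halves n s ε →
  OddPower s (detℤ (W G)) → OddPower s (detℤ (W G ᵀ)) → ∀ h →
  (∀ (k : Fin n) → + 4 ∣ (λ l → walkCount G (toℕ k ℕ.+ toℕ l)) ⋆ h) → ∀ l → + 2 ∣ h l
gram-injective-mod-2 {n} G s halves (o , odd-o , det-W) (o′ , odd-o′ , det-Wᵀ) h h4 l =
  odd-cancel (h l) det-odd (subst (+ 2 ∣_) solved (⋆-∣ʳ {x = adjugate M l} scaled-even))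
  where
  open RowScaling (rowScaling G s halves)
  M : Matrix ℤ n
  M k l = quotient (t∣count k l)
  entry : ∀ (k l : Fin n) → walkCount G (toℕ k ℕ.+ toℕ l) ≡ t k * M k l
  entry k l = trans (_∣_.equality (t∣count k l)) (ℤₚ.*-comm (M k l) (t k))
  gram : ∀ k l → (W G ᵀ ∙ W G) k l ≡ ((λ i j → δ i j * t i) ∙ M) k l
  gram k l = trans (walkVec-⋆ G (toℕ k) (toℕ l)) (trans (entry k l)
    (sym (trans (∑-cong (λ j → cong (_* M j l) (ℤₚ.*-comm (δ k j) (t k)))) (∑-scaled-δˡ (t k) k (λ j → M j l)))))
  lemma : ∀ p o o′ → p * o′ * (p * o) ≡ p * p * (o′ * o)
  lemma = solve-∀
  det-M : detℤ M ≡ o′ * o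
  det-M = *-cancelˡ-≢0 {+ (2 ^ s) * + (2 ^ s)} (*-≢0 (2^≢0 s) (2^≢0 s)) (begin
    + (2 ^ s) * + (2 ^ s) * detℤ M ≡⟨ cong (_* detℤ M) (sym (trans (det-diagonal t) ∏t)) ⟩
    detℤ (λ i j → δ i j * t i) * detℤ M ≡⟨ sym (det-∙ (λ i j → δ i j * t i) M) ⟩
    detℤ ((λ i j → δ i j * t i) ∙ M) ≡⟨ det-cong (λ k l → sym (gram k l)) ⟩
    detℤ (W G ᵀ ∙ W G) ≡⟨ det-∙ (W G ᵀ) (W G) ⟩
    detℤ (W G ᵀ) * detℤ (W G) ≡⟨ cong₂ _*_ det-Wᵀ det-W ⟩
    + (2 ^ s) * o′ * (+ (2 ^ s) * o) ≡⟨ lemma (+ (2 ^ s)) o o′ ⟩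
    + (2 ^ s) * + (2 ^ s) * (o′ * o) ∎)
  det-odd : ¬ + 2 ∣ detℤ M
  det-odd h = odd-* odd-o′ odd-o (subst (+ 2 ∣_) det-M h)
  det≢0 : detℤ M ≢ + 0
  det≢0 eq = det-odd (subst (+ 2 ∣_) (sym eq) (divides (+ 0) refl))
  halve : ∀ {τ x} → τ ≡ + 1 ⊎ τ ≡ + 2 → + 4 ∣ τ * x → + 2 ∣ x
  halve {x = x} (inj₁ refl) h = ℤ∣.∣-trans (divides (+ 2) refl) (subst (+ 4 ∣_) (ℤₚ.*-identityˡ x) h)
  halve {x = x} (inj₂ refl) h = ℤ∣.*-cancelˡ-∣ (+ 2) {+ 2} {x} h
  scaled-even : ∀ k → + 2 ∣ M k ⋆ h
  scaled-even k = halve {t k} (1-or-2 k) (subst (+ 4 ∣_)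
    (trans (∑-cong (λ l → trans (cong (_* h l) (entry k l)) (ℤₚ.*-assoc (t k) (M k l) (h l)))) (∑-*ˡ (t k) (λ l → M k l * h l))) (h4 k))
  solved : adjugate M l ⋆ (λ k → M k ⋆ h) ≡ detℤ M * h l
  solved = trans (⋆-⊙ (adjugate M l) M h) (trans (⋆-cong {y = h} (λ k → trans (⋆-comm ((M ᵀ) k) (adjugate M l))
      (∙-comm-scalar M (adjugate M) det≢0 (∙-adjugate M) l k)) (λ _ → refl))
    (∑-scaled-δˡ (detℤ M) l h))

module _ (G : Graph n) where

  power⊙ : ℕ → (Fin n → ℤ) → Fin n → ℤ
  power⊙ zero    x = x
  power⊙ (suc k) x = adjMat G ⊙ power⊙ k x

  power⊙-self-adjoint : ∀ k x y → x ⋆ power⊙ k y ≡ power⊙ k x ⋆ y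
  power⊙-self-adjoint zero    x y = refl
  power⊙-self-adjoint (suc k) x y = begin
    x ⋆ (adjMat G ⊙ power⊙ k y) ≡⟨ ⋆-adjMat G x (power⊙ k y) ⟩
    (adjMat G ⊙ x) ⋆ power⊙ k y ≡⟨ power⊙-self-adjoint k (adjMat G ⊙ x) y ⟩
    power⊙ k (adjMat G ⊙ x) ⋆ y ≡⟨ ⋆-cong {y = y} (commute k x) (λ _ → refl) ⟩
    (adjMat G ⊙ power⊙ k x) ⋆ y ∎
    where
    commute : ∀ k x a → power⊙ k (adjMat G ⊙ x) a ≡ (adjMat G ⊙ power⊙ k x) a
    commute zero    x a = refl
    commute (suc k) x a = ⋆-cong {x = adjMat G a} (λ _ → refl) (commute k x)

  power⊙-linear : ∀ k c e x y a → power⊙ k (λ i → c * x i + e * y i) a ≡ c * power⊙ k x a + e * power⊙ k y a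
  power⊙-linear zero    c e x y a = refl
  power⊙-linear (suc k) c e x y a = trans (⋆-cong {x = adjMat G a} (λ _ → refl) (power⊙-linear k c e x y))
    (⋆-linear (adjMat G a) c e (power⊙ k x) (power⊙ k y))

  power⊙-∣ : ∀ {N} k {x} → (∀ i → N ∣ x i) → ∀ i → N ∣ power⊙ k x i
  power⊙-∣ zero    h = h
  power⊙-∣ (suc k) h i = ⋆-∣ʳ {x = adjMat G i} (power⊙-∣ k h)

  power⊙-∑ : ∀ {m} k (c : Fin m → ℤ) (y : Fin m → Fin n → ℤ) a →
    power⊙ k (λ i → ∑ (λ l → c l * y l i)) a ≡ ∑ (λ l → c l * power⊙ k (y l) a)
  power⊙-∑ zero    c y a = refl
  power⊙-∑ (suc k) c y a = trans (⋆-cong {x = adjMat G a} (λ _ → refl) (power⊙-∑ k c y)) (⋆-∑ (adjMat G a) c (λ l → power⊙ k (y l)))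

  power⊙-walkVec : ∀ k j a → power⊙ k (walkVec G j) a ≡ walkVec G (k ℕ.+ j) a
  power⊙-walkVec zero    j a = refl
  power⊙-walkVec (suc k) j a = ⋆-cong {x = adjMat G a} (λ _ → refl) (power⊙-walkVec k j)

-- These are the entries of M^T A^k M = ℓ^2 B^k, with A moved onto the left column one step at a
-- time.
column-power⊙ : {G H : Graph n} {ℓ : ℤ} {M : Matrix ℤ n} → Scaled G H ℓ M →
  ∀ k i j → ℓ * ℓ ∣ (M ᵀ) i ⋆ power⊙ G k ((M ᵀ) j)
column-power⊙ {ℓ = ℓ} scaled zero i j = subst (ℓ * ℓ ∣_) (sym (Scaled.orthogonal scaled i j)) (ℤ∣.∣m⇒∣m*n (δ i j) ℤ∣.∣-refl)
column-power⊙ {G = G} {H} {ℓ} {M} scaled (suc k) i j = subst (ℓ * ℓ ∣_) (sym identity)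
  (∑-∣ (λ l → ℤ∣.∣n⇒∣m*n (adjMat H l i) (column-power⊙ scaled k l j)))
  where
  y = power⊙ G k ((M ᵀ) j)
  identity : (M ᵀ) i ⋆ (adjMat G ⊙ y) ≡ ∑ (λ l → adjMat H l i * (M ᵀ) l ⋆ y)
  identity = trans (⋆-adjMat G ((M ᵀ) i) y) (trans (⋆-comm (adjMat G ⊙ (M ᵀ) i) y)
    (trans (⋆-intertwine scaled y i) (∑-cong (λ l → cong (adjMat H l i *_) (⋆-comm y ((M ᵀ) l))))))

module TwoPart {G : Graph n} {d : Fin n → ℤ} (S : SmithBases (W G) d) (s ε r : ℕ) (halves : Halves n s ε)
  (n≤r+s : n ℕ.≤ r ℕ.+ s) (d≡1 : ∀ i → toℕ i ℕ.< r → d i ≡ + 1)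
  (det-W : OddPower s (detℤ (W G))) (det-Wᵀ : OddPower s (detℤ (W G ᵀ))) where

  open SmithBases S
  open SmithKernel G S

  n-even : ε ≡ 0 → + 2 ∣ walkCount G 0
  n-even ε≡0 = subst (+ 2 ∣_) (sym (trans (∑-const {n} (+ 1)) (ℤₚ.*-identityʳ (+ n)))) (+-∣ (n-double halves))
    where
    n-double : Halves n s ε → 2 ℕ∣.∣ n
    n-double (inj₁ (eq , _)) = ℕ∣.divides s (trans eq (sym (trans (ℕₚ.*-comm s 2) (cong (s ℕ.+_) (ℕₚ.+-identityʳ s)))))
    n-double (inj₂ (_ , eq)) with trans (sym ε≡0) eq
    ... | ()

  walkVec-kernel : ∀ i → Kernel G (+ 2) (walkVec G (ε ℕ.+ i))
  walkVec-kernel i k = subst (+ 2 ∣_) (sym (walkVec-⋆ G (toℕ k) (ε ℕ.+ i))) (divisible (toℕ k ℕ.+ (ε ℕ.+ i)) refl)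
    where
    divisible : ∀ m → toℕ k ℕ.+ (ε ℕ.+ i) ≡ m → + 2 ∣ walkCount G m
    divisible zero    eq = n-even (ℕₚ.m+n≡0⇒m≡0 ε (ℕₚ.m+n≡0⇒n≡0 (toℕ k) eq))
    divisible (suc m) eq = walkCount-even G (suc m) (ℕ.s≤s ℕ.z≤n)

  index-bound : ∀ (i : Fin s) → (ε ℕ.+ toℕ i) ℕ.+ (ε ℕ.+ toℕ i) ℕ.< n
  index-bound i = halves-bound halves (Finₚ.toℕ<n i)

  double-index : Fin s → Fin n
  double-index i = fromℕ< (index-bound i)

  double-index-injective : ∀ i j → double-index i ≡ double-index j → i ≡ j
  double-index-injective i j eq = Finₚ.toℕ-injective (ℕₚ.+-cancelˡ-≡ ε (toℕ i) (toℕ j) (double-injective (ε ℕ.+ toℕ i) (ε ℕ.+ toℕ j)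
    (trans (sym (Finₚ.toℕ-fromℕ< (index-bound i))) (trans (cong toℕ eq) (Finₚ.toℕ-fromℕ< (index-bound j))))))
    where
    double-injective : ∀ a b → a ℕ.+ a ≡ b ℕ.+ b → a ≡ b
    double-injective zero    zero    eq = refl
    double-injective (suc a) (suc b) eq = cong suc (double-injective a b
      (ℕₚ.suc-injective (trans (sym (ℕₚ.+-suc a a)) (trans (ℕₚ.suc-injective eq) (ℕₚ.+-suc b b)))))

  -- In f^T A^k f the terms with i ≠ j come in equal pairs of even numbers and vanish modulo 4. The
  -- diagonal terms are row `k` of the Gram matrix applied to the vector `h` carrying g_i^2 at
  -- position 2(ε + i). By `gram-injective-mod-2` these squares are even.
  combination-even : (g : Fin s → ℤ) →
    (∀ k → + 4 ∣ (λ a → ∑ (λ i → g i * walkVec G (ε ℕ.+ toℕ i) a)) ⋆ power⊙ G k (λ a → ∑ (λ i → g i * walkVec G (ε ℕ.+ toℕ i) a))) →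
    ∀ i → + 2 ∣ g i
  combination-even g f-even i = root (+ 2 ℤ∣.∣? g i)
    where
    w = λ (i : Fin s) → walkVec G (ε ℕ.+ toℕ i)
    f = λ a → ∑ (λ i → g i * w i a)
    index = λ (k : ℕ) (i j : Fin s) → (ε ℕ.+ toℕ i) ℕ.+ (k ℕ.+ (ε ℕ.+ toℕ j))
    H = λ k i j → g i * (g j * walkCount G (index k i j))
    expand : ∀ k → f ⋆ power⊙ G k f ≡ ∑ (λ i → ∑ (H k i))
    expand k = begin
      f ⋆ power⊙ G k f ≡⟨ ⋆-comm f (power⊙ G k f) ⟩
      power⊙ G k f ⋆ f ≡⟨ ⋆-∑ (power⊙ G k f) g w ⟩
      ∑ (λ i → g i * power⊙ G k f ⋆ w i) ≡⟨ ∑-cong (λ i → trans (cong (g i *_) (inner i)) (sym (∑-*ˡ (g i) (λ j → g j * walkCount G (index k i j))))) ⟩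
      ∑ (λ i → ∑ (H k i)) ∎
      where
      inner : ∀ i → power⊙ G k f ⋆ w i ≡ ∑ (λ j → g j * walkCount G (index k i j))
      inner i = begin
        power⊙ G k f ⋆ w i ≡⟨ trans (⋆-comm (power⊙ G k f) (w i)) (⋆-cong {x = w i} (λ _ → refl) (power⊙-∑ G k g w)) ⟩
        w i ⋆ (λ a → ∑ (λ j → g j * power⊙ G k (w j) a)) ≡⟨ ⋆-∑ (w i) g (λ j → power⊙ G k (w j)) ⟩
        ∑ (λ j → g j * w i ⋆ power⊙ G k (w j)) ≡⟨ ∑-cong (λ j → cong (g j *_) (trans (⋆-cong {x = w i} (λ _ → refl) (power⊙-walkVec G k (ε ℕ.+ toℕ j)))
                                                                   (walkVec-⋆ G (ε ℕ.+ toℕ i) (k ℕ.+ (ε ℕ.+ toℕ j))))) ⟩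
        ∑ (λ j → g j * walkCount G (index k i j)) ∎
    H-sym : ∀ k i j → H k i j ≡ H k j i
    H-sym k i j = trans (swap-front (g i) (g j) (walkCount G (index k i j))) (cong (λ m → g j * (g i * walkCount G m)) (index-sym (ε ℕ.+ toℕ i) k (ε ℕ.+ toℕ j)))
      where
      swap-front : ∀ a b c → a * (b * c) ≡ b * (a * c)
      swap-front = solve-∀
      index-sym : ∀ a k b → a ℕ.+ (k ℕ.+ b) ≡ b ℕ.+ (k ℕ.+ a)
      index-sym a k b = trans (ℕₚ.+-comm a (k ℕ.+ b)) (trans (cong (ℕ._+ a) (ℕₚ.+-comm k b)) (ℕₚ.+-assoc b k a))
    H-off : ∀ k i j → i ≢ j → + 2 ∣ H k i j
    H-off k i j i≢j = ℤ∣.∣n⇒∣m*n (g i) (ℤ∣.∣n⇒∣m*n (g j) (walkCount-even G (index k i j) (positive (index k i j) refl)))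
      where
      positive : ∀ m → index k i j ≡ m → 0 ℕ.< m
      positive (suc m) eq = ℕ.s≤s ℕ.z≤n
      positive zero    eq = contradiction (Finₚ.toℕ-injective (trans (ℕₚ.m+n≡0⇒n≡0 ε (ℕₚ.m+n≡0⇒m≡0 (ε ℕ.+ toℕ i) eq))
        (sym (ℕₚ.m+n≡0⇒n≡0 ε (ℕₚ.m+n≡0⇒n≡0 k (ℕₚ.m+n≡0⇒n≡0 (ε ℕ.+ toℕ i) eq)))))) i≢j
    diagonal-even : ∀ k → + 4 ∣ ∑ (λ i → H k i i)
    diagonal-even k = subst (+ 4 ∣_) (lemma (∑ (λ i → ∑ (H k i))) (∑ (λ i → H k i i)))
      (ℤ∣.∣m∣n⇒∣m-n (subst (+ 4 ∣_) (expand k) (f-even k)) (∑-symmetric {q = + 2} (H k) (H-sym k) (H-off k)))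
      where
      lemma : ∀ p q → p - (p - q) ≡ q
      lemma = solve-∀
    h : Fin n → ℤ
    h l = ∑ (λ i → g i * g i * δ (double-index i) l)
    gram-even : ∀ (k : Fin n) → + 4 ∣ (λ l → walkCount G (toℕ k ℕ.+ toℕ l)) ⋆ h
    gram-even k = subst (+ 4 ∣_) (sym (trans (⋆-∑ (λ l → walkCount G (toℕ k ℕ.+ toℕ l)) (λ i → g i * g i) (λ i → δ (double-index i)))
        (∑-cong (λ i → trans (cong (g i * g i *_) (trans (⋆-comm (λ l → walkCount G (toℕ k ℕ.+ toℕ l)) (δ (double-index i)))
            (trans (∑-δˡ (double-index i) (λ l → walkCount G (toℕ k ℕ.+ toℕ l)))
              (cong (walkCount G) (trans (cong (toℕ k ℕ.+_) (Finₚ.toℕ-fromℕ< (index-bound i))) (reindex (toℕ k) (ε ℕ.+ toℕ i)))))))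
          (ℤₚ.*-assoc (g i) (g i) (walkCount G (index (toℕ k) i i)))))))
      (diagonal-even (toℕ k))
      where
      reindex : ∀ k a → k ℕ.+ (a ℕ.+ a) ≡ a ℕ.+ (k ℕ.+ a)
      reindex k a = trans (sym (ℕₚ.+-assoc k a a)) (trans (cong (ℕ._+ a) (ℕₚ.+-comm k a)) (ℕₚ.+-assoc a k a))
    δ-double : ∀ j → δ (double-index j) (double-index i) ≡ δ j i
    δ-double j with j ≟ i
    ... | yes refl = δ-refl (double-index i)
    ... | no  j≢i  = δ-≢ (λ eq → j≢i (double-index-injective j i eq))
    square-even : + 2 ∣ g i * g i
    square-even = subst (+ 2 ∣_) (trans (∑-cong (λ j → cong (g j * g j *_) (δ-double j))) (∑-δʳ i (λ j → g j * g j)))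
      (gram-injective-mod-2 G s halves det-W det-Wᵀ h gram-even (double-index i))
    root : Dec (+ 2 ∣ g i) → + 2 ∣ g i
    root (yes h) = h
    root (no h)  = odd-cancel (g i) h square-even

  -- The column `x` and `s` walk vectors are related modulo 2, say c₀ x + f = z with `z` even.
  -- Expanding f = z - c₀ x in f^T A^k f gives three terms divisible by 4: `z` paired with itself,
  -- twice a pairing with `z`, and a multiple of ℓ^2. So the coefficients in `f` are even, the odd
  -- coefficient must be c₀, and `x` is even.
  level-even : ∀ {H ℓ M} → Scaled G H ℓ M → + 2 ∣ ℓ → ∀ a j → + 2 ∣ M a j
  level-even {H} {ℓ} {M} scaled 2∣ℓ a j = conclude (dependent-mod-2 n r s C n≤r+s C-even)
    where
    x = (M ᵀ) j
    y : Fin (suc s) → Fin n → ℤ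
    y = x ◂ (λ i → walkVec G (ε ℕ.+ toℕ i))
    y-kernel : ∀ l → Kernel G (+ 2) (y l)
    y-kernel zero    = column-kernel scaled 2∣ℓ j
    y-kernel (suc i) = walkVec-kernel (toℕ i)
    -- Coordinates in the basis `u`; those at invariant factors equal to 1 vanish modulo 2 on the
    -- kernel.
    C : Fin n → Fin (suc s) → ℤ
    C i l = b i ⋆ y l
    C-even : ∀ i → toℕ i ℕ.< r → ∀ l → + 2 ∣ C i l
    C-even i lt l = subst (+ 2 ∣_) (trans (cong (_* b i ⋆ y l) (d≡1 i lt)) (ℤₚ.*-identityˡ (b i ⋆ y l))) (kernel-coordinate {+ 2} {y l} (y-kernel l) i)
    conclude : ∃[ c ] (∃[ l ] ¬ + 2 ∣ c l) × (∀ i → + 2 ∣ C i ⋆ c) → + 2 ∣ M a j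
    conclude (c , (l , odd) , rel) = odd-cancel (x a) (leading l odd) (ℤ∣.∣m+n∣n⇒∣m {m = c zero * x a} (z-even a) (∑-∣ (λ i → ℤ∣.∣m⇒∣m*n (walkVec G (ε ℕ.+ toℕ i) a) (g-even i))))
      where
      g = λ i → c (suc i)
      f = λ a → ∑ (λ i → g i * walkVec G (ε ℕ.+ toℕ i) a)
      z = λ a → ∑ (λ l → c l * y l a)
      z-even : ∀ a → + 2 ∣ z a
      z-even a = subst (+ 2 ∣_) (sym (expand-u z a)) (∑-∣ (λ i → ℤ∣.∣m⇒∣m*n (u i a)
        (subst (+ 2 ∣_) (sym (trans (⋆-∑ (b i) c y) (⋆-comm c (C i)))) (rel i))))
      f-split : ∀ a → f a ≡ + 1 * z a + - c zero * x a
      f-split a = lemma (f a) (c zero) (x a)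
        where
        lemma : ∀ f c x → f ≡ + 1 * (c * x + f) + - c * x
        lemma = solve-∀
      f-even : ∀ k → + 4 ∣ f ⋆ power⊙ G k f
      f-even k = subst (+ 4 ∣_) (sym identity)
        (ℤ∣.∣m∣n⇒∣m+n (ℤ∣.∣m∣n⇒∣m+n (⋆-∣ z-even (power⊙-∣ G k z-even))
            (ℤ∣.∣n⇒∣m*n (- c zero) (ℤ∣.*-monoʳ-∣ (+ 2) {+ 2} (⋆-∣ˡ {x = z} {power⊙ G k x} z-even))))
          (ℤ∣.∣n⇒∣m*n (c zero * c zero) (ℤ∣.∣-trans (*-mono-∣ 2∣ℓ 2∣ℓ) (column-power⊙ scaled k j j))))
        where
        p = power⊙ G k
        lemma : ∀ c zz zx xx → + 1 * (+ 1 * zz + - c * zx) + - c * (+ 1 * zx + - c * xx) ≡ zz + - c * (+ 2 * zx) + c * c * xx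
        lemma = solve-∀
        power-f : ∀ a → p f a ≡ + 1 * p z a + - c zero * p x a
        power-f a = trans (power-cong k f-split a) (power⊙-linear G k (+ 1) (- c zero) z x a)
          where
          power-cong : ∀ k {x y} → (∀ a → x a ≡ y a) → ∀ a → power⊙ G k x a ≡ power⊙ G k y a
          power-cong zero    h = h
          power-cong (suc k) h a = ⋆-cong {x = adjMat G a} (λ _ → refl) (power-cong k h)
        pair : ∀ v → v ⋆ p f ≡ + 1 * v ⋆ p z + - c zero * v ⋆ p x
        pair v = trans (⋆-cong {x = v} (λ _ → refl) power-f) (⋆-linear v (+ 1) (- c zero) (p z) (p x))
        identity : f ⋆ p f ≡ z ⋆ p z + - c zero * (+ 2 * z ⋆ p x) + c zero * c zero * x ⋆ p x
        identity = begin
          f ⋆ p f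
            ≡⟨ trans (⋆-comm f (p f)) (trans (⋆-cong {x = p f} (λ _ → refl) f-split) (⋆-linear (p f) (+ 1) (- c zero) z x)) ⟩
          + 1 * p f ⋆ z + - c zero * p f ⋆ x
            ≡⟨ cong₂ (λ q q′ → + 1 * q + - c zero * q′) (trans (⋆-comm (p f) z) (pair z)) (trans (⋆-comm (p f) x) (pair x)) ⟩
          + 1 * (+ 1 * z ⋆ p z + - c zero * z ⋆ p x) + - c zero * (+ 1 * x ⋆ p z + - c zero * x ⋆ p x)
            ≡⟨ cong (λ q → + 1 * (+ 1 * z ⋆ p z + - c zero * z ⋆ p x) + - c zero * (+ 1 * q + - c zero * x ⋆ p x)) (trans (power⊙-self-adjoint G k x z) (⋆-comm (p x) z)) ⟩
          + 1 * (+ 1 * z ⋆ p z + - c zero * z ⋆ p x) + - c zero * (+ 1 * z ⋆ p x + - c zero * x ⋆ p x)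
            ≡⟨ lemma (c zero) (z ⋆ p z) (z ⋆ p x) (x ⋆ p x) ⟩
          z ⋆ p z + - c zero * (+ 2 * z ⋆ p x) + c zero * c zero * x ⋆ p x ∎
      g-even : ∀ i → + 2 ∣ g i
      g-even = combination-even g f-even
      leading : ∀ l → ¬ + 2 ∣ c l → ¬ + 2 ∣ c zero
      leading zero    odd = odd
      leading (suc i) odd = contradiction (g-even i) odd

-- From generalized cospectrality to an integral matrix

-- Only walk counts occur on the right, so two graphs with equal counts have equal pairings of this
-- kind.
W-pairing : (G : Graph n) (α β : Fin n → ℤ) → ∀ k →
  (W G ⊙ α) ⋆ power⊙ G k (W G ⊙ β) ≡ α ⋆ (λ i → β ⋆ (λ j → walkCount G (toℕ i ℕ.+ (k ℕ.+ toℕ j))))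
W-pairing G α β k = trans (W⊙-⋆ G α (power⊙ G k (W G ⊙ β))) (⋆-cong {x = α} (λ _ → refl) inner)
  where
  spread : ∀ k a → power⊙ G k (W G ⊙ β) a ≡ ∑ (λ j → β j * walkVec G (k ℕ.+ toℕ j) a)
  spread zero    a = ⋆-comm (W G a) β
  spread (suc k) a = trans (⋆-cong {x = adjMat G a} (λ _ → refl) (spread k)) (⋆-∑ (adjMat G a) β (λ j → walkVec G (k ℕ.+ toℕ j)))
  inner : ∀ i → walkVec G (toℕ i) ⋆ power⊙ G k (W G ⊙ β) ≡ β ⋆ (λ j → walkCount G (toℕ i ℕ.+ (k ℕ.+ toℕ j)))
  inner i = trans (⋆-cong {x = walkVec G (toℕ i)} (λ _ → refl) (spread k))
    (trans (⋆-∑ (walkVec G (toℕ i)) β (λ j → walkVec G (k ℕ.+ toℕ j)))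
      (∑-cong (λ j → cong (β j *_) (walkVec-⋆ G (toℕ i) (k ℕ.+ toℕ j)))))

W-pairing-transfer : {G H : Graph n} → (∀ k → walkCount G k ≡ walkCount H k) → (α β : Fin n → ℤ) → ∀ k →
  (W H ⊙ α) ⋆ power⊙ H k (W H ⊙ β) ≡ (W G ⊙ α) ⋆ power⊙ G k (W G ⊙ β)
W-pairing-transfer {G = G} {H} same α β k = trans (W-pairing H α β k)
  (trans (⋆-cong {x = α} (λ _ → refl) (λ i → ⋆-cong {x = β} (λ _ → refl) (λ j → sym (same (toℕ i ℕ.+ (k ℕ.+ toℕ j))))))
    (sym (W-pairing G α β k)))

module Transfer {G H : Graph (suc n)} (same : ∀ k → walkCount G k ≡ walkCount H k)
  {L : ℤ} (L≢0 : L ≢ + 0) {V : Matrix ℤ (suc n)} (WV : ∀ i j → (W G ∙ V) i j ≡ L * δ i j) where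

  L²≢0 : L * L ≢ + 0
  L²≢0 = *-≢0 L≢0 L≢0

  M : Matrix ℤ (suc n)
  M a j = (W H ⊙ (V ᵀ) a) j

  -- Says M B^k M^T = L^2 A^k for the adjacency matrix B of H: k = 0 yields orthogonality of the
  -- rows, k = 1 the conjugation of B into A.
  pairing : ∀ k a c → M a ⋆ power⊙ H k (M c) ≡ (λ i → L * δ i a) ⋆ power⊙ G k (λ i → L * δ i c)
  pairing k a c = trans (W-pairing-transfer same ((V ᵀ) a) ((V ᵀ) c) k)
    (⋆-cong (λ i → WV i a) (power-cong k (λ i → WV i c)))
    where
    power-cong : ∀ k {x y} → (∀ i → x i ≡ y i) → ∀ i → power⊙ G k x i ≡ power⊙ G k y i
    power-cong zero    h = h
    power-cong (suc k) h i = ⋆-cong {x = adjMat G i} (λ _ → refl) (power-cong k h)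

  δ-pair : ∀ (a : Fin (suc n)) x → (λ i → L * δ i a) ⋆ x ≡ L * x a
  δ-pair a x = trans (⋆-comm (λ i → L * δ i a) x) (∑-scaled-δʳ L a x)

  rows-orthogonal : ∀ a c → (M ∙ M ᵀ) a c ≡ L * L * δ a c
  rows-orthogonal a c = trans (pairing 0 a c) (trans (δ-pair a (λ i → L * δ i c)) (sym (ℤₚ.*-assoc L L (δ a c))))

  columns-orthogonal : ∀ i j → (M ᵀ) i ⋆ (M ᵀ) j ≡ L * L * δ i j
  columns-orthogonal = ∙-comm-scalar M (M ᵀ) L²≢0 rows-orthogonal

  conjugate : ∀ a c → M a ⋆ (adjMat H ⊙ M c) ≡ L * L * adjMat G a c
  conjugate a c = trans (pairing 1 a c) (trans (δ-pair a (adjMat G ⊙ (λ i → L * δ i c)))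
    (trans (cong (L *_) (∑-scaled-δʳ L c (adjMat G a))) (sym (ℤₚ.*-assoc L L (adjMat G a c)))))

  column-sums : ∀ j → ∑ ((M ᵀ) j) ≡ L
  column-sums j = begin
    ∑ (λ a → ∑ (λ k → W H j k * V k a)) ≡⟨ ∑-swap (λ a k → W H j k * V k a) ⟩
    ∑ (λ k → ∑ (λ a → W H j k * V k a)) ≡⟨ ∑-cong (λ k → trans (∑-*ˡ (W H j k) (V k)) (cong (W H j k *_) (row k))) ⟩
    ∑ (λ k → W H j k * (L * δ k zero)) ≡⟨ ∑-scaled-δʳ L zero (W H j) ⟩
    L * + 1 ≡⟨ ℤₚ.*-identityʳ L ⟩
    L ∎
    where
    -- The all-one vector is column zero of W(G), and V W(G) = L by commutation.
    row : ∀ k → ∑ (V k) ≡ L * δ k zero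
    row k = trans (∑-cong (λ a → sym (ℤₚ.*-identityʳ (V k a)))) (∙-comm-scalar (W G) V L≢0 WV k zero)

  row-sums : ∀ i → ∑ (M i) ≡ L
  row-sums i = *-cancelˡ-≢0 L≢0 (begin
    L * ∑ (M i) ≡⟨ sym (∑-*ˡ L (M i)) ⟩
    ∑ (λ j → L * M i j) ≡⟨ ∑-cong (λ j → trans (cong (_* M i j) (sym (column-sums j))) (trans (ℤₚ.*-comm (∑ ((M ᵀ) j)) (M i j)) (sym (∑-*ˡ (M i j) ((M ᵀ) j))))) ⟩
    ∑ (λ j → ∑ (λ c → M i j * M c j)) ≡⟨ ∑-swap (λ j c → M i j * M c j) ⟩
    ∑ (λ c → (M ∙ M ᵀ) i c) ≡⟨ ∑-cong (λ c → trans (rows-orthogonal i c) (sym (ℤₚ.*-identityʳ (L * L * δ i c)))) ⟩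
    ∑ (λ c → L * L * δ i c * + 1) ≡⟨ ∑-scaled-δˡ (L * L) i (λ _ → + 1) ⟩
    L * L * + 1 ≡⟨ ℤₚ.*-identityʳ (L * L) ⟩
    L * L ∎)

  intertwines : ∀ j a → (adjMat G ⊙ (M ᵀ) j) a ≡ ∑ (λ k → adjMat H k j * (M ᵀ) k a)
  intertwines j a = *-cancelˡ-≢0 L²≢0 (begin
    L * L * adjMat G a ⋆ (M ᵀ) j
      ≡⟨ sym (∑-*ˡ (L * L) (λ c → adjMat G a c * M c j)) ⟩
    ∑ (λ c → L * L * (adjMat G a c * M c j))
      ≡⟨ ∑-cong (λ c → trans (sym (ℤₚ.*-assoc (L * L) (adjMat G a c) (M c j))) (trans (cong (_* M c j) (trans (sym (conjugate a c)) (⋆-adjMat H (M a) (M c))))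
           (trans (ℤₚ.*-comm ((adjMat H ⊙ M a) ⋆ M c) (M c j)) (cong (M c j *_) (⋆-comm (adjMat H ⊙ M a) (M c)))))) ⟩
    (λ c → M c j) ⋆ (M ⊙ (adjMat H ⊙ M a))
      ≡⟨ ⋆-⊙ ((M ᵀ) j) M (adjMat H ⊙ M a) ⟩
    (M ᵀ ⊙ (M ᵀ) j) ⋆ (adjMat H ⊙ M a)
      ≡⟨ ⋆-cong {y = adjMat H ⊙ M a} (λ k → trans (columns-orthogonal k j) (cong (L * L *_) (δ-sym k j))) (λ _ → refl) ⟩
    ∑ (λ k → L * L * δ j k * (adjMat H ⊙ M a) k)
      ≡⟨ ∑-scaled-δˡ (L * L) j (adjMat H ⊙ M a) ⟩
    L * L * adjMat H j ⋆ M a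
      ≡⟨ cong (L * L *_) (∑-cong (λ k → cong (_* M a k) (adjMat-sym H j k))) ⟩
    L * L * ∑ (λ k → adjMat H k j * M a k) ∎)

  transfer-scaled : Scaled G H L M
  transfer-scaled = record
    { orthogonal = columns-orthogonal ; intertwine = intertwines ; column-sum = column-sums ; row-sum = row-sums }

-- The sign is absorbed into V so that the multiplier is a natural number, on which `reduce` can
-- recurse.
∙-right-multiple : (M : Matrix ℤ n) → ∃[ V ] ∀ i j → (M ∙ V) i j ≡ + ∣ detℤ M ∣ * δ i j
∙-right-multiple M = choose (detℤ M) refl
  where
  choose : ∀ D → detℤ M ≡ D → ∃[ V ] ∀ i j → (M ∙ V) i j ≡ + ∣ D ∣ * δ i j
  choose (+ m) eq = adjugate M , λ i j → trans (∙-adjugate M i j) (cong (_* δ i j) eq)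
  choose ℤ.-[1+ m ] eq = (λ i j → - adjugate M i j) , λ i j →
    trans (∑-cong (λ k → sym (ℤₚ.neg-distribʳ-* (M i k) (adjugate M k j)))) (trans (∑-neg (λ k → M i k * adjugate M k j))
      (trans (cong -_ (∙-adjugate M i j)) (trans (ℤₚ.neg-distribˡ-* (detℤ M) (δ i j)) (cong (λ z → - z * δ i j) eq))))

genCospectral⇒scaled : {G H : Graph (suc n)} → GenCospectral G H → detℤ (W G) ≢ + 0 →
  ∃[ M ] Scaled G H (+ ∣ detℤ (W G) ∣) M
genCospectral⇒scaled {G = G} {H} cospectral det≢0 = let V , WV = ∙-right-multiple (W G) in
  Transfer.M {G = G} {H} (genCospectral⇒walkCount {G = G} {H} cospectral) L≢0 {V} WV ,
  Transfer.transfer-scaled {G = G} {H} (genCospectral⇒walkCount {G = G} {H} cospectral) L≢0 {V} WV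
  where
  L≢0 : + ∣ detℤ (W G) ∣ ≢ + 0
  L≢0 eq = det≢0 (ℤₚ.∣i∣≡0⇒i≡0 (ℤₚ.+-injective eq))

scaled-divide : {G H : Graph n} {r ℓ : ℤ} {M M′ : Matrix ℤ n} → r ≢ + 0 → (∀ a j → M a j ≡ r * M′ a j) →
  Scaled G H (r * ℓ) M → Scaled G H ℓ M′
scaled-divide {n} {G} {H} {r} {ℓ} {M} {M′} r≢0 eq scaled = record
  { orthogonal = λ i j → *-cancelˡ-≢0 (*-≢0 r≢0 r≢0) (begin
      r * r * (M′ ᵀ) i ⋆ (M′ ᵀ) j ≡⟨ sym (∑-*ˡ (r * r) (λ a → M′ a i * M′ a j)) ⟩
      ∑ (λ a → r * r * (M′ a i * M′ a j)) ≡⟨ ∑-cong (λ a → trans (pair r (M′ a i) (M′ a j)) (sym (cong₂ _*_ (eq a i) (eq a j)))) ⟩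
      (M ᵀ) i ⋆ (M ᵀ) j ≡⟨ orthogonal i j ⟩
      r * ℓ * (r * ℓ) * δ i j ≡⟨ square r ℓ (δ i j) ⟩
      r * r * (ℓ * ℓ * δ i j) ∎)
  ; intertwine = λ j a → *-cancelˡ-≢0 r≢0 (begin
      r * adjMat G a ⋆ (M′ ᵀ) j ≡⟨ scale (adjMat G a) (λ c → M′ c j) ⟩
      ∑ (λ c → adjMat G a c * (r * M′ c j)) ≡⟨ ∑-cong (λ c → cong (adjMat G a c *_) (sym (eq c j))) ⟩
      adjMat G a ⋆ (M ᵀ) j ≡⟨ intertwine j a ⟩
      ∑ (λ k → adjMat H k j * M a k) ≡⟨ ∑-cong (λ k → cong (adjMat H k j *_) (eq a k)) ⟩
      ∑ (λ k → adjMat H k j * (r * M′ a k)) ≡⟨ sym (scale (λ k → adjMat H k j) (M′ a)) ⟩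
      r * ∑ (λ k → adjMat H k j * M′ a k) ∎)
  ; column-sum = λ j → *-cancelˡ-≢0 r≢0 (trans (sym (∑-*ˡ r ((M′ ᵀ) j))) (trans (∑-cong (λ a → sym (eq a j))) (column-sum j)))
  ; row-sum = λ i → *-cancelˡ-≢0 r≢0 (trans (sym (∑-*ˡ r (M′ i))) (trans (∑-cong (λ j → sym (eq i j))) (row-sum i)))
  }
  where
  open Scaled scaled
  pair : ∀ r x y → r * r * (x * y) ≡ r * x * (r * y)
  pair = solve-∀
  square : ∀ r ℓ d → r * ℓ * (r * ℓ) * d ≡ r * r * (ℓ * ℓ * d)
  square = solve-∀
  left-comm : ∀ a b c → a * (b * c) ≡ b * (a * c)
  left-comm = solve-∀
  scale : ∀ (x y : Fin n → ℤ) → r * x ⋆ y ≡ ∑ (λ c → x c * (r * y c))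
  scale x y = trans (sym (∑-*ˡ r (λ c → x c * y c))) (∑-cong (λ c → left-comm r (x c) (y c)))

-- Arithmetic of the Smith normal form

∏-snoc : (f : Fin (suc n) → ℤ) → ∏ f ≡ ∏ (f ∘ inject₁) * f (fromℕ n)
∏-snoc {zero}  f = ℤₚ.*-comm (f zero) (+ 1)
∏-snoc {suc n} f = trans (cong (f zero *_) (∏-snoc (f ∘ suc))) (sym (ℤₚ.*-assoc (f zero) (∏ (f ∘ suc ∘ inject₁)) (f (fromℕ (suc n)))))

∏-cong : {f g : Fin n → ℤ} → (∀ i → f i ≡ g i) → ∏ f ≡ ∏ g
∏-cong {zero}  h = refl
∏-cong {suc n} h = cong₂ _*_ (h zero) (∏-cong (h ∘ suc))

snfF-one : ∀ {n p b} (i : Fin n) → toℕ i ℕ.< ⌈ n /2⌉ → snfF n p b i ≡ + 1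
snfF-one {n} i lt with toℕ i ℕ.<? ⌈ n /2⌉
... | yes _  = refl
... | no ¬lt = contradiction lt ¬lt

snfF-two : ∀ {n p b} (i : Fin n) → ¬ toℕ i ℕ.< ⌈ n /2⌉ → suc (toℕ i) ≢ n → snfF n p b i ≡ + 2
snfF-two {n} i ¬lt neq with toℕ i ℕ.<? ⌈ n /2⌉
... | yes lt = contradiction lt ¬lt
... | no _ with suc (toℕ i) ℕ.≟ n
...   | yes eq = contradiction eq neq
...   | no _   = refl

snfF-last : ∀ {n p b} (i : Fin n) → ¬ toℕ i ℕ.< ⌈ n /2⌉ → suc (toℕ i) ≡ n → snfF n p b i ≡ + (2 ℕ.* (p ℕ.* p) ℕ.* b)
snfF-last {n} i ¬lt eq with toℕ i ℕ.<? ⌈ n /2⌉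
... | yes lt = contradiction lt ¬lt
... | no _ with suc (toℕ i) ℕ.≟ n
...   | yes _  = refl
...   | no neq = contradiction eq neq

-- The ones and twos of `snfF` without its last entry, in a recursive form that lets the product be
-- computed by induction.
threshold : ℕ → ℕ → ℤ
threshold zero    j       = + 2
threshold (suc c) zero    = + 1
threshold (suc c) (suc j) = threshold c j

threshold-< : ∀ {c j} → j ℕ.< c → threshold c j ≡ + 1
threshold-< {suc c} {zero}  lt = refl
threshold-< {suc c} {suc j} (ℕ.s≤s lt) = threshold-< lt

threshold-≥ : ∀ {c j} → ¬ j ℕ.< c → threshold c j ≡ + 2
threshold-≥ {zero}  ¬lt = refl
threshold-≥ {suc c} {zero}  ¬lt = contradiction (ℕ.s≤s ℕ.z≤n) ¬lt
threshold-≥ {suc c} {suc j} ¬lt = threshold-≥ {c} (¬lt ∘ ℕ.s≤s)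

∏-threshold : ∀ n c → ∏ {n} (λ i → threshold c (toℕ i)) ≡ + (2 ^ (n ℕ.∸ c))
∏-threshold n zero          = ∏-const n
∏-threshold zero (suc c)    = refl
∏-threshold (suc n) (suc c) = trans (ℤₚ.*-identityˡ (∏ {n} (λ i → threshold c (toℕ i)))) (∏-threshold n c)

module _ (m p b : ℕ) where
  private
    n₂ : ℕ
    n₂ = suc (suc m)

    ι : Fin n₂
    ι = fromℕ (suc m)

  suc-toℕ-ι : suc (toℕ ι) ≡ n₂
  suc-toℕ-ι = cong suc (Finₚ.toℕ-fromℕ (suc m))

  ≢ι⇒suc-toℕ≢ : ∀ i → i ≢ ι → suc (toℕ i) ≢ n₂
  ≢ι⇒suc-toℕ≢ i i≢ι eq = i≢ι (Finₚ.toℕ-injective (ℕₚ.suc-injective (trans eq (sym suc-toℕ-ι))))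

  snfF-ι : snfF n₂ p b ι ≡ + (2 ℕ.* (p ℕ.* p) ℕ.* b)
  snfF-ι = snfF-last ι (ℕₚ.≤⇒≯ (ℕₚ.≤-trans (ℕ.s≤s (ℕₚ.⌈n/2⌉≤n m)) (ℕₚ.≤-reflexive (sym (Finₚ.toℕ-fromℕ (suc m)))))) suc-toℕ-ι

  snfF-≢ι : ∀ i → i ≢ ι → snfF n₂ p b i ≡ threshold ⌈ n₂ /2⌉ (toℕ i)
  snfF-≢ι i i≢ι = split (toℕ i ℕ.<? ⌈ n₂ /2⌉)
    where
    split : Dec (toℕ i ℕ.< ⌈ n₂ /2⌉) → snfF n₂ p b i ≡ threshold ⌈ n₂ /2⌉ (toℕ i)
    split (yes lt) = trans (snfF-one {p = p} {b} i lt) (sym (threshold-< lt))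
    split (no ¬lt) = trans (snfF-two {p = p} {b} i ¬lt (≢ι⇒suc-toℕ≢ i i≢ι)) (sym (threshold-≥ ¬lt))

  snfF-1-or-2 : ∀ i → i ≢ ι → snfF n₂ p b i ≡ + 1 ⊎ snfF n₂ p b i ≡ + 2
  snfF-1-or-2 i i≢ι = split (toℕ i ℕ.<? ⌈ n₂ /2⌉)
    where
    split : Dec (toℕ i ℕ.< ⌈ n₂ /2⌉) → snfF n₂ p b i ≡ + 1 ⊎ snfF n₂ p b i ≡ + 2
    split (yes lt) = inj₁ (snfF-one {p = p} {b} i lt)
    split (no ¬lt) = inj₂ (snfF-two {p = p} {b} i ¬lt (≢ι⇒suc-toℕ≢ i i≢ι))

  ∏-snfF : ∏ (snfF n₂ p b) ≡ + (2 ^ ⌊ n₂ /2⌋) * + (p ℕ.* p ℕ.* b)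
  ∏-snfF = begin
    ∏ (snfF n₂ p b)
      ≡⟨ ∏-snoc (snfF n₂ p b) ⟩
    ∏ (snfF n₂ p b ∘ inject₁) * snfF n₂ p b ι
      ≡⟨ cong₂ _*_ (trans (∏-cong low) (trans (∏-threshold (suc m) ⌈ n₂ /2⌉) (cong (λ e → + (2 ^ e)) exponent))) snfF-ι ⟩
    + (2 ^ ⌊ m /2⌋) * + (2 ℕ.* (p ℕ.* p) ℕ.* b)
      ≡⟨ trans (sym (ℤₚ.pos-* (2 ^ ⌊ m /2⌋) (2 ℕ.* (p ℕ.* p) ℕ.* b))) (trans (cong +_ arithmetic) (ℤₚ.pos-* (2 ^ ⌊ n₂ /2⌋) (p ℕ.* p ℕ.* b))) ⟩
    + (2 ^ ⌊ n₂ /2⌋) * + (p ℕ.* p ℕ.* b) ∎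
    where
    low : ∀ i → snfF n₂ p b (inject₁ i) ≡ threshold ⌈ n₂ /2⌉ (toℕ i)
    low i = trans (snfF-≢ι (inject₁ i) (Finₚ.fromℕ≢inject₁ ∘ sym)) (cong (threshold ⌈ n₂ /2⌉) (Finₚ.toℕ-inject₁ i))
    exponent : suc m ℕ.∸ ⌈ n₂ /2⌉ ≡ ⌊ m /2⌋
    exponent = trans (cong (ℕ._∸ ⌈ m /2⌉) (sym (ℕₚ.⌊n/2⌋+⌈n/2⌉≡n m))) (ℕₚ.m+n∸n≡m ⌊ m /2⌋ ⌈ m /2⌉)
    arithmetic : 2 ^ ⌊ m /2⌋ ℕ.* (2 ℕ.* (p ℕ.* p) ℕ.* b) ≡ 2 ℕ.* 2 ^ ⌊ m /2⌋ ℕ.* (p ℕ.* p ℕ.* b)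
    arithmetic = trans (cong (2 ^ ⌊ m /2⌋ ℕ.*_) (ℕₚ.*-assoc 2 (p ℕ.* p) b))
      (trans (sym (ℕₚ.*-assoc (2 ^ ⌊ m /2⌋) 2 (p ℕ.* p ℕ.* b))) (cong (ℕ._* (p ℕ.* p ℕ.* b)) (ℕₚ.*-comm (2 ^ ⌊ m /2⌋) 2)))

halves : ∀ n → ∃[ ε ] Halves n ⌊ n /2⌋ ε
halves zero          = 0 , inj₁ (refl , refl)
halves (suc zero)    = 1 , inj₂ (refl , refl)
halves (suc (suc m)) with halves m
... | ε , inj₁ (eq , e) = ε , inj₁ (cong suc (trans (cong suc eq) (sym (ℕₚ.+-suc ⌊ m /2⌋ ⌊ m /2⌋))) , e)
... | ε , inj₂ (eq , e) = ε , inj₂ (cong suc (trans (cong suc eq) (cong suc (sym (ℕₚ.+-suc ⌊ m /2⌋ ⌊ m /2⌋)))) , e)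

IsUnit : ℤ → Set
IsUnit x = ∃[ y ] x * y ≡ + 1

unit-odd : ∀ {x} → IsUnit x → ¬ + 2 ∣ x
unit-odd (y , eq) h = 2∤1 (subst (+ 2 ∣_) eq (ℤ∣.∣m⇒∣m*n y h))

det-unit : (P Q : Matrix ℤ n) → (∀ i j → (P ∙ Q) i j ≡ δ i j) → detℤ P * detℤ Q ≡ + 1
det-unit {n} P Q h = trans (sym (det-∙ P Q)) (trans (det-cong {n} h) (det-δ n))

diagonal-sym : (d : Fin n → ℤ) → ∀ i j → δ j i * d j ≡ δ i j * d i
diagonal-sym d i j with j ≟ i
... | yes refl = cong (_* d i) (sym (δ-refl i))
... | no  j≢i  = cong (_* d i) (sym (δ-≢ (j≢i ∘ sym)))

-- Take determinants in U M V = diag and in its transpose V^T M^T U^T = diag; the outer factors have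
-- determinants with integral inverses.
hasSNF⇒det : {M : Matrix ℤ n} {d : Fin n → ℤ} → HasSNF M d →
  (∃[ x ] IsUnit x × detℤ M ≡ ∏ d * x) × (∃[ x ] IsUnit x × detℤ (M ᵀ) ≡ ∏ d * x)
hasSNF⇒det {n} {M} {d} (U , V , unimodU , unimodV , snf) =
  assemble (unimodular-inverse {U = U} unimodU) (unimodular-inverse {U = V} unimodV)
  where
  solve-det : ∀ a a′ c c′ x → a * a′ ≡ + 1 → c * c′ ≡ + 1 → a * x * c ≡ ∏ d → ∃[ y ] IsUnit y × x ≡ ∏ d * y
  solve-det a a′ c c′ x ha hc eq = a′ * c′ , (a * c , trans (regroup a a′ c c′) (cong₂ _*_ ha hc)) ,
    trans (sym (trans (cong₂ (λ s t → s * t * x) ha hc) (ℤₚ.*-identityˡ x))) (trans (expand a a′ c c′ x) (cong (_* (a′ * c′)) eq))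
    where
    regroup : ∀ a a′ c c′ → a′ * c′ * (a * c) ≡ a * a′ * (c * c′)
    regroup = solve-∀
    expand : ∀ a a′ c c′ x → a * a′ * (c * c′) * x ≡ a * x * c * (a′ * c′)
    expand = solve-∀
  transpose-∙ : (P Q : Matrix ℤ n) → ∀ i j → (Q ᵀ ∙ P ᵀ) i j ≡ (P ∙ Q) j i
  transpose-∙ P Q i j = ⋆-comm ((Q ᵀ) i) (P j)
  snfᵀ : ∀ i j → ((V ᵀ ∙ M ᵀ) ∙ U ᵀ) i j ≡ δ i j * d i
  snfᵀ i j = begin
    ((V ᵀ ∙ M ᵀ) ∙ U ᵀ) i j ≡⟨ ∙-cong {N = U ᵀ} (transpose-∙ M V) (λ _ _ → refl) i j ⟩
    ((M ∙ V) ᵀ ∙ U ᵀ) i j ≡⟨ transpose-∙ U (M ∙ V) i j ⟩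
    (U ∙ (M ∙ V)) j i ≡⟨ trans (sym (∙-assoc U M V j i)) (snf j i) ⟩
    δ j i * d j ≡⟨ diagonal-sym d i j ⟩
    δ i j * d i ∎
  product : (P Q R : Matrix ℤ n) → (∀ i j → ((P ∙ Q) ∙ R) i j ≡ δ i j * d i) → detℤ P * detℤ Q * detℤ R ≡ ∏ d
  product P Q R h = trans (cong (_* detℤ R) (sym (det-∙ P Q))) (trans (sym (det-∙ (P ∙ Q) R)) (trans (det-cong {n} h) (det-diagonal d)))
  assemble : ∃[ U⁻ ] (∀ i j → (U ∙ U⁻) i j ≡ δ i j) × (∀ i j → (U⁻ ∙ U) i j ≡ δ i j) →
    ∃[ V⁻ ] (∀ i j → (V ∙ V⁻) i j ≡ δ i j) × (∀ i j → (V⁻ ∙ V) i j ≡ δ i j) →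
    (∃[ x ] IsUnit x × detℤ M ≡ ∏ d * x) × (∃[ x ] IsUnit x × detℤ (M ᵀ) ≡ ∏ d * x)
  assemble (U⁻ , UU⁻ , U⁻U) (V⁻ , VV⁻ , V⁻V) =
    solve-det (detℤ U) (detℤ U⁻) (detℤ V) (detℤ V⁻) (detℤ M) (det-unit U U⁻ UU⁻) (det-unit V V⁻ VV⁻) (product U M V snf) ,
    solve-det (detℤ (V ᵀ)) (detℤ (V⁻ ᵀ)) (detℤ (U ᵀ)) (detℤ (U⁻ ᵀ)) (detℤ (M ᵀ)) (det-unit (V ᵀ) (V⁻ ᵀ) (λ i j → trans (transpose-∙ V⁻ V i j) (trans (V⁻V j i) (δ-sym j i))))
      (det-unit (U ᵀ) (U⁻ ᵀ) (λ i j → trans (transpose-∙ U⁻ U i j) (trans (U⁻U j i) (δ-sym j i)))) (product (V ᵀ) (M ᵀ) (U ᵀ) snfᵀ)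

prime-∣-prime : ∀ {p q} → Prime p → Prime q → p ℕ∣.∣ q → p ≡ q
prime-∣-prime pp pq p∣q with prime⇒irreducible pq p∣q
... | inj₁ refl = contradiction pp ¬prime[1]
... | inj₂ eq   = eq

prime∤1 : ∀ {r} → Prime r → ¬ + r ∣ + 1
prime∤1 pr h = ¬prime[1] (subst Prime (ℕ∣.∣1⇒≡1 (ℤ∣.∣⇒∣ᵤ h)) pr)

prime≢0 : ∀ {r} → Prime r → + r ≢ + 0
prime≢0 {r} pr eq = ℕ.≢-nonZero⁻¹ r {{prime⇒nonZero pr}} (ℤₚ.+-injective eq)

prime∤2 : ∀ {r} → Prime r → Odd r → ¬ + r ∣ + 2
prime∤2 {r} pr odd h = odd (ℕ∣.∣-reflexive (sym (prime-∣-prime pr prime[2] (ℤ∣.∣⇒∣ᵤ h))))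

prime-∣-* : ∀ {r x y} → Prime r → + r ∣ x * y → (+ r ∣ x) ⊎ (+ r ∣ y)
prime-∣-* {r} {x} {y} pr h with + r ℤ∣.∣? x
... | yes r∣x = inj₁ r∣x
... | no r∤x  = inj₂ (invertible-cancel x y (prime-unit pr x r∤x) h)

prime²-cancel : ∀ {r} x y → Prime r → ¬ + r ∣ x → + r * + r ∣ x * y → + r * + r ∣ y
prime²-cancel {r} x y pr r∤x = invertible-cancel x y (invertible-* {+ r} {+ r} {x} (prime-unit pr x r∤x) (prime-unit pr x r∤x))

prime∤2^ : ∀ {r} → Prime r → Odd r → ∀ s → ¬ + r ∣ + (2 ^ s)
prime∤2^ pr odd zero    h = prime∤1 pr h
prime∤2^ pr odd (suc s) h with prime-∣-* {x = + 2} {+ (2 ^ s)} pr (subst (_ ∣_) (ℤₚ.pos-* 2 (2 ^ s)) h)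
... | inj₁ h′ = prime∤2 pr odd h′
... | inj₂ h′ = prime∤2^ pr odd s h′

squareFree⇒¬∣ : ∀ {r b} → Prime r → SquareFree b → ¬ + r * + r ∣ + b
squareFree⇒¬∣ {r} {b} pr sqf h = ¬prime[1] (subst Prime (sqf r (ℤ∣.∣⇒∣ᵤ (subst (_∣ + b) (sym (ℤₚ.pos-* r r)) h))) pr)

prime-divisor : ∀ l → l ≢ 0 → l ≢ 1 → ∃[ r ] Prime r × r ℕ∣.∣ l
prime-divisor l l≢0 l≢1 = first (factorise l {{ℕ.≢-nonZero l≢0}})
  where
  first : PrimeFactorisation l → ∃[ r ] Prime r × r ℕ∣.∣ l
  first record { factors = [] ; isFactorisation = eq } = contradiction eq l≢1
  first record { factors = r ∷ rs ; isFactorisation = eq ; factorsPrime = pr ∷ _ } = r , pr , subst (r ℕ∣.∣_) (sym eq) (ℕ∣.m∣m*n _)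

∣-associate : ∀ {r} D P x → IsUnit x → D ≡ P * x → r ∣ D → r ∣ P
∣-associate {r} D P x (y , xy≡1) eq h = subst (r ∣_)
  (trans (cong (_* y) eq) (trans (ℤₚ.*-assoc P x y) (trans (cong (P *_) xy≡1) (ℤₚ.*-identityʳ P)))) (ℤ∣.∣m⇒∣m*n y h)

-- The level is 1 or p

module Family {m p b : ℕ} (prime-p : Prime p) (odd-p : Odd p) (odd-b : Odd b) (sqf-b : SquareFree b) (p∤b : ¬ p ℕ∣.∣ b)
  {G : Graph (suc (suc m))} (snf : HasSNF (W G) (snfF (suc (suc m)) p b)) where

  d : Fin (suc (suc m)) → ℤ
  d = snfF (suc (suc m)) p b

  ι : Fin (suc (suc m))
  ι = fromℕ (suc m)

  S : SmithBases (W G) d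
  S = hasSNF⇒smithBases {M = W G} {d} snf

  o : ℤ
  o = + (p ℕ.* p ℕ.* b)

  o≡ : o ≡ + p * + p * + b
  o≡ = trans (ℤₚ.pos-* (p ℕ.* p) b) (cong (_* + b) (ℤₚ.pos-* p p))

  dι≡ : d ι ≡ + 2 * (+ p * + p * + b)
  dι≡ = trans (snfF-ι m p b) (trans (cong +_ (ℕₚ.*-assoc 2 (p ℕ.* p) b)) (trans (ℤₚ.pos-* 2 (p ℕ.* p ℕ.* b)) (cong (+ 2 *_) o≡)))

  2∤p : ¬ + 2 ∣ + p
  2∤p h = odd-p (ℤ∣.∣⇒∣ᵤ h)

  2∤o : ¬ + 2 ∣ o
  2∤o h = odd-* (odd-* 2∤p 2∤p) (odd-b ∘ ℤ∣.∣⇒∣ᵤ) (subst (+ 2 ∣_) o≡ h)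

  oddPower : ∀ x D → IsUnit x → D ≡ ∏ d * x → OddPower ⌊ suc (suc m) /2⌋ D
  oddPower x D unit eq = o * x , odd-* {o} {x} 2∤o (unit-odd unit) ,
    trans eq (trans (cong (_* x) (∏-snfF m p b)) (ℤₚ.*-assoc (+ (2 ^ ⌊ suc (suc m) /2⌋)) o x))

  det-W : OddPower ⌊ suc (suc m) /2⌋ (detℤ (W G))
  det-W = let (x , unit , eq) , _ = hasSNF⇒det {M = W G} {d} snf in oddPower x (detℤ (W G)) unit eq

  det-Wᵀ : OddPower ⌊ suc (suc m) /2⌋ (detℤ (W G ᵀ))
  det-Wᵀ = let _ , (x , unit , eq) = hasSNF⇒det {M = W G} {d} snf in oddPower x (detℤ (W G ᵀ)) unit eq

  det≢0 : detℤ (W G) ≢ + 0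
  det≢0 eq = let o′ , odd , eq′ = det-W in *-≢0 (2^≢0 ⌊ suc (suc m) /2⌋) (λ o′≡0 → odd (subst (+ 2 ∣_) (sym o′≡0) (divides (+ 0) refl))) (trans (sym eq′) eq)

  level-even : ∀ {H ℓ M} → Scaled G H ℓ M → + 2 ∣ ℓ → ∀ a j → + 2 ∣ M a j
  level-even = TwoPart.level-even S ⌊ suc (suc m) /2⌋ (proj₁ (halves (suc (suc m)))) ⌈ suc (suc m) /2⌉ (proj₂ (halves (suc (suc m))))
    (ℕₚ.≤-reflexive (trans (sym (ℕₚ.⌊n/2⌋+⌈n/2⌉≡n (suc (suc m)))) (ℕₚ.+-comm ⌊ suc (suc m) /2⌋ ⌈ suc (suc m) /2⌉)))
    (λ i lt → snfF-one {p = p} {b} i lt) det-W det-Wᵀ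

  prime∤d : ∀ {r} → Prime r → Odd r → ∀ i → i ≢ ι → ¬ + r ∣ d i
  prime∤d {r} pr odd-r i i≢ι h = [ (λ eq → prime∤1 pr (subst (+ r ∣_) eq h)) , (λ eq → prime∤2 pr odd-r (subst (+ r ∣_) eq h)) ]′ (snfF-1-or-2 m p b i i≢ι)

  level-b : ∀ {r} → Prime r → r ℕ∣.∣ b → ∀ {H ℓ M} → Scaled G H ℓ M → + r ∣ ℓ → ∀ a j → + r ∣ M a j
  level-b {r} pr r∣b = OddPart.level-divisible S (prime∤1 pr) ℤ∣.∣-refl (prime-unit pr) (prime∤d pr odd-r) r∣dι r²∤dι
    where
    odd-r : Odd r
    odd-r h = odd-b (ℕ∣.∣-trans h r∣b)
    r∣dι : + r ∣ d ι
    r∣dι = subst (+ r ∣_) (sym dι≡) (ℤ∣.∣n⇒∣m*n (+ 2) (ℤ∣.∣n⇒∣m*n (+ p * + p) (+-∣ r∣b)))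
    r∤p : ¬ + r ∣ + p
    r∤p h = p∤b (subst (ℕ∣._∣ b) (prime-∣-prime pr prime-p (ℤ∣.∣⇒∣ᵤ h)) r∣b)
    r²∤dι : ¬ + r * + r ∣ d ι
    r²∤dι h = squareFree⇒¬∣ pr sqf-b (prime²-cancel (+ p * + p) (+ b) pr ([ r∤p , r∤p ]′ ∘ prime-∣-* {x = + p} {+ p} pr)
      (prime²-cancel (+ 2) (+ p * + p * + b) pr (prime∤2 pr odd-r) (subst (+ r * + r ∣_) dι≡ h)))

  p²∣dι : + p * + p ∣ d ι
  p²∣dι = subst (+ p * + p ∣_) (sym dι≡) (ℤ∣.∣n⇒∣m*n (+ 2) (ℤ∣.∣m⇒∣m*n (+ b) ℤ∣.∣-refl))

  p∣dι : + p ∣ d ι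
  p∣dι = ℤ∣.∣-trans (divides (+ p) refl) p²∣dι

  p²-unit : ∀ x → ¬ + p ∣ x → Invertible (+ p * + p) x
  p²-unit x p∤x = invertible-* {+ p} {+ p} {x} (prime-unit prime-p x p∤x) (prime-unit prime-p x p∤x)

  -- With N = p the odd argument gives no contradiction, since p^2 divides `d ι`. With N = p^2 it
  -- does, since p^4 would force p to divide b. Thus p^2 is excluded from the level while p itself
  -- may occur.
  level-p² : ∀ {H ℓ M} → Scaled G H ℓ M → + p * + p ∣ ℓ → ∀ a j → + p ∣ M a j
  level-p² = OddPart.level-divisible S (prime∤1 prime-p) (divides (+ p) refl) p²-unit (prime∤d prime-p odd-p) p²∣dι p⁴∤dι
    where
    regroup : ∀ q b → + 2 * (q * b) ≡ q * (+ 2 * b)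
    regroup = solve-∀
    p⁴∤dι : ¬ (+ p * + p) * (+ p * + p) ∣ d ι
    p⁴∤dι h = p∤b (ℤ∣.∣⇒∣ᵤ (ℤ∣.∣-trans (divides (+ p) refl) (invertible-cancel (+ 2) (+ b) (p²-unit (+ 2) (prime∤2 prime-p odd-p))
      (ℤ∣.*-cancelˡ-∣ (+ p * + p) {+ p * + p} {+ 2 * + b} {{ℤ.≢-nonZero (*-≢0 (prime≢0 prime-p) (prime≢0 prime-p))}} (subst ((+ p * + p) * (+ p * + p) ∣_) (trans dι≡ (regroup (+ p * + p) (+ b))) h)))))

  prime-∣-det : ∀ {r} → Prime r → + r ∣ detℤ (W G) → r ≡ 2 ⊎ r ≡ p ⊎ r ℕ∣.∣ b
  prime-∣-det {r} pr h = from-∏ (let (x , unit , eq) , _ = hasSNF⇒det {M = W G} {d} snf in ∣-associate (detℤ (W G)) (∏ d) x unit eq h)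
    where
    2-or-odd : Dec (2 ℕ∣.∣ r) → r ≡ 2 ⊎ Odd r
    2-or-odd (yes 2∣r) = inj₁ (sym (prime-∣-prime prime[2] pr 2∣r))
    2-or-odd (no odd)  = inj₂ odd
    from-p : + r ∣ + p → r ≡ p
    from-p h = prime-∣-prime pr prime-p (ℤ∣.∣⇒∣ᵤ h)
    from-odd : Odd r → + r ∣ ∏ d → r ≡ p ⊎ r ℕ∣.∣ b
    from-odd odd h = [ (λ h′ → inj₁ ([ from-p , from-p ]′ (prime-∣-* {x = + p} {+ p} pr h′))) , inj₂ ∘ ℤ∣.∣⇒∣ᵤ ]′
      (prime-∣-* {x = + p * + p} {+ b} pr (subst (+ r ∣_) o≡
        (invertible-cancel (+ (2 ^ ⌊ suc (suc m) /2⌋)) o (prime-unit pr (+ (2 ^ ⌊ suc (suc m) /2⌋)) (prime∤2^ pr odd ⌊ suc (suc m) /2⌋))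
          (subst (+ r ∣_) (∏-snfF m p b) h))))
    from-∏ : + r ∣ ∏ d → r ≡ 2 ⊎ r ≡ p ⊎ r ℕ∣.∣ b
    from-∏ h = [ inj₁ , (λ odd → inj₂ (from-odd odd h)) ]′ (2-or-odd (2 ℕ∣.∣? r))

  Reduced : Graph (suc (suc m)) → Set
  Reduced H = (∃[ M ] Scaled G H (+ 1) M) ⊎ (∃[ M ] Scaled G H (+ p) M × ¬ (∀ a j → + p ∣ M a j))

  module _ {H : Graph (suc (suc m))} where

    -- Each step divides `M` and `l` by one prime, and `fuel` bounds the shrinking `l`. Primes 2 and
    -- those of b can always be removed, p as long as p^2 divides `l`. What remains is l = 1, or l =
    -- p, where it is decided whether p divides all of `M`.
    reduce : ∀ fuel l → l ℕ.< fuel → l ≢ 0 → (∀ {r} → Prime r → r ℕ∣.∣ l → r ≡ 2 ⊎ r ≡ p ⊎ r ℕ∣.∣ b) →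
      ∀ M → Scaled G H (+ l) M → Reduced H
    reduce (suc fuel) l (ℕ.s≤s l≤fuel) l≢0 primes M scaled = start (l ℕ.≟ 1)
      where
      continue : ∀ r q → Prime r → l ≡ q ℕ.* r → (∀ a j → + r ∣ M a j) → Reduced H
      continue r q pr eq all = reduce fuel q (ℕₚ.<-≤-trans q<l l≤fuel) q≢0 (λ pr′ r′∣q → primes pr′ (subst (_ ℕ∣.∣_) (sym eq) (ℕ∣.∣m⇒∣m*n r r′∣q))) _
        (scaled-divide {r = + r} {+ q} {M} {λ a j → quotient (all a j)} (prime≢0 pr) (λ a j → trans (_∣_.equality (all a j)) (ℤₚ.*-comm (quotient (all a j)) (+ r)))
          (subst (λ z → Scaled G H z M) (trans (cong +_ eq) (trans (ℤₚ.pos-* q r) (ℤₚ.*-comm (+ q) (+ r)))) scaled))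
        where
        q≢0 : q ≢ 0
        q≢0 refl = l≢0 eq
        q<l : q ℕ.< l
        q<l = subst (q ℕ.<_) (sym eq) (ℕₚ.m<m*n q r {{ℕ.≢-nonZero q≢0}} (ℕₚ.≤∧≢⇒< (ℕ.>-nonZero⁻¹ r {{prime⇒nonZero pr}}) (λ 1≡r → ¬prime[1] (subst Prime (sym 1≡r) pr))))
      away-from-p : ∀ {r} → Prime r → r ℕ∣.∣ l → r ≡ 2 ⊎ r ℕ∣.∣ b → Reduced H
      away-from-p pr r∣l@(ℕ∣.divides q eq) (inj₁ refl) = continue 2 q pr eq (level-even scaled (+-∣ r∣l))
      away-from-p {r} pr r∣l@(ℕ∣.divides q eq) (inj₂ r∣b)  = continue r q pr eq (level-b pr r∣b scaled (+-∣ r∣l))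
      at-p : ∀ q → l ≡ q ℕ.* p → Reduced H
      at-p q eq with q ℕ.≟ 1
      ... | yes refl = decide (Finₚ.all? (λ a → Finₚ.all? (λ j → + p ℤ∣.∣? M a j)))
        where
        decide : Dec (∀ a j → + p ∣ M a j) → Reduced H
        decide (yes all) = continue p 1 prime-p eq all
        decide (no ¬all) = inj₂ (M , subst (λ z → Scaled G H (+ z) M) (trans eq (ℕₚ.*-identityˡ p)) scaled , ¬all)
      ... | no q≢1 = next (prime-divisor q q≢0 q≢1)
        where
        q≢0 : q ≢ 0
        q≢0 refl = l≢0 eq
        next : ∃[ r ] Prime r × r ℕ∣.∣ q → Reduced H
        next (r , pr , r∣q) = split (primes pr r∣l)
          where
          r∣l : r ℕ∣.∣ l
          r∣l = subst (r ℕ∣.∣_) (sym eq) (ℕ∣.∣m⇒∣m*n p r∣q)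
          split : r ≡ 2 ⊎ r ≡ p ⊎ r ℕ∣.∣ b → Reduced H
          split (inj₁ r≡2) = away-from-p pr r∣l (inj₁ r≡2)
          split (inj₂ (inj₂ r∣b)) = away-from-p pr r∣l (inj₂ r∣b)
          split (inj₂ (inj₁ refl)) = continue p q prime-p eq (level-p² scaled
            (subst₂ _∣_ (ℤₚ.pos-* p p) (cong +_ (sym eq)) (+-∣ (ℕ∣.*-monoˡ-∣ p r∣q))))
      start : Dec (l ≡ 1) → Reduced H
      start (yes refl) = inj₁ (M , scaled)
      start (no l≢1) with prime-divisor l l≢0 l≢1
      ... | r , pr , r∣l with primes pr r∣l
      ...   | inj₁ r≡2 = away-from-p pr r∣l (inj₁ r≡2)
      ...   | inj₂ (inj₂ r∣b) = away-from-p pr r∣l (inj₂ r∣b)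
      start (no l≢1) | r , pr , ℕ∣.divides q eq | inj₂ (inj₁ refl) = at-p q eq

    genCospectral⇒reduced : GenCospectral G H → Reduced H
    genCospectral⇒reduced cospectral = let M , scaled = genCospectral⇒scaled cospectral det≢0 in
      reduce (suc ∣ detℤ (W G) ∣) ∣ detℤ (W G) ∣ ℕₚ.≤-refl (det≢0 ∘ ℤₚ.∣i∣≡0⇒i≡0) (λ pr h → prime-∣-det pr (ℤ∣.∣ᵤ⇒∣ h)) M scaled

-- Level one: integral orthogonal matrices and permutations.

0≤x*x : ∀ x → + 0 ℤ.≤ x * x
0≤x*x x@(+ _)        = subst (+ 0 ℤ.≤_) (ℤₚ.pos-* ∣ x ∣ ∣ x ∣) (ℤ.+≤+ ℕ.z≤n)
0≤x*x ℤ.-[1+ m ] = ℤ.+≤+ ℕ.z≤n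

0≤x*x-x : ∀ x → + 0 ℤ.≤ x * x - x
0≤x*x-x (+ zero)     = ℤ.+≤+ ℕ.z≤n
0≤x*x-x (+ suc m)    = subst (+ 0 ℤ.≤_) (trans (ℤₚ.pos-* (suc m) m) (lemma (+ m))) (ℤ.+≤+ ℕ.z≤n)
  where
  lemma : ∀ k → (+ 1 + k) * k ≡ (+ 1 + k) * (+ 1 + k) - (+ 1 + k)
  lemma = solve-∀
0≤x*x-x ℤ.-[1+ m ]   = subst (+ 0 ℤ.≤_) (trans (ℤₚ.pos-* (suc m) (suc (suc m))) (lemma (+ m))) (ℤ.+≤+ ℕ.z≤n)
  where
  lemma : ∀ k → (+ 1 + k) * (+ 1 + (+ 1 + k)) ≡ - (+ 1 + k) * - (+ 1 + k) - - (+ 1 + k)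
  lemma = solve-∀

∑-nonneg : {f : Fin n → ℤ} → (∀ i → + 0 ℤ.≤ f i) → + 0 ℤ.≤ ∑ f
∑-nonneg {zero}  h = ℤₚ.≤-refl
∑-nonneg {suc n} h = ℤₚ.+-mono-≤ (h zero) (∑-nonneg (h ∘ suc))

∑-≥-term : {f : Fin n → ℤ} → (∀ i → + 0 ℤ.≤ f i) → ∀ i → f i ℤ.≤ ∑ f
∑-≥-term {suc n} {f} h zero = subst (ℤ._≤ ∑ f) (ℤₚ.+-identityʳ (f zero)) (ℤₚ.+-monoʳ-≤ (f zero) (∑-nonneg (h ∘ suc)))
∑-≥-term {suc n} {f} h (suc i) = subst (ℤ._≤ ∑ f) (ℤₚ.+-identityˡ (f (suc i))) (ℤₚ.+-mono-≤ (h zero) (∑-≥-term (h ∘ suc) i))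

∑-nonneg-≡0 : {f : Fin n → ℤ} → (∀ i → + 0 ℤ.≤ f i) → ∑ f ≡ + 0 → ∀ i → f i ≡ + 0
∑-nonneg-≡0 {f = f} h eq i = ℤₚ.≤-antisym (subst (f i ℤ.≤_) eq (∑-≥-term h i)) (h i)

idempotent : ∀ x → x * x - x ≡ + 0 → x ≡ + 0 ⊎ x ≡ + 1
idempotent x eq with ℤₚ.i*j≡0⇒i≡0∨j≡0 x (trans (lemma x) eq)
  where
  lemma : ∀ x → x * (x - + 1) ≡ x * x - x
  lemma = solve-∀
... | inj₁ x≡0   = inj₁ x≡0
... | inj₂ x-1≡0 = inj₂ (ℤₚ.i-j≡0⇒i≡j x (+ 1) x-1≡0)

-- For an integer, x^2 - x is nonnegative; the sum of these excesses is zero, so each of them is.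
∑-idempotent : (x : Fin n → ℤ) → x ⋆ x ≡ ∑ x → ∀ i → x i ≡ + 0 ⊎ x i ≡ + 1
∑-idempotent x eq i = idempotent (x i) (∑-nonneg-≡0 {f = λ i → x i * x i - x i} (λ i → 0≤x*x-x (x i))
  (trans (∑-+ (λ i → x i * x i) (λ i → - x i)) (trans (cong₂ _+_ eq (∑-neg x)) (ℤₚ.+-inverseʳ (∑ x)))) i)

∑≡1⇒unit : (x : Fin n → ℤ) → (∀ i → x i ≡ + 0 ⊎ x i ≡ + 1) → ∑ x ≡ + 1 → ∃[ a ] ∀ i → x i ≡ δ a i
∑≡1⇒unit {zero}  x bool ()
∑≡1⇒unit {suc n} x bool eq = head (bool zero)
  where
  0≤ : ∀ i → + 0 ℤ.≤ x i
  0≤ i = [ (λ e → ℤₚ.≤-reflexive (sym e)) , (λ e → subst (+ 0 ℤ.≤_) (sym e) (ℤ.+≤+ ℕ.z≤n)) ]′ (bool i)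
  head : x zero ≡ + 0 ⊎ x zero ≡ + 1 → ∃[ a ] ∀ i → x i ≡ δ a i
  head (inj₂ e) = zero , λ { zero → e ; (suc i) → ∑-nonneg-≡0 (λ i → 0≤ (suc i)) tail≡0 i }
    where
    tail≡0 : ∑ (x ∘ suc) ≡ + 0
    tail≡0 = ∙-cancelˡ (+ 1) (∑ (x ∘ suc)) (+ 0) (trans (cong (_+ ∑ (x ∘ suc)) (sym e)) eq)
  head (inj₁ e) = let a , h = ∑≡1⇒unit (x ∘ suc) (bool ∘ suc) (trans (sym (ℤₚ.+-identityˡ (∑ (x ∘ suc)))) (trans (cong (_+ ∑ (x ∘ suc)) (sym e)) eq)) in
    suc a , λ { zero → e ; (suc i) → trans (h i) (sym (δ-suc a i)) }

δ-injective : (i j : Fin n) → δ i j ≡ + 1 → i ≡ j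
δ-injective i j eq with i ≟ j
... | yes i≡j = i≡j
... | no  _   = contradiction eq λ ()

adjMat-injective : (G H : Graph n) → ∀ {i j k l} → adjMat G i j ≡ adjMat H k l → Graph.adj G i j ≡ Graph.adj H k l
adjMat-injective G H {i} {j} {k} {l} eq with Graph.adj G i j | Graph.adj H k l
... | true  | true  = refl
... | false | false = refl
... | true  | false = contradiction eq λ ()
... | false | true  = contradiction eq λ ()

-- Every row and column has square sum 1 and sum 1, hence is a unit vector. Rows give `σ`, columns
-- give `τ`, and reading one entry both ways shows that they are mutually inverse.
scaled₁⇒isomorphic : {G H : Graph n} {M : Matrix ℤ n} → Scaled G H (+ 1) M → Isomorphic G H
scaled₁⇒isomorphic {n} {G} {H} {M} scaled = permutation σ τ στ τσ ,
  λ i j → adjMat-injective H G (trans (sym (adjacency (σ i) (σ j))) (cong₂ (adjMat G) (τσ i) (τσ j)))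
  where
  open Scaled scaled
  norm : ∀ j → (M ᵀ) j ⋆ (M ᵀ) j ≡ + 1
  norm j = trans (orthogonal j j) (cong (+ 1 * + 1 *_) (δ-refl j))
  row-norm : ∀ i → M i ⋆ M i ≡ + 1
  row-norm i = trans (∙-comm-scalar (M ᵀ) M {+ 1} (λ ()) orthogonal i i) (cong (+ 1 *_) (δ-refl i))
  units : ∀ j → ∃[ a ] ∀ i → M i j ≡ δ a i
  units j = ∑≡1⇒unit ((M ᵀ) j) (∑-idempotent ((M ᵀ) j) (trans (norm j) (sym (column-sum j)))) (column-sum j)
  row-units : ∀ i → ∃[ a ] ∀ j → M i j ≡ δ a j
  row-units i = ∑≡1⇒unit (M i) (∑-idempotent (M i) (trans (row-norm i) (sym (row-sum i)))) (row-sum i)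
  τ σ : Fin n → Fin n
  τ j = proj₁ (units j)
  σ i = proj₁ (row-units i)
  column : ∀ j i → M i j ≡ δ (τ j) i
  column j = proj₂ (units j)
  row : ∀ i j → M i j ≡ δ (σ i) j
  row i = proj₂ (row-units i)
  τσ : ∀ a → τ (σ a) ≡ a
  τσ a = δ-injective (τ (σ a)) a (trans (sym (column (σ a) a)) (trans (row a (σ a)) (δ-refl (σ a))))
  στ : ∀ j → σ (τ j) ≡ j
  στ j = δ-injective (σ (τ j)) j (trans (sym (row (τ j) j)) (trans (column j (τ j)) (δ-refl (τ j))))
  adjacency : ∀ i j → adjMat G (τ i) (τ j) ≡ adjMat H i j
  adjacency i j = begin
    adjMat G (τ i) (τ j) ≡⟨ sym (∑-δʳ (τ j) (adjMat G (τ i))) ⟩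
    ∑ (λ a → adjMat G (τ i) a * δ a (τ j)) ≡⟨ ∑-cong (λ a → cong (adjMat G (τ i) a *_) (trans (δ-sym a (τ j)) (sym (column j a)))) ⟩
    adjMat G (τ i) ⋆ (M ᵀ) j ≡⟨ intertwine j (τ i) ⟩
    ∑ (λ k → adjMat H k j * M (τ i) k) ≡⟨ ∑-cong (λ k → cong (adjMat H k j *_) (trans (row (τ i) k) (trans (cong (λ z → δ z k) (στ i)) (δ-sym i k)))) ⟩
    ∑ (λ k → adjMat H k j * δ k i) ≡⟨ ∑-δʳ i (λ k → adjMat H k j) ⟩
    adjMat H i j ∎

-- Search for primitive matrices

-- Provides the exhaustive search by which a primitive matrix is found from `¬ DGS G`. Matrices are
-- functions and can be listed only up to pointwise equality, so the predicate searched for must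
-- respect `_≈_`.
record Searchable (A : Set) (_≈_ : A → A → Set) : Set₁ where
  field
    ≈-refl : ∀ {x} → x ≈ x
    search : (P : A → Set) → (∀ {x y} → x ≈ y → P x → P y) → (∀ x → Dec (P x)) → Dec (∃ P)

searchable-Fin : ∀ k → Searchable (Fin k) _≡_
searchable-Fin k = record { ≈-refl = refl ; search = λ P _ P? → Finₚ.any? P? }

searchable-Π : ∀ {A _≈_} n → Searchable A _≈_ → Searchable (Fin n → A) (λ f g → ∀ i → f i ≈ g i)
searchable-Π {A} {_≈_} n S = record { ≈-refl = λ _ → ≈-refl ; search = go n }
  where
  open Searchable S
  go : ∀ n (P : (Fin n → A) → Set) → (∀ {f g} → (∀ i → f i ≈ g i) → P f → P g) → (∀ f → Dec (P f)) → Dec (∃ P)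
  go zero P resp P? with P? (λ ())
  ... | yes p = yes (_ , p)
  ... | no ¬p = no λ (f , p) → ¬p (resp (λ ()) p)
  go (suc n) P resp P? with search (λ x → ∃[ f ] P (x ◂ f)) (λ x≈y (f , p) → f , resp (λ { zero → x≈y ; (suc i) → ≈-refl }) p)
    (λ x → go n (λ f → P (x ◂ f)) (λ f≈g → resp λ { zero → ≈-refl ; (suc i) → f≈g i }) (λ f → P? (x ◂ f)))
  ... | yes (x , f , p) = yes (_ , p)
  ... | no ¬p = no λ (f , p) → ¬p (f zero , f ∘ suc , resp (λ { zero → ≈-refl ; (suc i) → ≈-refl }) p)

-- The integral matrix p Q of a primitive Q, in decidable terms and tied to `G`. The rank condition
-- becomes membership of the columns in the kernel modulo p: for the graphs considered this kernel
-- has one generator, so all columns are multiples of any nontrivial kernel vector. `nonzero` keeps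
-- the level from dropping below p.
record IntPrimitive (p : ℕ) (G : Graph n) (M : Matrix ℤ n) : Set where
  field
    orthogonal : ∀ i j → (M ᵀ) i ⋆ (M ᵀ) j ≡ + p * + p * δ i j
    row-sum    : ∀ i → ∑ (M i) ≡ + p
    nonzero    : ¬ (∀ a j → + p ∣ M a j)
    kernel     : ∀ j → Kernel G (+ p) ((M ᵀ) j)

intPrimitive-resp : ∀ {p} {G : Graph n} {M N : Matrix ℤ n} → (∀ i j → M i j ≡ N i j) → IntPrimitive p G M → IntPrimitive p G N
intPrimitive-resp {p = p} {G} eq prim = record
  { orthogonal = λ i j → trans (∑-cong (λ a → sym (cong₂ _*_ (eq a i) (eq a j)))) (orthogonal i j)
  ; row-sum    = λ i → trans (∑-cong (λ j → sym (eq i j))) (row-sum i)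
  ; nonzero    = λ h → nonzero (λ a j → subst (+ p ∣_) (sym (eq a j)) (h a j))
  ; kernel     = λ j k → subst (+ p ∣_) (⋆-cong {x = walkVec G (toℕ k)} (λ _ → refl) (λ a → eq a j)) (kernel j k)
  }
  where open IntPrimitive prim

intPrimitive? : ∀ p (G : Graph n) M → Dec (IntPrimitive p G M)
intPrimitive? p G M = map′ (λ (o , r , z , k) → record { orthogonal = o ; row-sum = r ; nonzero = z ; kernel = k })
  (λ prim → let open IntPrimitive prim in orthogonal , row-sum , nonzero , kernel)
  (Finₚ.all? (λ i → Finₚ.all? (λ j → (M ᵀ) i ⋆ (M ᵀ) j ℤ.≟ + p * + p * δ i j))
    ×-dec Finₚ.all? (λ i → ∑ (M i) ℤ.≟ + p)
    ×-dec ¬? (Finₚ.all? (λ a → Finₚ.all? (λ j → + p ℤ∣.∣? M a j)))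
    ×-dec Finₚ.all? (λ j → Finₚ.all? (λ k → + p ℤ∣.∣? (walkVec G (toℕ k) ⋆ (M ᵀ) j))))

-- A column has square sum p^2. This makes the search space finite.
intPrimitive-bounded : ∀ {p} {G : Graph n} {M} → IntPrimitive p G M → ∀ a j → ∣ M a j ∣ ℕ.≤ p
intPrimitive-bounded {p = p} {M = M} prim a j = square-cancel (ℤₚ.drop‿+≤+ (subst₂ ℤ._≤_ square norm (∑-≥-term {f = λ a → M a j * M a j} (λ a → 0≤x*x (M a j)) a)))
  where
  open IntPrimitive prim
  square : M a j * M a j ≡ + (∣ M a j ∣ ℕ.* ∣ M a j ∣)
  square = sym (trans (cong +_ (sym (ℤₚ.abs-* (M a j) (M a j)))) (ℤₚ.0≤i⇒+∣i∣≡i (0≤x*x (M a j))))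
  norm : (M ᵀ) j ⋆ (M ᵀ) j ≡ + (p ℕ.* p)
  norm = trans (orthogonal j j) (trans (cong (+ p * + p *_) (δ-refl j)) (trans (ℤₚ.*-identityʳ (+ p * + p)) (sym (ℤₚ.pos-* p p))))
  square-cancel : ∀ {x y} → x ℕ.* x ℕ.≤ y ℕ.* y → x ℕ.≤ y
  square-cancel {x} {y} le = ℕₚ.≮⇒≥ (λ y<x → ℕₚ.<⇒≱ (ℕₚ.*-mono-< y<x y<x) le)

decode : ∀ p → Fin (suc (p ℕ.+ p)) → ℤ
decode p c = + toℕ c - + p

encode : ∀ p x → ∣ x ∣ ℕ.≤ p → ∃[ c ] decode p c ≡ x
encode p (+ m) m≤p = fromℕ< lt , trans (cong (λ z → + z - + p) (Finₚ.toℕ-fromℕ< lt)) (lemma (+ p) (+ m))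
  where
  lt : p ℕ.+ m ℕ.< suc (p ℕ.+ p)
  lt = ℕ.s≤s (ℕₚ.+-monoʳ-≤ p m≤p)
  lemma : ∀ p m → p + m - p ≡ m
  lemma = solve-∀
encode p ℤ.-[1+ m ] m<p = fromℕ< lt , trans (cong (λ z → + z - + p) (Finₚ.toℕ-fromℕ< lt)) (trans (cong (_- + p) difference) (lemma (+ p) (+ suc m)))
  where
  lt : p ℕ.∸ suc m ℕ.< suc (p ℕ.+ p)
  lt = ℕ.s≤s (ℕₚ.≤-trans (ℕₚ.m∸n≤m p (suc m)) (ℕₚ.m≤m+n p p))
  difference : + (p ℕ.∸ suc m) ≡ + p - + suc m
  difference = trans (sym (ℤₚ.⊖-≥ m<p)) (sym (ℤₚ.m-n≡m⊖n p (suc m)))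
  lemma : ∀ p m → p - m - p ≡ - m
  lemma = solve-∀

∃-intPrimitive? : ∀ p (G : Graph n) → Dec (∃[ M ] IntPrimitive p G M)
∃-intPrimitive? {n} p G = map′ (λ (c , prim) → _ , prim) encoded
  (Searchable.search (searchable-Π n (searchable-Π n (searchable-Fin (suc (p ℕ.+ p)))))
    (λ c → IntPrimitive p G (λ i j → decode p (c i j)))
    (λ c≈c′ → intPrimitive-resp (λ i j → cong (decode p) (c≈c′ i j)))
    (λ c → intPrimitive? p G (λ i j → decode p (c i j))))
  where
  encoded : ∃[ M ] IntPrimitive p G M → ∃[ c ] IntPrimitive p G (λ i j → decode p (c i j))
  encoded (M , prim) = (λ i j → proj₁ (code i j)) , intPrimitive-resp (λ i j → sym (proj₂ (code i j))) prim
    where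
    code : ∀ i j → ∃[ c ] decode p c ≡ M i j
    code i j = encode p (M i j) (intPrimitive-bounded prim i j)

-- Rational matrices

-- Built directly in lowest terms, so that numerator and denominator compute on it; `/1≡fromℤ`
-- converts the form used in `scaleQ`.
fromℤ : ℤ → ℚ
fromℤ z = mkℚ z 0 (Coprimality.sym (Coprimality.1-coprimeTo ∣ z ∣))

/1≡fromℤ : ∀ z → z ℚ./ 1 ≡ fromℤ z
/1≡fromℤ z = ℚₚ.↥p/↧p≡p (fromℤ z)

fromℤ-+ : ∀ a b → fromℤ a ℚ.+ fromℤ b ≡ fromℤ (a + b)
fromℤ-+ a b = trans (cong (ℚ._/ 1) (cong₂ _+_ (ℤₚ.*-identityʳ a) (ℤₚ.*-identityʳ b))) (/1≡fromℤ (a + b))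

fromℤ-* : ∀ a b → fromℤ a ℚ.* fromℤ b ≡ fromℤ (a * b)
fromℤ-* a b = /1≡fromℤ (a * b)

fromℤ-injective : ∀ {a b} → fromℤ a ≡ fromℤ b → a ≡ b
fromℤ-injective eq = cong ↥_ eq

integral⇒fromℤ : ∀ q → IntegralQ q → q ≡ fromℤ (↥ q)
integral⇒fromℤ (mkℚ n zero _) refl = refl

scaleQ≡ : ∀ k q → scaleQ k q ≡ fromℤ (+ k) ℚ.* q
scaleQ≡ k q = cong (ℚ._* q) (/1≡fromℤ (+ k))

∑ℚ-cong : {f g : Fin n → ℚ} → (∀ i → f i ≡ g i) → LQ.sumF f ≡ LQ.sumF g
∑ℚ-cong {zero}  h = refl
∑ℚ-cong {suc n} h = cong₂ ℚ._+_ (h zero) (∑ℚ-cong (h ∘ suc))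

∑ℚ-*ʳ : (c : ℚ) (f : Fin n → ℚ) → LQ.sumF (λ i → f i ℚ.* c) ≡ LQ.sumF f ℚ.* c
∑ℚ-*ʳ {zero}  c f = sym (ℚₚ.*-zeroˡ c)
∑ℚ-*ʳ {suc n} c f = trans (cong (ℚ._+_ (f zero ℚ.* c)) (∑ℚ-*ʳ c (f ∘ suc))) (sym (ℚₚ.*-distribʳ-+ c (f zero) (LQ.sumF (f ∘ suc))))

∑ℚ-fromℤ : (f : Fin n → ℤ) → LQ.sumF (λ i → fromℤ (f i)) ≡ fromℤ (∑ f)
∑ℚ-fromℤ {zero}  f = refl
∑ℚ-fromℤ {suc n} f = trans (cong (ℚ._+_ (fromℤ (f zero))) (∑ℚ-fromℤ (f ∘ suc))) (fromℤ-+ (f zero) (∑ (f ∘ suc)))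

δℚ≡ : (i j : Fin n) → LQ.δ i j ≡ fromℤ (δ i j)
δℚ≡ i j with i ≟ j
... | yes _ = refl
... | no  _ = refl

¬∀∀⇒∃∃¬ : ∀ {N} (M : Matrix ℤ n) → ¬ (∀ a j → N ∣ M a j) → ∃[ a ] ∃[ j ] ¬ N ∣ M a j
¬∀∀⇒∃∃¬ {n} {N} M ¬all =
  let a , ¬row = Finₚ.¬∀⟶∃¬ n (λ a → ∀ j → N ∣ M a j) (λ a → Finₚ.all? (λ j → N ℤ∣.∣? M a j)) ¬all
      j , ¬entry = Finₚ.¬∀⟶∃¬ n (λ j → N ∣ M a j) (λ j → N ℤ∣.∣? M a j) ¬row
  in a , j , ¬entry

module _ {p : ℕ} (prime-p : Prime p) where

  p⁻¹ : ℚ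
  p⁻¹ = ℚ.1/_ (fromℤ (+ p)) {{prime⇒nonZero prime-p}}

  p*p⁻¹ : fromℤ (+ p) ℚ.* p⁻¹ ≡ 1ℚ
  p*p⁻¹ = ℚₚ.*-inverseʳ (fromℤ (+ p)) {{prime⇒nonZero prime-p}}

  p*[x*p⁻¹] : ∀ x → fromℤ (+ p) ℚ.* (x ℚ.* p⁻¹) ≡ x
  p*[x*p⁻¹] x = trans (cong (fromℤ (+ p) ℚ.*_) (ℚₚ.*-comm x p⁻¹)) (trans (sym (ℚₚ.*-assoc (fromℤ (+ p)) p⁻¹ x)) (trans (cong (ℚ._* x) p*p⁻¹) (ℚₚ.*-identityˡ x)))

  intPrimitive⇒generates : {G : Graph n} {M : Matrix ℤ n} → IntPrimitive p G M → ∀ z → ColumnsMultipleOf p M z → ∃[ Q ] Generates p z Q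
  intPrimitive⇒generates {n} {G} {M} prim z multiples = Q , (regular , orthogonalQ , (0<p , integral , minimal) , (some-nonzero , z , columns)) , columns
    where
    open IntPrimitive prim
    Q : Matrix ℚ n
    Q i j = fromℤ (M i j) ℚ.* p⁻¹
    0<p : 0 ℕ.< p
    0<p = ℕ.>-nonZero⁻¹ p {{prime⇒nonZero prime-p}}
    pQ : ∀ i j → scaleQ p (Q i j) ≡ fromℤ (M i j)
    pQ i j = trans (scaleQ≡ p (Q i j)) (p*[x*p⁻¹] (fromℤ (M i j)))
    pQint≡ : ∀ i j → pQint p Q i j ≡ M i j
    pQint≡ i j = cong ↥_ (pQ i j)
    integral : IntegralMat (λ i j → scaleQ p (Q i j))
    integral i j = cong ↧ₙ_ (pQ i j)
    regular : Regular Q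
    regular i = trans (∑ℚ-*ʳ p⁻¹ (λ j → fromℤ (M i j))) (trans (cong (ℚ._* p⁻¹) (trans (∑ℚ-fromℤ (M i)) (cong fromℤ (row-sum i)))) p*p⁻¹)
    orthogonalQ : Orthogonal Q
    orthogonalQ i j = begin
      LQ.sumF (λ k → Q k i ℚ.* Q k j)
        ≡⟨ ∑ℚ-cong (λ k → trans (interchange (fromℤ (M k i)) p⁻¹ (fromℤ (M k j)) p⁻¹) (cong (ℚ._* (p⁻¹ ℚ.* p⁻¹)) (fromℤ-* (M k i) (M k j)))) ⟩
      LQ.sumF (λ k → fromℤ (M k i * M k j) ℚ.* (p⁻¹ ℚ.* p⁻¹))
        ≡⟨ ∑ℚ-*ʳ (p⁻¹ ℚ.* p⁻¹) (λ k → fromℤ (M k i * M k j)) ⟩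
      LQ.sumF (λ k → fromℤ (M k i * M k j)) ℚ.* (p⁻¹ ℚ.* p⁻¹)
        ≡⟨ cong (ℚ._* (p⁻¹ ℚ.* p⁻¹)) (trans (∑ℚ-fromℤ (λ k → M k i * M k j)) (trans (cong fromℤ (orthogonal i j))
             (trans (sym (fromℤ-* (+ p * + p) (δ i j))) (trans (cong (ℚ._* fromℤ (δ i j)) (sym (fromℤ-* (+ p) (+ p)))) (ℚₚ.*-comm (fromℤ (+ p) ℚ.* fromℤ (+ p)) (fromℤ (δ i j))))))) ⟩
      fromℤ (δ i j) ℚ.* (fromℤ (+ p) ℚ.* fromℤ (+ p)) ℚ.* (p⁻¹ ℚ.* p⁻¹)
        ≡⟨ trans (ℚₚ.*-assoc (fromℤ (δ i j)) (fromℤ (+ p) ℚ.* fromℤ (+ p)) (p⁻¹ ℚ.* p⁻¹)) (cong (fromℤ (δ i j) ℚ.*_) (trans (interchange (fromℤ (+ p)) (fromℤ (+ p)) p⁻¹ p⁻¹) (cong₂ ℚ._*_ p*p⁻¹ p*p⁻¹))) ⟩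
      fromℤ (δ i j) ℚ.* (1ℚ ℚ.* 1ℚ)
        ≡⟨ trans (ℚₚ.*-identityʳ (fromℤ (δ i j))) (sym (δℚ≡ i j)) ⟩
      LQ.δ i j ∎
    minimal : ∀ k → 0 ℕ.< k → k ℕ.< p → ¬ IntegralMat (λ i j → scaleQ k (Q i j))
    -- If k Q were integral, p would divide k M; as k is prime to p, it would divide every entry of
    -- `M`.
    minimal k 0<k k<p int = nonzero (λ a j → invertible-cancel (+ k) (M a j) (prime-unit prime-p (+ k) p∤k) (divides (↥ scaleQ k (Q a j)) (product a j)))
      where
      p∤k : ¬ + p ∣ + k
      p∤k h = ℕₚ.<⇒≱ k<p (ℕ∣.∣⇒≤ {{ℕ.>-nonZero 0<k}} (ℤ∣.∣⇒∣ᵤ h))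
      product : ∀ a j → + k * M a j ≡ ↥ scaleQ k (Q a j) * + p
      product a j = fromℤ-injective (begin
        fromℤ (+ k * M a j) ≡⟨ sym (fromℤ-* (+ k) (M a j)) ⟩
        fromℤ (+ k) ℚ.* fromℤ (M a j) ≡⟨ sym (p*[x*p⁻¹] (fromℤ (+ k) ℚ.* fromℤ (M a j))) ⟩
        fromℤ (+ p) ℚ.* (fromℤ (+ k) ℚ.* fromℤ (M a j) ℚ.* p⁻¹) ≡⟨ cong (fromℤ (+ p) ℚ.*_) (trans (ℚₚ.*-assoc (fromℤ (+ k)) (fromℤ (M a j)) p⁻¹) (sym (scaleQ≡ k (Q a j)))) ⟩
        fromℤ (+ p) ℚ.* scaleQ k (Q a j) ≡⟨ ℚₚ.*-comm (fromℤ (+ p)) (scaleQ k (Q a j)) ⟩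
        scaleQ k (Q a j) ℚ.* fromℤ (+ p) ≡⟨ cong (ℚ._* fromℤ (+ p)) (integral⇒fromℤ (scaleQ k (Q a j)) (int a j)) ⟩
        fromℤ (↥ scaleQ k (Q a j)) ℚ.* fromℤ (+ p) ≡⟨ fromℤ-* (↥ scaleQ k (Q a j)) (+ p) ⟩
        fromℤ (↥ scaleQ k (Q a j) * + p) ∎)
    some-nonzero : ∃[ i ] ∃[ j ] ¬ (pQint p Q i j ≡ + 0 [mod p ])
    some-nonzero = let a , j , ¬entry = ¬∀∀⇒∃∃¬ M nonzero in
      a , j , λ h → ¬entry (subst (+ p ∣_) (trans (ℤₚ.+-identityʳ (pQint p Q a j)) (pQint≡ a j)) (ℤ∣.∣ᵤ⇒∣ h))
    columns : ColumnsMultipleOf p (pQint p Q) z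
    columns j = let c , h = multiples j in c , λ i → subst (λ x → x ≡ c * z i [mod p ]) (sym (pQint≡ i j)) (h i)

  -- A primitive Q by itself is unrelated to `G`; its columns lie in the kernel because modulo p
  -- they are multiples of `z`, which does.
  generates⇒intPrimitive : {G : Graph n} {z : Fin n → ℤ} → Kernel G (+ p) z → ∀ Q → Generates p z Q → IntPrimitive p G (pQint p Q)
  generates⇒intPrimitive {n} {G} {z} ker Q ((regular , orth , (_ , integral , _) , ((a , j , nonzero-entry) , _)) , columns) = record
    { orthogonal = λ i j → fromℤ-injective (trans (sym (∑ℚ-fromℤ (λ k → M k i * M k j)))
        (trans (∑ℚ-cong (λ k → trans (sym (fromℤ-* (M k i) (M k j))) (trans (cong₂ ℚ._*_ (entry k i) (entry k j))
            (trans (interchange (fromℤ (+ p)) (Q k i) (fromℤ (+ p)) (Q k j)) (ℚₚ.*-comm (fromℤ (+ p) ℚ.* fromℤ (+ p)) (Q k i ℚ.* Q k j))))))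
          (trans (∑ℚ-*ʳ (fromℤ (+ p) ℚ.* fromℤ (+ p)) (λ k → Q k i ℚ.* Q k j))
            (trans (cong₂ ℚ._*_ (trans (orth i j) (δℚ≡ i j)) (fromℤ-* (+ p) (+ p))) (trans (fromℤ-* (δ i j) (+ p * + p)) (cong fromℤ (ℤₚ.*-comm (δ i j) (+ p * + p))))))))
    ; row-sum = λ i → fromℤ-injective (trans (sym (∑ℚ-fromℤ (M i))) (trans (∑ℚ-cong (λ j → trans (entry i j) (ℚₚ.*-comm (fromℤ (+ p)) (Q i j))))
        (trans (∑ℚ-*ʳ (fromℤ (+ p)) (Q i)) (trans (cong (ℚ._* fromℤ (+ p)) (regular i)) (ℚₚ.*-identityˡ (fromℤ (+ p)))))))
    ; nonzero = λ all → nonzero-entry (ℤ∣.∣⇒∣ᵤ (subst (+ p ∣_) (sym (ℤₚ.+-identityʳ (M a j))) (all a j)))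
    ; kernel = λ j k → let c , h = columns j in subst (+ p ∣_) (recombine (walkVec G (toℕ k)) c j)
        (ℤ∣.∣m∣n⇒∣m+n (ℤ∣.∣n⇒∣m*n (+ 1) (⋆-∣ʳ {x = walkVec G (toℕ k)} (λ i → ℤ∣.∣ᵤ⇒∣ (h i)))) (ℤ∣.∣n⇒∣m*n c (ker k)))
    }
    where
    M : Matrix ℤ n
    M = pQint p Q
    entry : ∀ i j → fromℤ (M i j) ≡ fromℤ (+ p) ℚ.* Q i j
    entry i j = trans (sym (integral⇒fromℤ (scaleQ p (Q i j)) (integral i j))) (scaleQ≡ p (Q i j))
    recombine : ∀ w c j → + 1 * w ⋆ (λ i → M i j - c * z i) + c * w ⋆ z ≡ w ⋆ (M ᵀ) j
    recombine w c j = trans (sym (⋆-linear w (+ 1) c (λ i → M i j - c * z i) z)) (⋆-cong {x = w} (λ _ → refl) (λ i → lemma (M i j) c (z i)))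
      where
      lemma : ∀ m c z → + 1 * (m - c * z) + c * z ≡ m
      lemma = solve-∀

-- The graph obtained from a primitive matrix

det-conjugate : {M X Y : Matrix ℤ n} {c : ℤ} → c ≢ + 0 → (∀ i j → (M ᵀ ∙ M) i j ≡ c * δ i j) →
  (∀ i j → (M ᵀ ∙ (X ∙ M)) i j ≡ c * Y i j) → detℤ X ≡ detℤ Y
det-conjugate {n} {M} {X} {Y} {c} c≢0 orth conj = *-cancelˡ-≢0 (det-scalar-≢0 {n} c≢0) (begin
  detℤ {n} (λ i j → c * δ i j) * detℤ X ≡⟨ cong (_* detℤ X) (trans (det-cong {n} (λ i j → sym (orth i j))) (det-∙ (M ᵀ) M)) ⟩
  detℤ (M ᵀ) * detℤ M * detℤ X ≡⟨ lemma (detℤ (M ᵀ)) (detℤ M) (detℤ X) ⟩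
  detℤ (M ᵀ) * (detℤ X * detℤ M) ≡⟨ sym (trans (det-∙ (M ᵀ) (X ∙ M)) (cong (detℤ (M ᵀ) *_) (det-∙ X M))) ⟩
  detℤ (M ᵀ ∙ (X ∙ M)) ≡⟨ det-cong {n} conj ⟩
  detℤ (λ i j → c * Y i j) ≡⟨ det-scale c Y ⟩
  detℤ {n} (λ i j → c * δ i j) * detℤ Y ∎)
  where
  lemma : ∀ a b x → a * b * x ≡ a * (x * b)
  lemma = solve-∀

compAdjMat≡ : (G : Graph n) → ∀ i j → compAdjMat G i j ≡ + 1 - δ i j - adjMat G i j
compAdjMat≡ G i j with i ≟ j
... | yes refl = cong (λ z → + 1 - + 1 - z) (sym (adjMat-diagonal G i))
... | no _ with Graph.adj G i j
...   | true  = refl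
...   | false = refl

-- `M` conjugates I, A and J simultaneously, J because of the column sums, hence every combination α
-- I + β A + γ J. The characteristic matrices of graph and complement are the cases (s, -1, 0) and
-- (s + 1, 1, -1).
scaled⇒genCospectral : {G H : Graph n} {ℓ : ℤ} {M : Matrix ℤ n} → ℓ ≢ + 0 → Scaled G H ℓ M → GenCospectral G H
scaled⇒genCospectral {n} {G} {H} {ℓ} {M} ℓ≢0 scaled =
  det⇒sameSpectrum {M = adjMat G} {adjMat H} (λ s → trans (det-cong {n} (λ i j → shape s (δ i j) (adjMat G i j)))
    (trans (dets s (- + 1) (+ 0)) (det-cong {n} (λ i j → sym (shape s (δ i j) (adjMat H i j)))))) ,
  det⇒sameSpectrum {M = compAdjMat G} {compAdjMat H} (λ s → trans (det-cong {n} (λ i j → trans (cong (λ z → s * δ i j - + 1 * z) (compAdjMat≡ G i j)) (comp-shape s (δ i j) (adjMat G i j))))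
    (trans (dets (s + + 1) (+ 1) (- + 1)) (det-cong {n} (λ i j → sym (trans (cong (λ z → s * δ i j - + 1 * z) (compAdjMat≡ H i j)) (comp-shape s (δ i j) (adjMat H i j)))))))
  where
  open Scaled scaled
  shape : ∀ s d a → s * d - + 1 * a ≡ + 1 * (s * d + - + 1 * a) + + 0 * + 1
  shape = solve-∀
  comp-shape : ∀ s d a → s * d - + 1 * (+ 1 - d - a) ≡ + 1 * ((s + + 1) * d + + 1 * a) + - + 1 * + 1
  comp-shape = solve-∀
  conjugate : ∀ i j → (M ᵀ) i ⋆ (adjMat G ⊙ (M ᵀ) j) ≡ ℓ * ℓ * adjMat H i j
  conjugate i j = trans (⋆-intertwine scaled ((M ᵀ) i) j) (trans (∑-cong (λ k → cong (adjMat H k j *_) (trans (orthogonal i k) (cong (ℓ * ℓ *_) (δ-sym i k)))))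
    (∑-scaled-δʳ (ℓ * ℓ) i (λ k → adjMat H k j)))
  dets : ∀ α β γ → detℤ (λ i j → + 1 * (α * δ i j + β * adjMat G i j) + γ * + 1) ≡ detℤ (λ i j → + 1 * (α * δ i j + β * adjMat H i j) + γ * + 1)
  dets α β γ = det-conjugate {M = M} {X} {Y} (*-≢0 ℓ≢0 ℓ≢0) orthogonal conj
    where
    X Y : Matrix ℤ n
    X i j = + 1 * (α * δ i j + β * adjMat G i j) + γ * + 1
    Y i j = + 1 * (α * δ i j + β * adjMat H i j) + γ * + 1
    XM : ∀ a j → (X ∙ M) a j ≡ + 1 * (α * M a j + β * (adjMat G ⊙ (M ᵀ) j) a) + γ * ℓ
    XM a j = begin
      ∑ (λ k → X a k * M k j)
        ≡⟨ ∑-cong (λ k → ℤₚ.*-comm (X a k) (M k j)) ⟩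
      (M ᵀ) j ⋆ X a
        ≡⟨ trans (⋆-linear ((M ᵀ) j) (+ 1) γ (λ k → α * δ a k + β * adjMat G a k) (λ _ → + 1))
             (cong (λ z → + 1 * z + γ * (M ᵀ) j ⋆ (λ _ → + 1)) (⋆-linear ((M ᵀ) j) α β (δ a) (adjMat G a))) ⟩
      + 1 * (α * (M ᵀ) j ⋆ δ a + β * (M ᵀ) j ⋆ adjMat G a) + γ * (M ᵀ) j ⋆ (λ _ → + 1)
        ≡⟨ cong₂ (λ y z → + 1 * y + γ * z) (cong₂ (λ y z → α * y + β * z) (trans (⋆-comm ((M ᵀ) j) (δ a)) (∑-δˡ a ((M ᵀ) j))) (⋆-comm ((M ᵀ) j) (adjMat G a)))
             (trans (∑-cong (λ k → ℤₚ.*-identityʳ (M k j))) (column-sum j)) ⟩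
      + 1 * (α * M a j + β * (adjMat G ⊙ (M ᵀ) j) a) + γ * ℓ ∎
    collect : ∀ α β γ ℓ d b → + 1 * (α * (ℓ * ℓ * d) + β * (ℓ * ℓ * b)) + γ * ℓ * ℓ ≡ ℓ * ℓ * (+ 1 * (α * d + β * b) + γ * + 1)
    collect = solve-∀
    conj : ∀ i j → (M ᵀ ∙ (X ∙ M)) i j ≡ ℓ * ℓ * Y i j
    conj i j = begin
      (M ᵀ) i ⋆ (λ a → (X ∙ M) a j)
        ≡⟨ ⋆-cong {x = (M ᵀ) i} (λ _ → refl) (λ a → trans (XM a j) (cong (_+_ (+ 1 * (α * M a j + β * (adjMat G ⊙ (M ᵀ) j) a))) (sym (ℤₚ.*-identityʳ (γ * ℓ))))) ⟩
      (M ᵀ) i ⋆ (λ a → + 1 * (α * M a j + β * (adjMat G ⊙ (M ᵀ) j) a) + γ * ℓ * + 1)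
        ≡⟨ trans (⋆-linear ((M ᵀ) i) (+ 1) (γ * ℓ) (λ a → α * M a j + β * (adjMat G ⊙ (M ᵀ) j) a) (λ _ → + 1))
             (cong (λ z → + 1 * z + γ * ℓ * (M ᵀ) i ⋆ (λ _ → + 1)) (⋆-linear ((M ᵀ) i) α β ((M ᵀ) j) (adjMat G ⊙ (M ᵀ) j))) ⟩
      + 1 * (α * (M ᵀ) i ⋆ (M ᵀ) j + β * (M ᵀ) i ⋆ (adjMat G ⊙ (M ᵀ) j)) + γ * ℓ * (M ᵀ) i ⋆ (λ _ → + 1)
        ≡⟨ cong₂ (λ y z → + 1 * y + γ * ℓ * z) (cong₂ (λ y z → α * y + β * z) (orthogonal i j) (conjugate i j))
             (trans (∑-cong (λ k → ℤₚ.*-identityʳ (M k i))) (column-sum i)) ⟩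
      + 1 * (α * (ℓ * ℓ * δ i j) + β * (ℓ * ℓ * adjMat H i j)) + γ * ℓ * ℓ
        ≡⟨ collect α β γ ℓ (δ i j) (adjMat H i j) ⟩
      ℓ * ℓ * Y i j ∎

isOne : ℤ → Bool
isOne x = does (x ℤ.≟ + 1)

isOne-value : ∀ {x} → x ≡ + 0 ⊎ x ≡ + 1 → (if isOne x then + 1 else + 0) ≡ x
isOne-value (inj₁ refl) = refl
isOne-value (inj₂ refl) = refl

module Rotation {G : Graph n} {ℓ : ℤ} (ℓ≢0 : ℓ ≢ + 0) {M : Matrix ℤ n}
  (orthogonal : ∀ i j → (M ᵀ) i ⋆ (M ᵀ) j ≡ ℓ * ℓ * δ i j) (row-sum : ∀ i → ∑ (M i) ≡ ℓ)
  (integral : ∀ i j → ℓ * ℓ ∣ (M ᵀ) i ⋆ (adjMat G ⊙ (M ᵀ) j)) where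

  A : Matrix ℤ n
  A = adjMat G

  ℓ²≢0 : ℓ * ℓ ≢ + 0
  ℓ²≢0 = *-≢0 ℓ≢0 ℓ≢0

  B : Matrix ℤ n
  B i j = quotient (integral i j)

  conjugate : ∀ i j → (M ᵀ) i ⋆ (A ⊙ (M ᵀ) j) ≡ ℓ * ℓ * B i j
  conjugate i j = trans (_∣_.equality (integral i j)) (ℤₚ.*-comm (B i j) (ℓ * ℓ))

  rows-orthogonal : ∀ a c → M a ⋆ M c ≡ ℓ * ℓ * δ a c
  rows-orthogonal = ∙-comm-scalar (M ᵀ) M ℓ²≢0 orthogonal

  resolve : ∀ y a → ∑ (λ k → M a k * (M ᵀ) k ⋆ y) ≡ ℓ * ℓ * y a
  resolve y a = trans (⋆-⊙ (M a) (M ᵀ) y) (trans (⋆-cong {y = y} (rows-orthogonal′ a) (λ _ → refl)) (∑-scaled-δˡ (ℓ * ℓ) a y))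
    where
    rows-orthogonal′ : ∀ a c → M c ⋆ M a ≡ ℓ * ℓ * δ a c
    rows-orthogonal′ a c = trans (rows-orthogonal c a) (cong (ℓ * ℓ *_) (δ-sym c a))

  parseval : ∀ y z → ∑ (λ k → y ⋆ (M ᵀ) k * z ⋆ (M ᵀ) k) ≡ ℓ * ℓ * y ⋆ z
  parseval y z = begin
    ∑ (λ k → y ⋆ (M ᵀ) k * z ⋆ (M ᵀ) k) ≡⟨ ∑-cong (λ k → trans (ℤₚ.*-comm (y ⋆ (M ᵀ) k) (z ⋆ (M ᵀ) k)) (cong (_* y ⋆ (M ᵀ) k) (⋆-comm z ((M ᵀ) k)))) ⟩
    ∑ (λ k → (M ᵀ) k ⋆ z * y ⋆ (M ᵀ) k) ≡⟨ sym (⋆-∑ y (λ k → (M ᵀ) k ⋆ z) (M ᵀ)) ⟩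
    y ⋆ (λ a → ∑ (λ k → (M ᵀ) k ⋆ z * M a k)) ≡⟨ ⋆-cong {x = y} (λ _ → refl) (λ a → trans (∑-cong (λ k → ℤₚ.*-comm ((M ᵀ) k ⋆ z) (M a k))) (resolve z a)) ⟩
    ∑ (λ a → y a * (ℓ * ℓ * z a)) ≡⟨ trans (∑-cong (λ a → left-comm (y a) (ℓ * ℓ) (z a))) (∑-*ˡ (ℓ * ℓ) (λ a → y a * z a)) ⟩
    ℓ * ℓ * y ⋆ z ∎
    where
    left-comm : ∀ a b c → a * (b * c) ≡ b * (a * c)
    left-comm = solve-∀

  column-sum : ∀ j → ∑ ((M ᵀ) j) ≡ ℓ
  column-sum j = *-cancelˡ-≢0 ℓ≢0 (begin
    ℓ * ∑ ((M ᵀ) j) ≡⟨ sym (∑-*ˡ ℓ ((M ᵀ) j)) ⟩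
    ∑ (λ a → ℓ * M a j) ≡⟨ ∑-cong (λ a → trans (cong (_* M a j) (sym (row-sum a))) (sym (∑-*ʳ (M a j) (M a)))) ⟩
    ∑ (λ a → ∑ (λ i → M a i * M a j)) ≡⟨ ∑-swap (λ a i → M a i * M a j) ⟩
    ∑ (λ i → (M ᵀ) i ⋆ (M ᵀ) j) ≡⟨ ∑-cong (λ i → trans (orthogonal i j) (sym (ℤₚ.*-identityˡ (ℓ * ℓ * δ i j)))) ⟩
    ∑ (λ i → + 1 * (ℓ * ℓ * δ i j)) ≡⟨ ∑-scaled-δʳ (ℓ * ℓ) j (λ _ → + 1) ⟩
    ℓ * ℓ * + 1 ≡⟨ ℤₚ.*-identityʳ (ℓ * ℓ) ⟩
    ℓ * ℓ ∎)

  B-symmetric : ∀ i j → B i j ≡ B j i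
  B-symmetric i j = *-cancelˡ-≢0 ℓ²≢0 (trans (sym (conjugate i j)) (trans (⋆-adjMat G ((M ᵀ) i) ((M ᵀ) j))
    (trans (⋆-comm (A ⊙ (M ᵀ) i) ((M ᵀ) j)) (conjugate j i))))

  B-row-square : ∀ i → ℓ * ℓ * B i ⋆ B i ≡ (A ⊙ (M ᵀ) i) ⋆ (A ⊙ (M ᵀ) i)
  B-row-square i = *-cancelˡ-≢0 ℓ²≢0 (begin
    ℓ * ℓ * (ℓ * ℓ * B i ⋆ B i) ≡⟨ cong (ℓ * ℓ *_) (sym (∑-*ˡ (ℓ * ℓ) (λ j → B i j * B i j))) ⟩
    ℓ * ℓ * ∑ (λ j → ℓ * ℓ * (B i j * B i j)) ≡⟨ sym (∑-*ˡ (ℓ * ℓ) (λ j → ℓ * ℓ * (B i j * B i j))) ⟩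
    ∑ (λ j → ℓ * ℓ * (ℓ * ℓ * (B i j * B i j))) ≡⟨ ∑-cong (λ j → trans (square (ℓ * ℓ) (B i j)) (cong (λ z → z * z) (trans (sym (conjugate i j)) (⋆-adjMat G ((M ᵀ) i) ((M ᵀ) j))))) ⟩
    ∑ (λ j → (A ⊙ (M ᵀ) i) ⋆ (M ᵀ) j * (A ⊙ (M ᵀ) i) ⋆ (M ᵀ) j) ≡⟨ parseval (A ⊙ (M ᵀ) i) (A ⊙ (M ᵀ) i) ⟩
    ℓ * ℓ * (A ⊙ (M ᵀ) i) ⋆ (A ⊙ (M ᵀ) i) ∎)
    where
    square : ∀ c b → c * (c * (b * b)) ≡ c * b * (c * b)
    square = solve-∀

  ∑-B-square : ∑ (λ i → B i ⋆ B i) ≡ ∑ (λ a → A a ⋆ A a)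
  ∑-B-square = *-cancelˡ-≢0 ℓ²≢0 (begin
    ℓ * ℓ * ∑ (λ i → B i ⋆ B i) ≡⟨ sym (∑-*ˡ (ℓ * ℓ) (λ i → B i ⋆ B i)) ⟩
    ∑ (λ i → ℓ * ℓ * B i ⋆ B i) ≡⟨ ∑-cong B-row-square ⟩
    ∑ (λ i → ∑ (λ a → A a ⋆ (M ᵀ) i * A a ⋆ (M ᵀ) i)) ≡⟨ ∑-swap (λ i a → A a ⋆ (M ᵀ) i * A a ⋆ (M ᵀ) i) ⟩
    ∑ (λ a → ∑ (λ i → A a ⋆ (M ᵀ) i * A a ⋆ (M ᵀ) i)) ≡⟨ trans (∑-cong (λ a → parseval (A a) (A a))) (∑-*ˡ (ℓ * ℓ) (λ a → A a ⋆ A a)) ⟩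
    ℓ * ℓ * ∑ (λ a → A a ⋆ A a) ∎)

  ∑-B : ∑ (λ i → ∑ (B i)) ≡ ∑ (λ a → ∑ (A a))
  ∑-B = *-cancelˡ-≢0 ℓ²≢0 (begin
    ℓ * ℓ * ∑ (λ i → ∑ (B i)) ≡⟨ trans (sym (∑-*ˡ (ℓ * ℓ) (λ i → ∑ (B i)))) (∑-cong (λ i → trans (sym (∑-*ˡ (ℓ * ℓ) (B i))) (∑-cong (λ j → sym (conjugate i j))))) ⟩
    ∑ (λ i → ∑ (λ j → (M ᵀ) i ⋆ (A ⊙ (M ᵀ) j))) ≡⟨ ∑-cong (λ i → trans (∑-cong (λ j → sym (ℤₚ.*-identityˡ ((M ᵀ) i ⋆ (A ⊙ (M ᵀ) j))))) (sym (⋆-∑ ((M ᵀ) i) (λ _ → + 1) (λ j → A ⊙ (M ᵀ) j)))) ⟩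
    ∑ (λ i → (M ᵀ) i ⋆ (λ a → ∑ (λ j → + 1 * A a ⋆ (M ᵀ) j))) ≡⟨ ∑-cong (λ i → ⋆-cong {x = (M ᵀ) i} (λ _ → refl) (λ a → image a)) ⟩
    ∑ (λ i → (M ᵀ) i ⋆ (λ a → ℓ * ∑ (A a))) ≡⟨ ∑-swap (λ i a → M a i * (ℓ * ∑ (A a))) ⟩
    ∑ (λ a → ∑ (λ i → M a i * (ℓ * ∑ (A a)))) ≡⟨ ∑-cong (λ a → trans (∑-*ʳ (ℓ * ∑ (A a)) (M a)) (trans (cong (_* (ℓ * ∑ (A a))) (row-sum a)) (sym (ℤₚ.*-assoc ℓ ℓ (∑ (A a)))))) ⟩
    ∑ (λ a → ℓ * ℓ * ∑ (A a)) ≡⟨ ∑-*ˡ (ℓ * ℓ) (λ a → ∑ (A a)) ⟩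
    ℓ * ℓ * ∑ (λ a → ∑ (A a)) ∎)
    where
    image : ∀ a → ∑ (λ j → + 1 * A a ⋆ (M ᵀ) j) ≡ ℓ * ∑ (A a)
    image a = begin
      ∑ (λ j → + 1 * A a ⋆ (M ᵀ) j) ≡⟨ sym (⋆-∑ (A a) (λ _ → + 1) (M ᵀ)) ⟩
      A a ⋆ (λ c → ∑ (λ j → + 1 * M c j)) ≡⟨ ⋆-cong {x = A a} (λ _ → refl) (λ c → trans (∑-cong (λ j → ℤₚ.*-identityˡ (M c j))) (row-sum c)) ⟩
      ∑ (λ c → A a c * ℓ) ≡⟨ trans (∑-*ʳ ℓ (A a)) (ℤₚ.*-comm (∑ (A a)) ℓ) ⟩
      ℓ * ∑ (A a) ∎

  A-square : ∀ a c → A a c * A a c ≡ A a c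
  A-square a c with Graph.adj G a c
  ... | true  = refl
  ... | false = refl

  -- Conjugation preserves the trace of the square, and by regularity also the sum of all entries.
  -- Both agree for the 0-1 matrix A, so the nonnegative integers B_ij^2 - B_ij sum to zero.
  B-bool : ∀ i j → B i j ≡ + 0 ⊎ B i j ≡ + 1
  B-bool i j = idempotent (B i j) (∑-nonneg-≡0 {f = excess i} (λ j → 0≤x*x-x (B i j))
    (∑-nonneg-≡0 {f = λ i → ∑ (excess i)} (λ i → ∑-nonneg (λ j → 0≤x*x-x (B i j))) total i) j)
    where
    excess : Matrix ℤ n
    excess i j = B i j * B i j - B i j
    total : ∑ (λ i → ∑ (excess i)) ≡ + 0
    total = begin
      ∑ (λ i → ∑ (excess i)) ≡⟨ ∑-cong (λ i → trans (∑-+ (λ j → B i j * B i j) (λ j → - B i j)) (cong (_+_ (B i ⋆ B i)) (∑-neg (B i)))) ⟩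
      ∑ (λ i → B i ⋆ B i - ∑ (B i)) ≡⟨ trans (∑-+ (λ i → B i ⋆ B i) (λ i → - ∑ (B i))) (cong (_+_ (∑ (λ i → B i ⋆ B i))) (∑-neg (λ i → ∑ (B i)))) ⟩
      ∑ (λ i → B i ⋆ B i) - ∑ (λ i → ∑ (B i)) ≡⟨ cong₂ _-_ (trans ∑-B-square (∑-cong (λ a → ∑-cong (λ c → A-square a c)))) ∑-B ⟩
      ∑ (λ a → ∑ (A a)) - ∑ (λ a → ∑ (A a)) ≡⟨ ℤₚ.+-inverseʳ (∑ (λ a → ∑ (A a))) ⟩
      + 0 ∎

  -- The trace is invariant under conjugation and A has zero diagonal. As the entries of `B` are
  -- nonnegative, its diagonal then vanishes entrywise.
  B-trace : ∑ (λ i → B i i) ≡ + 0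
  B-trace = *-cancelˡ-≢0 ℓ²≢0 (begin
    ℓ * ℓ * ∑ (λ i → B i i) ≡⟨ trans (sym (∑-*ˡ (ℓ * ℓ) (λ i → B i i))) (∑-cong (λ i → sym (conjugate i i))) ⟩
    ∑ (λ i → ∑ (λ a → M a i * A a ⋆ (M ᵀ) i)) ≡⟨ ∑-swap (λ i a → M a i * A a ⋆ (M ᵀ) i) ⟩
    ∑ (λ a → ∑ (λ i → M a i * A a ⋆ (M ᵀ) i)) ≡⟨ ∑-zero (λ a → trans (∑-cong (λ i → cong (M a i *_) (⋆-comm (A a) ((M ᵀ) i)))) (trans (resolve (A a) a) (trans (cong (ℓ * ℓ *_) (adjMat-diagonal G a)) (ℤₚ.*-zeroʳ (ℓ * ℓ))))) ⟩
    + 0 ≡⟨ sym (ℤₚ.*-zeroʳ (ℓ * ℓ)) ⟩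
    ℓ * ℓ * + 0 ∎)

  B-diagonal : ∀ i → B i i ≡ + 0
  B-diagonal = ∑-nonneg-≡0 {f = λ i → B i i} (λ i → [ (λ e → ℤₚ.≤-reflexive (sym e)) , (λ e → subst (+ 0 ℤ.≤_) (sym e) (ℤ.+≤+ ℕ.z≤n)) ]′ (B-bool i i)) B-trace

  rotated : Graph n
  rotated = record
    { adj    = λ i j → isOne (B i j)
    ; sym    = λ i j → cong isOne (B-symmetric i j)
    ; irrefl = λ i → cong isOne (B-diagonal i)
    }

  rotated-adjMat : ∀ i j → adjMat rotated i j ≡ B i j
  rotated-adjMat i j = isOne-value (B-bool i j)

  rotated-scaled : Scaled G rotated ℓ M
  rotated-scaled = record
    { orthogonal = orthogonal
    ; intertwine = λ j a → *-cancelˡ-≢0 ℓ²≢0 (begin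
        ℓ * ℓ * (A ⊙ (M ᵀ) j) a ≡⟨ sym (resolve (A ⊙ (M ᵀ) j) a) ⟩
        ∑ (λ k → M a k * (M ᵀ) k ⋆ (A ⊙ (M ᵀ) j)) ≡⟨ ∑-cong (λ k → trans (cong (M a k *_) (trans (conjugate k j) (cong (ℓ * ℓ *_) (sym (rotated-adjMat k j))))) (rotate-* (M a k) (ℓ * ℓ) (adjMat rotated k j))) ⟩
        ∑ (λ k → ℓ * ℓ * (adjMat rotated k j * M a k)) ≡⟨ ∑-*ˡ (ℓ * ℓ) (λ k → adjMat rotated k j * M a k) ⟩
        ℓ * ℓ * ∑ (λ k → adjMat rotated k j * M a k) ∎)
    ; column-sum = column-sum
    ; row-sum = row-sum
    }
    where
    rotate-* : ∀ m c b → m * (c * b) ≡ c * (b * m)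
    rotate-* = solve-∀

-- Isomorphisms and the walk matrix.

∑-permute : (σ : Permutation′ n) (f : Fin n → ℤ) → ∑ (λ j → f (σ ⟨$⟩ʳ j)) ≡ ∑ f
∑-permute {n} σ f = begin
  ∑ (λ j → f (σ ⟨$⟩ʳ j)) ≡⟨ ∑-cong (λ j → sym (∑-δˡ (σ ⟨$⟩ʳ j) f)) ⟩
  ∑ (λ j → ∑ (λ k → δ (σ ⟨$⟩ʳ j) k * f k)) ≡⟨ ∑-swap (λ j k → δ (σ ⟨$⟩ʳ j) k * f k) ⟩
  ∑ (λ k → ∑ (λ j → δ (σ ⟨$⟩ʳ j) k * f k)) ≡⟨ ∑-cong (λ k → trans (∑-cong (λ j → trans (cong (_* f k) (move j k)) (ℤₚ.*-comm (δ j (σ ⟨$⟩ˡ k)) (f k)))) (∑-δʳ (σ ⟨$⟩ˡ k) (λ _ → f k))) ⟩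
  ∑ f ∎
  where
  move : ∀ j k → δ (σ ⟨$⟩ʳ j) k ≡ δ j (σ ⟨$⟩ˡ k)
  move j k with j ≟ (σ ⟨$⟩ˡ k)
  ... | yes refl = trans (cong (λ z → δ z k) (inverseʳ σ)) (δ-refl k)
  ... | no  j≢   = δ-≢ (λ eq → j≢ (trans (sym (inverseˡ σ)) (cong (σ ⟨$⟩ˡ_) eq)))

isomorphic-walkVec : {G H : Graph n} ((σ , _) : Isomorphic G H) → ∀ k i → walkVec H k (σ ⟨$⟩ʳ i) ≡ walkVec G k i
isomorphic-walkVec (σ , iso) zero    i = refl
isomorphic-walkVec {G = G} {H} (σ , iso) (suc k) i = trans (sym (∑-permute σ (λ j → adjMat H (σ ⟨$⟩ʳ i) j * walkVec H k j)))
  (∑-cong (λ j → cong₂ _*_ (cong (λ b → if b then + 1 else + 0) (iso i j)) (isomorphic-walkVec (σ , iso) k j)))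

walks-separate : {G : Graph n} {d : Fin n → ℤ} → SmithBases (W G) d → (∀ i → d i ≢ + 0) → ∀ y →
  (∀ (k : Fin n) → walkVec G (toℕ k) ⋆ y ≡ + 0) → ∀ a → y a ≡ + 0
walks-separate {n} {G} {d} S d≢0 y h a = trans (expand-u y a) (∑-zero (λ i → trans (cong (_* u i a) (coordinate i)) (ℤₚ.*-zeroˡ (u i a))))
  where
  open SmithBases S
  coordinate : ∀ i → b i ⋆ y ≡ + 0
  -- Divisibility by 0 is equality with 0, so the kernel lemma at N = 0 serves for exact equations.
  coordinate i = *-cancelˡ-≢0 {d i} {b i ⋆ y} {+ 0} (d≢0 i)
    (trans (ℤ∣.0∣⇒≡0 (SmithKernel.kernel-coordinate G S {+ 0} {y} (λ k → subst (+ 0 ∣_) (sym (h k)) ℤ∣.∣-refl) i)) (sym (ℤₚ.*-zeroʳ (d i))))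

-- `M` sends the walk vectors of G to `ℓ` times those of H, and the isomorphism matches the latter
-- with those of G again. So column `σ i` of `M` and `ℓ` times the unit vector at `i` have equal
-- pairings with all walk vectors and must coincide.
isomorphic⇒divisible : {G H : Graph n} {d : Fin n → ℤ} → SmithBases (W G) d → (∀ i → d i ≢ + 0) →
  ∀ {ℓ M} → Scaled G H ℓ M → Isomorphic G H → ∀ a j → ℓ ∣ M a j
isomorphic⇒divisible {n} {G} {H} S d≢0 {ℓ} {M} scaled iso a j =
  subst (λ j → ℓ ∣ M a j) (inverseʳ σ) (divides (δ (σ ⟨$⟩ˡ j) a) (trans (column (σ ⟨$⟩ˡ j) a) (ℤₚ.*-comm ℓ (δ (σ ⟨$⟩ˡ j) a))))
  where
  σ : Permutation′ n
  σ = proj₁ iso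
  column : ∀ i a → M a (σ ⟨$⟩ʳ i) ≡ ℓ * δ i a
  column i a = trans (lemma (M a (σ ⟨$⟩ʳ i)) ℓ (δ i a)) (trans (cong (_+ ℓ * δ i a) (walks-separate S d≢0 y vanish a)) (ℤₚ.+-identityˡ (ℓ * δ i a)))
    where
    y : Fin n → ℤ
    y a = + 1 * M a (σ ⟨$⟩ʳ i) + - ℓ * δ i a
    lemma : ∀ x p d → x ≡ + 1 * x + - p * d + p * d
    lemma = solve-∀
    cancel : ∀ p x → + 1 * (p * x) + - p * x ≡ + 0
    cancel = solve-∀
    vanish : ∀ k → walkVec G (toℕ k) ⋆ y ≡ + 0
    vanish k = trans (⋆-linear (walkVec G (toℕ k)) (+ 1) (- ℓ) ((M ᵀ) (σ ⟨$⟩ʳ i)) (δ i))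
      (trans (cong₂ (λ s t → + 1 * s + - ℓ * t)
          (trans (walkVec-⋆-column scaled (toℕ k) (σ ⟨$⟩ʳ i)) (cong (ℓ *_) (isomorphic-walkVec {G = G} {H} iso (toℕ k) i)))
          (trans (⋆-comm (walkVec G (toℕ k)) (δ i)) (∑-δˡ i (walkVec G (toℕ k)))))
        (cancel ℓ (walkVec G (toℕ k) i)))

-- The two directions of the equivalence.

module Characterisation {m p b : ℕ} (prime-p : Prime p) (odd-p : Odd p) (odd-b : Odd b) (sqf-b : SquareFree b) (p∤b : ¬ p ℕ∣.∣ b)
  {G : Graph (suc (suc m))} (snf : HasSNF (W G) (snfF (suc (suc m)) p b)) where

  open Family {m} {p} {b} prime-p odd-p odd-b sqf-b p∤b {G} snf
  open SmithBases S using (u; b⋆u) renaming (b to b*)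
  open SmithKernel G S using (u-kernel)
  open OddPart S (prime∤1 prime-p) ℤ∣.∣-refl (prime-unit prime-p) (prime∤d prime-p odd-p) p∣dι using (kernel-vanish; kernel-multiple; columns-⋆-adjMat)

  nontrivial-coordinate : ∀ {z} → Kernel G (+ p) z → ¬ (∀ a → + p ∣ z a) → ¬ + p ∣ b* ι ⋆ z
  nontrivial-coordinate {z} ker nontrivial h = nontrivial (kernel-vanish {z} ker h)

  generates : (∃[ M ] IntPrimitive p G M) → ∀ z → Kernel G (+ p) z → ¬ (∀ a → + p ∣ z a) → ∃[ Q ] Generates p z Q
  generates (M , prim) z ker nontrivial = intPrimitive⇒generates prime-p {G = G} {M} prim z
    (λ j → let c , h = kernel-multiple {z} {(M ᵀ) j} ker (nontrivial-coordinate {z} ker nontrivial) (IntPrimitive.kernel prim j) in c , λ i → ℤ∣.∣⇒∣ᵤ (h i))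

  -- Existence is decided by search. Were there none, every generalized cospectral graph would
  -- reduce to level one and be isomorphic to `G`.
  ¬dgs⇒intPrimitive : ¬ DGS G → ∃[ M ] IntPrimitive p G M
  ¬dgs⇒intPrimitive ¬dgs = found (∃-intPrimitive? p G)
    where
    isomorphic : ¬ (∃[ M ] IntPrimitive p G M) → ∀ {H} → Reduced H → Isomorphic G H
    isomorphic none (inj₁ (M , scaled)) = scaled₁⇒isomorphic {M = M} scaled
    isomorphic none (inj₂ (M , scaled , ¬all)) = contradiction (M , record
      { orthogonal = Scaled.orthogonal scaled ; row-sum = Scaled.row-sum scaled
      ; nonzero = ¬all ; kernel = column-kernel scaled ℤ∣.∣-refl }) none
    found : Dec (∃[ M ] IntPrimitive p G M) → ∃[ M ] IntPrimitive p G M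
    found (yes prim) = prim
    found (no none)  = contradiction (λ H cospectral → isomorphic none {H} (genCospectral⇒reduced cospectral)) ¬dgs

  d≢0 : ∀ i → d i ≢ + 0
  d≢0 i = split (i ≟ ι)
    where
    b≢0 : + b ≢ + 0
    b≢0 eq = odd-b (subst (2 ℕ∣.∣_) (sym (ℤₚ.+-injective eq)) (2 ℕ∣.∣0))
    split : Dec (i ≡ ι) → d i ≢ + 0
    split (yes i≡ι) eq = *-≢0 {+ 2} (λ ()) (*-≢0 (*-≢0 (prime≢0 prime-p) (prime≢0 prime-p)) b≢0) (trans (sym dι≡) (trans (cong d (sym i≡ι)) eq))
    split (no i≢ι) eq = [ (λ e → contradiction (trans (sym e) eq) λ ()) , (λ e → contradiction (trans (sym e) eq) λ ()) ]′ (snfF-1-or-2 m p b i i≢ι)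

  intPrimitive⇒¬dgs : ∃[ M ] IntPrimitive p G M → ¬ DGS G
  intPrimitive⇒¬dgs (M , prim) dgs = nonzero (isomorphic⇒divisible {G = G} {rotated} S d≢0 rotated-scaled
      (dgs rotated (scaled⇒genCospectral {G = G} {rotated} {+ p} {M} (prime≢0 prime-p) rotated-scaled)))
    where
    open IntPrimitive prim
    p²∣ : ∀ i j → + p * + p ∣ (M ᵀ) i ⋆ (M ᵀ) j
    p²∣ i j = subst (+ p * + p ∣_) (sym (orthogonal i j)) (ℤ∣.∣m⇒∣m*n (δ i j) ℤ∣.∣-refl)
    pivot : ∃[ j ] ¬ + p ∣ b* ι ⋆ (M ᵀ) j
    pivot = Finₚ.¬∀⟶∃¬ (suc (suc m)) (λ j → + p ∣ b* ι ⋆ (M ᵀ) j) (λ j → + p ℤ∣.∣? b* ι ⋆ (M ᵀ) j) (λ all → nonzero (λ a j → kernel-vanish {(M ᵀ) j} (kernel j) (all j) a))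
    integral : ∀ i j → + p * + p ∣ (M ᵀ) i ⋆ (adjMat G ⊙ (M ᵀ) j)
    integral = columns-⋆-adjMat p²∣dι {M} kernel p²∣ (proj₁ pivot) (proj₂ pivot)
    open Rotation {G = G} (prime≢0 prime-p) {M} orthogonal row-sum integral using (rotated; rotated-scaled)

  -- A concrete nontrivial kernel vector, to which the hypothesis on all z is applied; it is nonzero
  -- modulo p because its pairing with `b* ι` is 1.
  z₀ : Fin (suc (suc m)) → ℤ
  z₀ = u ι

  z₀-kernel : Kernel G (+ p) z₀
  z₀-kernel = u-kernel ι p∣dι

  z₀-nontrivial : ¬ (∀ a → + p ∣ z₀ a)
  z₀-nontrivial h = prime∤1 prime-p (subst (+ p ∣_) (b⋆u ι) (⋆-∣ʳ {x = b* ι} h))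

≡0[mod]⇒∣ : ∀ {p x} → x ≡ + 0 [mod p ] → + p ∣ x
≡0[mod]⇒∣ {p} {x} h = subst (+ p ∣_) (ℤₚ.+-identityʳ x) (ℤ∣.∣ᵤ⇒∣ h)

∣⇒≡0[mod] : ∀ {p x} → + p ∣ x → x ≡ + 0 [mod p ]
∣⇒≡0[mod] {p} {x} h = ℤ∣.∣⇒∣ᵤ (subst (+ p ∣_) (sym (ℤₚ.+-identityʳ x)) h)

p²∣det⇒∏ : ∀ {p} {M : Matrix ℤ n} {d : Fin n → ℤ} → HasSNF M d → (+ (p ℕ.* p)) ℤDiv.∣ detℤ M → + p * + p ∣ ∏ d
p²∣det⇒∏ {p = p} {M} {d} snf h = let (x , unit , eq) , _ = hasSNF⇒det {M = M} {d} snf in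
  ∣-associate (detℤ M) (∏ d) x unit eq (subst (_∣ detℤ M) (ℤₚ.pos-* p p) (ℤ∣.∣ᵤ⇒∣ h))

-- The family hides its own prime q behind an existential. If p differed from q, cancelling the
-- power of 2 and q^2 in the determinant would leave p^2 dividing the square-free b.
same-prime : ∀ {m p q b} → Prime p → Odd p → Prime q → SquareFree b → + p * + p ∣ ∏ (snfF (suc (suc m)) q b) → p ≡ q
same-prime {m} {p} {q} {b} prime-p odd-p prime-q sqf h = decide (p ℕ.≟ q)
  where
  p∤q : p ≢ q → ¬ + p ∣ + q
  p∤q p≢q h = p≢q (prime-∣-prime prime-p prime-q (ℤ∣.∣⇒∣ᵤ h))
  p²∣b : p ≢ q → + p * + p ∣ + b
  p²∣b p≢q = prime²-cancel (+ q * + q) (+ b) prime-p ([ p∤q p≢q , p∤q p≢q ]′ ∘ prime-∣-* {x = + q} {+ q} prime-p)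
    (subst (+ p * + p ∣_) (trans (ℤₚ.pos-* (q ℕ.* q) b) (cong (_* + b) (ℤₚ.pos-* q q)))
      (prime²-cancel (+ (2 ^ ⌊ suc (suc m) /2⌋)) (+ (q ℕ.* q ℕ.* b)) prime-p (prime∤2^ prime-p odd-p ⌊ suc (suc m) /2⌋) (subst (+ p * + p ∣_) (∏-snfF m q b) h)))
  decide : Dec (p ≡ q) → p ≡ q
  decide (yes eq)  = eq
  decide (no p≢q) = contradiction (p²∣b p≢q) (squareFree⇒¬∣ prime-p sqf)

theorem2p19 : (n p : ℕ) → OddPrime p → (G : Graph n) → inFp p G →
    (¬ DGS G) ⇔
    ((z : Fin n → ℤ) → ¬ (∀ i → z i ≡ + 0 [mod p ]) →
    (∀ k → LZ.sumF (λ i → W G i k Data.Integer.* z i) ≡ + 0 [mod p ]) →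
    ∃[ Q ] Generates p z Q)
-- For orders 0 and 1 the product of the invariant factors is 1, which p^2 cannot divide.
theorem2p19 zero p (prime-p , _) G ((b , q , _ , _ , _ , _ , snf) , p²∣det) =
  contradiction (ℤ∣.∣-trans (divides (+ p) refl) (p²∣det⇒∏ {p = p} {M = W G} {snfF 0 q b} snf p²∣det)) (prime∤1 prime-p)
theorem2p19 (suc zero) p (prime-p , _) G ((b , q , _ , _ , _ , _ , snf) , p²∣det) =
  contradiction (ℤ∣.∣-trans (divides (+ p) refl) (p²∣det⇒∏ {p = p} {M = W G} {snfF 1 q b} snf p²∣det)) (prime∤1 prime-p)
theorem2p19 (suc (suc m)) p (prime-p , odd-p) G ((b , q , odd-b , sqf-b , (prime-q , _) , q∤b , snf) , p²∣det) =
  assemble (same-prime {m} {p} {q} {b} prime-p odd-p prime-q sqf-b (p²∣det⇒∏ {p = p} {M = W G} {snfF (suc (suc m)) q b} snf p²∣det)) q∤b snf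
  where
  assemble : p ≡ q → ¬ q ℕ∣.∣ b → HasSNF (W G) (snfF (suc (suc m)) q b) → (¬ DGS G) ⇔
    ((z : Fin (suc (suc m)) → ℤ) → ¬ (∀ i → z i ≡ + 0 [mod p ]) →
    (∀ k → LZ.sumF (λ i → W G i k Data.Integer.* z i) ≡ + 0 [mod p ]) → ∃[ Q ] Generates p z Q)
  assemble refl p∤b snf = mk⇔
    (λ ¬dgs z nontrivial ker → generates (¬dgs⇒intPrimitive ¬dgs) z (λ k → ≡0[mod]⇒∣ (ker k)) (λ h → nontrivial (λ i → ∣⇒≡0[mod] (h i))))
    (λ all → let Q , gen = all z₀ (λ h → z₀-nontrivial (λ a → ≡0[mod]⇒∣ (h a))) (λ k → ∣⇒≡0[mod] (z₀-kernel k)) in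
      intPrimitive⇒¬dgs (pQint p Q , generates⇒intPrimitive prime-p {G = G} {z₀} z₀-kernel Q gen))
    where open Characterisation {m} {p} {b} prime-p odd-p odd-b sqf-b p∤b {G} snf
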